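{- (1) \textsc{Collision} polynomial-time reduces to \textsc{Bad $2$-Coloring} (so \textsc{Bad $2$-Coloring} is PPP-hard). (2) For every $k\ge 2$, \textsc{Bad $k$-Coloring} polynomial-time reduces to \textsc{$k$-Tur\'an}; in particular \textsc{Bad $2$-Coloring} reduces to \textsc{Mantel}. (3) For every $k\ge 2$, \textsc{Bad $k$-Coloring} polynomial-time reduces to \textsc{Bad $(k+1)$-Coloring}. (4) For every $k\ge 2$, \textsc{$k$-Tur\'an} polynomial-time reduces to \textsc{$(k+1)$-Tur\'an}.
   Context: All circuits are Boolean circuits of size polynomial in $n$; $k$ is a fixed constant. A search problem $A$ polynomial-time reduces to a search problem $B$ if there are polynomial-time computable maps $f,g$ such that for every instance $I$ of $A$, $f(I)$ is an instance of $B$, and for every solution $s$ of $f(I)$, $g(I,s)$ is a solution of $I$. \textsc{Collision}: given a poly($n$)-size circuit $C:\{0,1\}^n\to\{0,1\}^n$ (identified with $[0,2^n-1]\to[0,2^n-1]$), find either $x$ with $C(x)=0$, or $x\neq y$ with $C(x)=C(y)$. PPP is the class of search problems reducible to \textsc{Collision}. \textsc{Bad $k$-Coloring}: the vertex set is $V=[0,k2^n-1]$. The input is a poly($n$)-size circuit $E:[0,\binom{k}{2}2^{2n}]\to V^2$ (listing $\binom{k}{2}2^{2n}+1$ purported edges of a graph on $V$) and a poly($n$)-size circuit $C:V\to\{1,\dots,k\}$ (a coloring of the vertices). A solution is either two distinct indices $i\neq j$ such that $E(i)$ and $E(j)$ are the same unordered pair, or an index $i$ with $E(i)=(u,v)$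 and $C(u)=C(v)$ (this includes the case $u=v$). \textsc{$k$-Tur\'an}: the vertex set is $V=[0,k2^n-1]$ and the input is a poly($n$)-size circuit $E:[0,\binom{k}{2}2^{2n}]\to V^2$. A solution is either an error in $E$ — an index $i$ with $E(i)=(u,u)$, or two distinct indices $i\neq j$ with $E(i),E(j)$ the same unordered pair — or a set of $\binom{k+1}{2}$ indices whose edges $E(\cdot)$ form a clique on $k+1$ vertices. \textsc{Mantel} is \textsc{$2$-Tur\'an}. -}

module Defs where

open import Data.Bool using (Bool; true; false; _∧_; _∨_) renaming (not to ¬ᵇ)
open import Data.Fin using (Fin; zero; suc)
open import Data.Nat using (ℕ; zero; suc; _+_; _*_; _^_; _≤_; _<_)
open import Data.Nat.Combinatorics using () renaming (_C_ to _choose_)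
open import Data.Nat.Logarithm using (⌈log₂_⌉)
open import Data.Product using (Σ; ∃; ∃-syntax; _×_; _,_; proj₁; proj₂)
open import Data.Sum using (_⊎_)
open import Data.Vec using (Vec; []; _∷_; lookup; map; replicate; take; drop)
open import Data.Vec.Membership.Propositional using (_∈_)
open import Data.Vec.Relation.Unary.All using (All)
open import Data.Vec.Relation.Unary.Unique.Propositional using (Unique)
open import Relation.Binary.PropositionalEquality using (_≡_; _≢_)

------------------------------------------------------------------------
-- Polynomials in one variable with natural number coefficients

infixl 6 _⊕_
infixl 7 _⊗_

data Poly : Set where
  con     : ℕ → Poly
  var     : Poly
  _⊕_ _⊗_ : Poly → Poly → Poly

⟦_⟧ : Poly → ℕ → ℕ
⟦ con c ⟧ n = c
⟦ var   ⟧ n = n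
⟦ p ⊕ q ⟧ n = ⟦ p ⟧ n + ⟦ q ⟧ n
⟦ p ⊗ q ⟧ n = ⟦ p ⟧ n * ⟦ q ⟧ n

------------------------------------------------------------------------
-- Polynomial-time computation
--
-- The machine model is a WHILE language over binary trees, in the style
-- of Jones, "Computability and Complexity".  A program acts on a single
-- tree, which plays the role of the store.

data Tree : Set where
  leaf : Tree
  node : Tree → Tree → Tree

size : Tree → ℕ
size leaf       = 1
size (node x y) = suc (size x + size y)

leftOf rightOf : Tree → Tree
leftOf  leaf       = leaf
leftOf  (node x y) = x
rightOf leaf       = leaf
rightOf (node x y) = y

data Prog : Set where
  skip nil left right : Prog
  pair then           : Prog → Prog → Prog
  cond                : Prog → Prog → Prog
  while               : Prog → Prog

-- Run P x y t: on input x the program P halts with output y in time t.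
-- Every step is charged the full size of the tree it acts on, rather
-- than unit cost.  This makes the size of the output at most the running
-- time (with unit costs, repeated pairing could build exponentially large
-- trees in polynomial time), so that polynomial time here agrees with
-- polynomial time on Turing machines.
--
-- The tests of cond and while look at the left subtree, a leaf meaning
-- "false".

data Run : Prog → Tree → Tree → ℕ → Set where
  skip  : ∀ {x} → Run skip x x (size x)
  nil   : ∀ {x} → Run nil x leaf (size x)
  left  : ∀ {x} → Run left x (leftOf x) (size x)
  right : ∀ {x} → Run right x (rightOf x) (size x)
  pair  : ∀ {P Q x y z s t} → Run P x y s → Run Q x z t →
          Run (pair P Q) x (node y z) (size x + s + t)
  then  : ∀ {P Q x y z s t} → Run P x y s → Run Q y z t →
          Run (then P Q) x z (s + t)
  cond-true  : ∀ {P Q x a b y t} → leftOf x ≡ node a b → Run P x y t →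
               Run (cond P Q) x y (size x + t)
  cond-false : ∀ {P Q x y t} → leftOf x ≡ leaf → Run Q x y t →
               Run (cond P Q) x y (size x + t)
  while-true  : ∀ {P x a b y z s t} → leftOf x ≡ node a b →
                Run P x y s → Run (while P) y z t →
                Run (while P) x z (size x + s + t)
  while-false : ∀ {P x} → leftOf x ≡ leaf → Run (while P) x x (size x)

-- A is the domain of a map; the first argument encodes an element of the
-- domain, the second encodes the value of the map at that element.

PolyTime : {A : Set} → (A → Tree) → (A → Tree) → Set
PolyTime {A} input output =
  ∃[ P ] ∃[ p ] ((a : A) →
    ∃[ t ] (Run P (input a) (output a) t × t ≤ ⟦ p ⟧ (size (input a))))

------------------------------------------------------------------------
-- Search problems and reductions

record SearchProblem : Set₁ where
  field
    Instance       : Set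
    Solution       : Instance → Set
    encodeInstance : Instance → Tree
    encodeSolution : ∀ {I} → Solution I → Tree

open SearchProblem

record Reduces (A B : SearchProblem) : Set where
  field
    f          : Instance A → Instance B
    g          : (I : Instance A) → Solution B (f I) → Solution A I
    f-polyTime : PolyTime (encodeInstance A) (λ I → encodeInstance B (f I))
    g-polyTime : PolyTime {Σ (Instance A) (λ I → Solution B (f I))}
                   (λ (I , s) → node (encodeInstance A I) (encodeSolution B s))
                   (λ (I , s) → encodeSolution A (g I s))

-- A problem whose instances are poly(n)-size circuits: the argument is the
-- polynomial in n that bounds the size of the circuits.

CircuitProblem : Set₁
CircuitProblem = Poly → SearchProblem

-- Instances of size poly(n) are to be mapped to instances of size poly(n),
-- for a possibly larger polynomial.

infix 4 _≤ₚ_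

_≤ₚ_ : CircuitProblem → CircuitProblem → Set
A ≤ₚ B = ∀ p → ∃[ q ] Reduces (A p) (B q)

------------------------------------------------------------------------
-- Boolean circuits

Word : ℕ → Set
Word w = Vec Bool w

-- The number with the given binary digits, least significant digit first.

value : ∀ {w} → Word w → ℕ
value []           = 0
value (false ∷ bs) = 2 * value bs
value (true  ∷ bs) = 1 + 2 * value bs

data Gate (w : ℕ) : Set where
  const  : Bool → Gate w
  not    : Fin w → Gate w
  and or : Fin w → Fin w → Gate w

-- Straight-line programs from w to w′ wires.  Each gate adds one wire, in
-- front of the existing ones, so that wires are de Bruijn indices.

data Gates : ℕ → ℕ → Set where
  []  : ∀ {w} → Gates w w
  _∷_ : ∀ {w w′} → Gate w → Gates (suc w) w′ → Gates w w′

record Circuit (m n : ℕ) : Set where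
  constructor circuit
  field
    {wires} : ℕ
    gates   : Gates m wires
    outputs : Vec (Fin wires) n

open Circuit

evalGate : ∀ {w} → Gate w → Word w → Bool
evalGate (const b) ws = b
evalGate (not i)   ws = ¬ᵇ (lookup ws i)
evalGate (and i j) ws = lookup ws i ∧ lookup ws j
evalGate (or i j)  ws = lookup ws i ∨ lookup ws j

evalGates : ∀ {w w′} → Gates w w′ → Word w → Word w′
evalGates []       ws = ws
evalGates (g ∷ gs) ws = evalGates gs (evalGate g ws ∷ ws)

eval : ∀ {m n} → Circuit m n → Word m → Word n
eval C x = map (lookup (evalGates (gates C) x)) (outputs C)

countGates : ∀ {w w′} → Gates w w′ → ℕ
countGates []       = 0
countGates (_ ∷ gs) = suc (countGates gs)

circuitSize : ∀ {m n} → Circuit m n → ℕ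
circuitSize C = countGates (gates C)

------------------------------------------------------------------------
-- Encodings.  Numbers are written in unary.

encodeℕ : ℕ → Tree
encodeℕ zero    = leaf
encodeℕ (suc n) = node leaf (encodeℕ n)

encodeFin : ∀ {n} → Fin n → Tree
encodeFin zero    = leaf
encodeFin (suc i) = node leaf (encodeFin i)

encodeBool : Bool → Tree
encodeBool false = leaf
encodeBool true  = node leaf leaf

encodeVec : ∀ {A : Set} {n} → (A → Tree) → Vec A n → Tree
encodeVec enc []       = leaf
encodeVec enc (x ∷ xs) = node (enc x) (encodeVec enc xs)

encodeWord : ∀ {w} → Word w → Tree
encodeWord = encodeVec encodeBool

encodeGate : ∀ {w} → Gate w → Tree
encodeGate (const b) = node (encodeℕ 0) (encodeBool b)
encodeGate (not i)   = node (encodeℕ 1) (encodeFin i)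
encodeGate (and i j) = node (encodeℕ 2) (node (encodeFin i) (encodeFin j))
encodeGate (or i j)  = node (encodeℕ 3) (node (encodeFin i) (encodeFin j))

encodeGates : ∀ {w w′} → Gates w w′ → Tree
encodeGates []       = leaf
encodeGates (g ∷ gs) = node (encodeGate g) (encodeGates gs)

encodeCircuit : ∀ {m n} → Circuit m n → Tree
encodeCircuit C = node (encodeGates (gates C)) (encodeVec encodeFin (outputs C))

------------------------------------------------------------------------
-- Collision

module _ (p : Poly) where

  record CollisionInstance : Set where
    field
      n       : ℕ
      C       : Circuit n n
      C-small : circuitSize C ≤ ⟦ p ⟧ n

  open CollisionInstance

  data CollisionSolution (I : CollisionInstance) : Set where
    preimage : (x : Word (n I)) → eval (C I) x ≡ replicate (n I) false →
               CollisionSolution I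
    collide  : (x y : Word (n I)) → x ≢ y → eval (C I) x ≡ eval (C I) y →
               CollisionSolution I

  encodeCollisionSolution : ∀ {I} → CollisionSolution I → Tree
  encodeCollisionSolution (preimage x _)    =
    node (encodeℕ 0) (encodeWord x)
  encodeCollisionSolution (collide x y _ _) =
    node (encodeℕ 1) (node (encodeWord x) (encodeWord y))

Collision : CircuitProblem
Collision p = record
  { Instance       = CollisionInstance p
  ; Solution       = CollisionSolution p
  ; encodeInstance = λ I → let open CollisionInstance I in
                     node (encodeℕ n) (encodeCircuit C)
  ; encodeSolution = encodeCollisionSolution p
  }

PPP : SearchProblem → Set
PPP A = ∃[ p ] Reduces A (Collision p)

PPP-Hard : CircuitProblem → Set₁
PPP-Hard B = (A : SearchProblem) → PPP A → ∃[ q ] Reduces A (B q)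

------------------------------------------------------------------------
-- Graphs on [0, k 2ⁿ - 1] listed by circuits
--
-- Elements of a range of numbers are words of the least sufficient width
-- whose value lies in the range.  The widths for [0, k 2ⁿ - 1], for
-- [0, (k choose 2) 2²ⁿ] and for {1, …, k} are as follows.

vertexBits indexBits : ℕ → ℕ → ℕ
vertexBits k n = n + ⌈log₂ k ⌉
indexBits  k n = (n + n) + ⌈log₂ suc (k choose 2) ⌉

colourBits : ℕ → ℕ
colourBits k = ⌈log₂ suc k ⌉

IsVertex : ∀ k n → Word (vertexBits k n) → Set
IsVertex k n v = value v < k * 2 ^ n

IsIndex : ∀ k n → Word (indexBits k n) → Set
IsIndex k n i = value i ≤ (k choose 2) * 2 ^ (2 * n)

IsColour : ∀ k → Word (colourBits k) → Set
IsColour k c = 1 ≤ value c × value c ≤ k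

EdgeCircuit : ℕ → ℕ → Set
EdgeCircuit k n = Circuit (indexBits k n) (vertexBits k n + vertexBits k n)

edge : ∀ k n → EdgeCircuit k n → Word (indexBits k n) →
       Word (vertexBits k n) × Word (vertexBits k n)
edge k n E i = take (vertexBits k n) (eval E i) , drop (vertexBits k n) (eval E i)

SamePair : {A : Set} → A × A → A × A → Set
SamePair (u , v) (u′ , v′) = (u ≡ u′ × v ≡ v′) ⊎ (u ≡ v′ × v ≡ u′)

-- E maps the range of indices to pairs of vertices.

EdgesInRange : ∀ k n → EdgeCircuit k n → Set
EdgesInRange k n E = ∀ i → IsIndex k n i →
  IsVertex k n (proj₁ (edge k n E i)) × IsVertex k n (proj₂ (edge k n E i))

------------------------------------------------------------------------
-- Bad k-Coloring

module _ (k : ℕ) (p : Poly) where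

  record BadColoringInstance : Set where
    field
      n         : ℕ
      E         : EdgeCircuit k n
      C         : Circuit (vertexBits k n) (colourBits k)
      E-small   : circuitSize E ≤ ⟦ p ⟧ n
      C-small   : circuitSize C ≤ ⟦ p ⟧ n
      E-inRange : EdgesInRange k n E
      C-inRange : ∀ v → IsVertex k n v → IsColour k (eval C v)

  data BadColoringSolution (I : BadColoringInstance) : Set where
    repeated : let open BadColoringInstance I in
      (i j : Word (indexBits k n)) → IsIndex k n i → IsIndex k n j → i ≢ j →
      SamePair (edge k n E i) (edge k n E j) → BadColoringSolution I
    monochromatic : let open BadColoringInstance I in
      (i : Word (indexBits k n)) → IsIndex k n i →
      eval C (proj₁ (edge k n E i)) ≡ eval C (proj₂ (edge k n E i)) →
      BadColoringSolution I

  encodeBadColoringSolution : ∀ {I} → BadColoringSolution I → Tree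
  encodeBadColoringSolution (repeated i j _ _ _ _) =
    node (encodeℕ 0) (node (encodeWord i) (encodeWord j))
  encodeBadColoringSolution (monochromatic i _ _)  =
    node (encodeℕ 1) (encodeWord i)

BadColoring : ℕ → CircuitProblem
BadColoring k p = record
  { Instance       = BadColoringInstance k p
  ; Solution       = BadColoringSolution k p
  ; encodeInstance = λ I → let open BadColoringInstance I in
                     node (encodeℕ n) (node (encodeCircuit E) (encodeCircuit C))
  ; encodeSolution = encodeBadColoringSolution k p
  }

------------------------------------------------------------------------
-- k-Turán

-- The given pairs are, up to orientation, exactly the pairs of distinct
-- elements of some set of r vertices.

FormClique : {A : Set} {m : ℕ} (r : ℕ) → Vec (A × A) m → Set
FormClique {A} r es = Σ (Vec A r) λ vs →
  Unique vs ×
  All (λ (u , v) → u ∈ vs × v ∈ vs × u ≢ v) es ×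
  (∀ {u v} → u ∈ vs → v ∈ vs → u ≢ v → ∃[ e ] (e ∈ es × SamePair e (u , v)))

module _ (k : ℕ) (p : Poly) where

  record TuránInstance : Set where
    field
      n         : ℕ
      E         : EdgeCircuit k n
      E-small   : circuitSize E ≤ ⟦ p ⟧ n
      E-inRange : EdgesInRange k n E

  data TuránSolution (I : TuránInstance) : Set where
    loop : let open TuránInstance I in
      (i : Word (indexBits k n)) → IsIndex k n i →
      proj₁ (edge k n E i) ≡ proj₂ (edge k n E i) → TuránSolution I
    repeated : let open TuránInstance I in
      (i j : Word (indexBits k n)) → IsIndex k n i → IsIndex k n j → i ≢ j →
      SamePair (edge k n E i) (edge k n E j) → TuránSolution I
    clique : let open TuránInstance I in
      (is : Vec (Word (indexBits k n)) (suc k choose 2)) →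
      All (IsIndex k n) is → Unique is →
      FormClique (suc k) (map (edge k n E) is) → TuránSolution I

  encodeTuránSolution : ∀ {I} → TuránSolution I → Tree
  encodeTuránSolution (loop i _ _)           =
    node (encodeℕ 0) (encodeWord i)
  encodeTuránSolution (repeated i j _ _ _ _) =
    node (encodeℕ 1) (node (encodeWord i) (encodeWord j))
  encodeTuránSolution (clique is _ _ _)      =
    node (encodeℕ 2) (encodeVec encodeWord is)

Turán : ℕ → CircuitProblem
Turán k p = record
  { Instance       = TuránInstance k p
  ; Solution       = TuránSolution k p
  ; encodeInstance = λ I → let open TuránInstance I in
                     node (encodeℕ n) (encodeCircuit E)
  ; encodeSolution = encodeTuránSolution k p
  }

Mantel : CircuitProblem
Mantel = Turán 2

{-# OPTIONS --safe #-}
-- Collision reduces to Bad 2-Coloring by listing the edges {C(x), C(y)} of a bipartite graph,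
-- with one more edge {0, 0}: an edge listed twice is a collision or a preimage of 0.  From
-- Bad k-Coloring to k-Turán one forgets the colouring, since a clique on k + 1 vertices has a
-- monochromatic edge.  To go from k to k + 1, one adds 2ⁿ vertices joined to all the old ones;
-- they have a colour of their own, and a clique contains at most one of them.
--
-- For the time bounds, polynomial time is shown to be closed under loops whose steps add a
-- bounded amount to the accumulator, and gate lists are composed by appending them: if the
-- inputs of a circuit are first copied to the front, then its gates keep their encoding, as
-- wires are de Bruijn indices.
module Submission where

open import Defs
open import Data.Bool using (Bool; true; false; _∧_; _∨_; T; if_then_else_) renaming (not to ¬ᵇ; _≟_ to _≟ᵇ_)
open import Data.Bool.Properties using (∨-idem; ∨-identityʳ; ∧-assoc)
open import Data.Empty using (⊥; ⊥-elim)
open import Data.Fin using (Fin; zero; suc; toℕ; fromℕ<; _↑ˡ_; _↑ʳ_)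
open import Data.Fin.Properties using (toℕ-↑ˡ; toℕ-↑ʳ; toℕ-fromℕ<; pigeonhole; injective⇒≤) renaming (<⇒≢ to <ᶠ⇒≢; 0≢1+n to 0≢1+nᶠ)
open import Data.Nat using (ℕ; zero; suc; _+_; _*_; _∸_; _^_; _⊓_; _≤_; _<_; z≤n; s≤s; s≤s⁻¹; _<ᵇ_; _<?_; ⌈_/2⌉; ⌊_/2⌋)
open import Data.Nat.Combinatorics using (nC1≡n; nCk+nC[k+1]≡[n+1]C[k+1]) renaming (_C_ to _choose_)
open import Data.Nat.Induction using (<-wellFounded)
open import Data.Nat.Logarithm using (⌈log₂_⌉)
open import Data.Nat.Logarithm.Core using (⌈log2⌉)
open import Data.Nat.Properties hiding (_≟_)
open import Data.Nat.Solver using (module +-*-Solver)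
open import Data.Product using (Σ; ∃-syntax; _×_; _,_; proj₁; proj₂)
open import Data.Sum using (_⊎_; inj₁; inj₂)
open import Data.Vec using (Vec; []; _∷_; [_]; _++_; lookup; map; replicate; take; drop; tabulate; zipWith; head; tail)
open import Data.Vec.Membership.Propositional using (_∈_)
open import Data.Vec.Membership.Propositional.Properties using (∈-lookup; ∈-map⁺)
open import Data.Vec.Properties using (lookup-++ˡ; lookup-++ʳ; map-++; map-∘; map-cong; tabulate-∘; tabulate-cong; tabulate∘lookup; take++drop≡id; ++-injectiveˡ; ++-injectiveʳ; ≡-dec)
open import Data.Vec.Relation.Unary.All using (All; []; _∷_) renaming (lookup to All-lookup)
open import Data.Vec.Relation.Unary.Any using (here; there; index)
open import Data.Vec.Relation.Unary.Any.Properties using (lookup-index)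
open import Data.Vec.Relation.Unary.Unique.Propositional using (Unique; []; _∷_)
open import Data.Vec.Relation.Unary.Unique.Propositional.Properties using (lookup-injective)
open import Function using (_∘_; id)
import Induction.WellFounded as WF
open import Relation.Binary using (DecidableEquality)
open import Relation.Binary.PropositionalEquality hiding ([_])
open import Relation.Nullary using (does; Dec; yes; no; ¬_)

-- Vertices and indices are split into `n` low bits (`n + n` for an index) and a block number of
-- constant width. The low bits are only copied, set to zero or fed to the given circuits; all
-- arithmetic happens in the block, where truth tables suffice. This works because indices come in
-- blocks of 2²ⁿ: for `k = 2` the added edge is the only valid index with nonzero block, and passing
-- from `k` to `k + 1` needs exactly `k` more blocks, since (k + 1 choose 2) = k + (k choose 2).
-- `PolyTime` sees only encodings, whereas solutions carry proofs. Each solution map is therefore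
-- matched with a function on trees that makes the same choices without the proofs. For cliques the
-- obstacle is a length. A solution must list exactly (k + 1 choose 2) indices, while discarding the
-- edges at one vertex of a larger clique gives a list whose length is known only after counting
-- edges.

-- Polynomial time: composition, branching and loops

_⊚_ : Poly → Poly → Poly
con c   ⊚ q = con c
var     ⊚ q = q
(p ⊕ r) ⊚ q = (p ⊚ q) ⊕ (r ⊚ q)
(p ⊗ r) ⊚ q = (p ⊚ q) ⊗ (r ⊚ q)

⟦⟧-⊚ : ∀ p q n → ⟦ p ⊚ q ⟧ n ≡ ⟦ p ⟧ (⟦ q ⟧ n)
⟦⟧-⊚ (con c) q n = refl
⟦⟧-⊚ var     q n = refl
⟦⟧-⊚ (p ⊕ r) q n = cong₂ _+_ (⟦⟧-⊚ p q n) (⟦⟧-⊚ r q n)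
⟦⟧-⊚ (p ⊗ r) q n = cong₂ _*_ (⟦⟧-⊚ p q n) (⟦⟧-⊚ r q n)

⟦⟧-mono : ∀ p {m n} → m ≤ n → ⟦ p ⟧ m ≤ ⟦ p ⟧ n
⟦⟧-mono (con c) m≤n = ≤-refl
⟦⟧-mono var     m≤n = m≤n
⟦⟧-mono (p ⊕ r) m≤n = +-mono-≤ (⟦⟧-mono p m≤n) (⟦⟧-mono r m≤n)
⟦⟧-mono (p ⊗ r) m≤n = *-mono-≤ (⟦⟧-mono p m≤n) (⟦⟧-mono r m≤n)

⟦⟧-⊚-mono : ∀ p q {m n} → m ≤ ⟦ q ⟧ n → ⟦ p ⟧ m ≤ ⟦ p ⊚ q ⟧ n
⟦⟧-⊚-mono p q m≤ = ≤-trans (⟦⟧-mono p m≤) (≤-reflexive (sym (⟦⟧-⊚ p q _)))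

size-pos : ∀ x → 1 ≤ size x
size-pos leaf       = ≤-refl
size-pos (node x y) = s≤s z≤n

size-leftOf : ∀ x → size (leftOf x) ≤ size x
size-leftOf leaf       = ≤-refl
size-leftOf (node x y) = m≤n⇒m≤1+n (m≤m+n (size x) (size y))

size-rightOf : ∀ x → size (rightOf x) ≤ size x
size-rightOf leaf       = ≤-refl
size-rightOf (node x y) = m≤n⇒m≤1+n (m≤n+m (size y) (size x))

-- Every step is charged the size of its tree, so no output is larger than the time spent on it.
-- `thenₚ` and `consGrowth` rest on this: intermediate results have polynomial size.
size≤time : ∀ {P x y t} → Run P x y t → size y ≤ t
size≤time skip  = ≤-refl
size≤time (nil {x}) = size-pos x
size≤time (left {x}) = size-leftOf x
size≤time (right {x}) = size-rightOf x
size≤time (pair {x = x} {y} {z} {s} {t} r r′) = begin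
  suc (size y + size z)  ≤⟨ +-mono-≤ (size-pos x) (+-mono-≤ (size≤time r) (size≤time r′)) ⟩
  size x + (s + t)       ≡⟨ sym (+-assoc (size x) s t) ⟩
  size x + s + t         ∎
  where open ≤-Reasoning
size≤time (then {s = s} r r′) = ≤-trans (size≤time r′) (m≤n+m _ s)
size≤time (cond-true {x = x} _ r) = ≤-trans (size≤time r) (m≤n+m _ (size x))
size≤time (cond-false {x = x} _ r) = ≤-trans (size≤time r) (m≤n+m _ (size x))
size≤time (while-true _ _ r) = ≤-trans (size≤time r) (m≤n+m _ _)
size≤time (while-false _) = ≤-refl

private variable
  A B : Set
  i o : A → Tree

bound : PolyTime i o → Poly
bound (_ , p , _) = p

size-bound : (c : PolyTime i o) → ∀ a → size (o a) ≤ ⟦ bound c ⟧ (size (i a))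
size-bound (_ , _ , r) a = let (_ , run , t≤) = r a in ≤-trans (size≤time run) t≤

opaque
  idₚ : PolyTime i i
  idₚ = skip , var , λ a → _ , skip , ≤-refl

  leftₚ : PolyTime i o → PolyTime i (λ a → leftOf (o a))
  leftₚ c@(P , p , r) = then P left , p ⊕ p , λ a →
    let (_ , run , t≤) = r a in _ , then run left , +-mono-≤ t≤ (size-bound c a)

  rightₚ : PolyTime i o → PolyTime i (λ a → rightOf (o a))
  rightₚ c@(P , p , r) = then P right , p ⊕ p , λ a →
    let (_ , run , t≤) = r a in _ , then run right , +-mono-≤ t≤ (size-bound c a)

  leafₚ : PolyTime i (λ _ → leaf)
  leafₚ = nil , var , λ a → _ , nil , ≤-refl

  nodeₚ : {o o′ : A → Tree} → PolyTime i o → PolyTime i o′ → PolyTime i (λ a → node (o a) (o′ a))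
  nodeₚ (P , p , r) (Q , q , r′) = pair P Q , (var ⊕ p) ⊕ q , λ a →
    let (_ , run , t≤) = r a ; (_ , run′ , t′≤) = r′ a in
    _ , pair run run′ , +-mono-≤ (+-mono-≤ ≤-refl t≤) t′≤

  constₚ : ∀ x → PolyTime i (λ _ → x)
  constₚ leaf       = leafₚ
  constₚ (node x y) = nodeₚ (constₚ x) (constₚ y)

  thenₚ : {o o′ : A → Tree} → PolyTime i o → PolyTime o o′ → PolyTime i o′
  thenₚ c@(P , p , r) (Q , q , r′) = then P Q , p ⊕ (q ⊚ p) , λ a →
    let (_ , run , t≤) = r a ; (_ , run′ , t′≤) = r′ a in
    _ , then run run′ , +-mono-≤ t≤ (≤-trans t′≤ (⟦⟧-⊚-mono q p (size-bound c a)))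

  restrict : {i o : A → Tree} (h : B → A) → PolyTime i o → PolyTime (i ∘ h) (o ∘ h)
  restrict h (P , p , r) = P , p , λ b → r (h b)

  congₚ : {o o′ : A → Tree} → (∀ a → o a ≡ o′ a) → PolyTime i o → PolyTime i o′
  congₚ eq (P , p , r) = P , p , λ a →
    let (t , run , t≤) = r a in t , subst (λ y → Run P _ y t) (eq a) run , t≤

ifT : Tree → Tree → Tree → Tree
ifT (node _ _) x y = x
ifT leaf       x y = y

-- The branches are only required to be correct for the inputs that reach them.
opaque
  branchₚ : ∀ {A B₁ B₂ : Set} {i c o : A → Tree} {i₁ o₁ : B₁ → Tree} {i₂ o₂ : B₂ → Tree} →
    PolyTime i c → PolyTime i₁ o₁ → PolyTime i₂ o₂ →
    (∀ a → (∃[ x ] ∃[ y ] c a ≡ node x y × Σ B₁ λ b → i₁ b ≡ i a × o₁ b ≡ o a)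
         ⊎ (c a ≡ leaf × Σ B₂ λ b → i₂ b ≡ i a × o₂ b ≡ o a)) →
    PolyTime i o
  branchₚ {_} {B₁} {B₂} {i} {c} {o} {i₁} {o₁} {i₂} {o₂} C@(P , p , r) (Q₁ , q₁ , r₁) (Q₂ , q₂ , r₂) dec =
      -- `cond` looks at the left subtree, so the value of the test is put in front of the input;
      -- either branch first drops it with `right`. The size of this pair, bounded by `S`, is thus
      -- charged twice.
      then (pair P skip) (cond (then right Q₁) (then right Q₂))
    , time
    , λ a → run a (dec a)
    where
    S time : Poly
    S = con 1 ⊕ p ⊕ var
    time = ((var ⊕ p) ⊕ var) ⊕ (S ⊕ (S ⊕ (q₁ ⊕ q₂)))
    open ≤-Reasoning
    size≤S : ∀ a → size (node (c a) (i a)) ≤ ⟦ S ⟧ (size (i a))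
    size≤S a = s≤s (+-monoˡ-≤ (size (i a)) (size-bound C a))
    run : ∀ a →
      (∃[ x ] ∃[ y ] c a ≡ node x y × Σ B₁ λ b → i₁ b ≡ i a × o₁ b ≡ o a) ⊎ (c a ≡ leaf × Σ B₂ λ b → i₂ b ≡ i a × o₂ b ≡ o a) →
      ∃[ t ] (Run (then (pair P skip) (cond (then right Q₁) (then right Q₂))) (i a) (o a) t
                × t ≤ ⟦ time ⟧ (size (i a)))
    run a (inj₁ (x , y , eq , b , ib≡ , ob≡)) =
      let (_ , rc , tc≤) = r a ; (t , rb , tb≤) = r₁ b in
      _ , then (pair rc skip) (cond-true eq (then right (subst₂ (λ u v → Run Q₁ u v t) ib≡ ob≡ rb)))
        , +-mono-≤ (+-monoˡ-≤ (size (i a)) (+-monoʳ-≤ (size (i a)) tc≤))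
            (+-mono-≤ (size≤S a) (+-mono-≤ (size≤S a)
              (≤-trans tb≤ (≤-trans (≤-reflexive (cong (λ z → ⟦ q₁ ⟧ (size z)) ib≡)) (m≤m+n _ _)))))
    run a (inj₂ (eq , b , ib≡ , ob≡)) =
      let (_ , rc , tc≤) = r a ; (t , rb , tb≤) = r₂ b in
      _ , then (pair rc skip) (cond-false eq (then right (subst₂ (λ u v → Run Q₂ u v t) ib≡ ob≡ rb)))
        , +-mono-≤ (+-monoˡ-≤ (size (i a)) (+-monoʳ-≤ (size (i a)) tc≤))
            (+-mono-≤ (size≤S a) (+-mono-≤ (size≤S a)
              (≤-trans tb≤ (≤-trans (≤-reflexive (cong (λ z → ⟦ q₂ ⟧ (size z)) ib≡)) (m≤n+m _ (⟦ q₁ ⟧ _))))))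

Op₁ : (Tree → Tree) → Set₁
Op₁ f = ∀ {A : Set} {i x : A → Tree} → PolyTime i x → PolyTime i (λ a → f (x a))

Op₂ : (Tree → Tree → Tree) → Set₁
Op₂ f = ∀ {A : Set} {i x y : A → Tree} → PolyTime i x → PolyTime i y → PolyTime i (λ a → f (x a) (y a))

Op₃ : (Tree → Tree → Tree → Tree) → Set₁
Op₃ f = ∀ {A : Set} {i x y z : A → Tree} →
  PolyTime i x → PolyTime i y → PolyTime i z → PolyTime i (λ a → f (x a) (y a) (z a))

opaque
  ifₚ : Op₃ ifT
  ifₚ {i = i} {x} {y} {z} X Y Z = branchₚ X Y Z λ a → dec a (x a) refl
    where
    dec : ∀ a c → x a ≡ c →
          (∃[ u ] ∃[ v ] x a ≡ node u v × Σ _ λ b → i b ≡ i a × y b ≡ ifT (x a) (y a) (z a))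
        ⊎ (x a ≡ leaf × Σ _ λ b → i b ≡ i a × z b ≡ ifT (x a) (y a) (z a))
    dec a (node u v) eq = inj₁ (u , v , eq , a , refl , cong (λ c → ifT c (y a) (z a)) (sym eq))
    dec a leaf       eq = inj₂ (eq , a , refl , cong (λ c → ifT c (y a) (z a)) (sym eq))

-- The step receives the whole remaining list and not only its head, so that it can depend on the
-- number of elements still to come, as in `rangeT` and `copyT`.
foldlT : (Tree → Tree → Tree → Tree) → Tree → Tree → Tree → Tree
foldlT φ e leaf       acc = acc
foldlT φ e (node h t) acc = foldlT φ e t (φ e (node h t) acc)

-- Repeated application of a polynomial-time step stays polynomial when each step adds to
-- the accumulator an amount that does not depend on the accumulator.
Growth : (Tree → Tree → Tree → Tree) → Set
Growth φ = ∃[ b ] ∀ e l acc → size (φ e l acc) ≤ size acc + ⟦ b ⟧ (size e + size l)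

module _ {φ : Tree → Tree → Tree → Tree} (Φ : Op₃ φ) (growth : Growth φ) where

  private
    b = proj₁ growth

    -- The store of the loop is `node l (node e acc)`: the remaining list stands on the left, where
    -- `while` looks for its test.
    body : PolyTime {Tree} id (λ x →
      node (rightOf (leftOf x)) (node (leftOf (rightOf x))
        (φ (leftOf (rightOf x)) (leftOf x) (rightOf (rightOf x)))))
    body = nodeₚ (rightₚ (leftₚ idₚ)) (nodeₚ (leftₚ (rightₚ idₚ))
             (Φ (leftₚ (rightₚ idₚ)) (leftₚ idₚ) (rightₚ (rightₚ idₚ))))

    P = proj₁ body
    p = proj₁ (proj₂ body)

    -- `M` bounds the store during the whole loop. The summand `size l * K` is a reserve: an
    -- iteration enlarges the accumulator by at most `K`, and the shorter list releases at least
    -- that much. Each iteration then costs at most `M` for the test and `⟦ p ⟧ M` for the body.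
    whileRun : ∀ M K e l acc → ⟦ b ⟧ (size e + size l) ≤ K →
           size (node l (node e acc)) + size l * K ≤ M →
           ∃[ t ] (Run (while P) (node l (node e acc)) (node leaf (node e (foldlT φ e l acc))) t
             × t ≤ size l * (M + ⟦ p ⟧ M))
    whileRun M K e leaf acc b≤K S≤M = _ , while-false refl , (begin
      size (node leaf (node e acc))  ≤⟨ m+n≤o⇒m≤o _ S≤M ⟩
      M                              ≤⟨ m≤m+n M _ ⟩
      M + ⟦ p ⟧ M                    ≡⟨ sym (*-identityˡ _) ⟩
      1 * (M + ⟦ p ⟧ M)              ∎)
      where open ≤-Reasoning
    whileRun M K e l@(node h t) acc b≤K S≤M =
      let (s , run , s≤) = proj₂ (proj₂ body) (node l (node e acc))
          (s′ , run′ , s′≤) = whileRun M K e t acc′ (≤-trans (⟦⟧-mono b (+-monoʳ-≤ (size e) t≤l)) b≤K) S′≤M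
      in _ , while-true refl run run′ , (begin
        size (node l (node e acc)) + s + s′
          ≤⟨ +-mono-≤ (+-mono-≤ S≤ (≤-trans s≤ (⟦⟧-mono p S≤))) s′≤ ⟩
        M + ⟦ p ⟧ M + size t * (M + ⟦ p ⟧ M)
          ≤⟨ *-monoˡ-≤ (M + ⟦ p ⟧ M) 1+t≤l ⟩
        size l * (M + ⟦ p ⟧ M)  ∎)
      where
      open ≤-Reasoning
      acc′ = φ e l acc
      S≤ : size (node l (node e acc)) ≤ M
      S≤ = m+n≤o⇒m≤o _ S≤M
      1+t≤l : suc (size t) ≤ size l
      1+t≤l = s≤s (m≤n+m (size t) (size h))
      t≤l : size t ≤ size l
      t≤l = ≤-trans (n≤1+n _) 1+t≤l
      S′≤M : size (node t (node e acc′)) + size t * K ≤ M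
      S′≤M = begin
        suc (size t + suc (size e + size acc′)) + size t * K
          ≤⟨ +-monoˡ-≤ _ (s≤s (+-mono-≤ t≤l (s≤s (+-monoʳ-≤ (size e)
               (≤-trans (proj₂ growth e l acc) (+-monoʳ-≤ (size acc) b≤K)))))) ⟩
        suc (size l + suc (size e + (size acc + K))) + size t * K
          ≡⟨ cong (λ z → suc (size l + suc z) + size t * K) (sym (+-assoc (size e) _ K)) ⟩
        suc (size l + (suc (size e + size acc) + K)) + size t * K
          ≡⟨ cong (λ z → suc z + size t * K) (sym (+-assoc (size l) _ K)) ⟩
        suc (size l + suc (size e + size acc)) + K + size t * K
          ≡⟨ +-assoc (suc (size l + suc (size e + size acc))) K _ ⟩
        suc (size l + suc (size e + size acc)) + suc (size t) * K
          ≤⟨ +-monoʳ-≤ (suc (size l + suc (size e + size acc))) (*-monoˡ-≤ K 1+t≤l) ⟩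
        suc (size l + suc (size e + size acc)) + size l * K
          ≤⟨ S≤M ⟩
        M ∎

    whole : PolyTime {Tree × Tree × Tree} (λ (e , l , acc) → node l (node e acc))
                     (λ (e , l , acc) → node leaf (node e (foldlT φ e l acc)))
    whole = while P , var ⊗ (M ⊕ (p ⊚ M)) , λ (e , l , acc) → run e l acc
      where
      -- With S the initial size of the store, one step adds at most b(S), and S bounds the number
      -- of steps; hence S + S * b(S).
      M = var ⊕ var ⊗ b
      run : ∀ e l acc → ∃[ t ] (Run (while P) _ _ t × t ≤ ⟦ var ⊗ (M ⊕ (p ⊚ M)) ⟧ (size (node l (node e acc))))
      run e l acc =
        let (t , r , t≤) = whileRun (⟦ M ⟧ S) (⟦ b ⟧ S) e l acc (⟦⟧-mono b el≤) (+-monoʳ-≤ S (*-monoˡ-≤ (⟦ b ⟧ S) l≤))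
        in t , r , ≤-trans t≤ (*-mono-≤ l≤ (+-monoʳ-≤ (⟦ M ⟧ S) (≤-reflexive (sym (⟦⟧-⊚ p M S)))))
        where
        S = size (node l (node e acc))
        l≤ : size l ≤ S
        l≤ = size-leftOf (node l (node e acc))
        el≤ : size e + size l ≤ S
        el≤ = ≤-trans (≤-reflexive (+-comm (size e) (size l)))
          (m≤n⇒m≤1+n (+-monoʳ-≤ (size l) (m≤n⇒m≤1+n (m≤m+n (size e) (size acc)))))

  opaque
    foldlₚ : Op₃ (foldlT φ)
    foldlₚ {x = e} {l} {acc} E L Acc =
      thenₚ (nodeₚ L (nodeₚ E Acc)) (rightₚ (rightₚ (restrict (λ a → e a , l a , acc a) whole)))

opaque
  -- The new entry is computed from `e` and `l` in polynomial time, so its size is bounded in terms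
  -- of these alone.
  consGrowth : {ψ : Tree → Tree → Tree} → Op₂ ψ → Growth (λ e l acc → node (ψ e l) acc)
  consGrowth {ψ} Ψ = con 2 ⊕ (bound c ⊚ (con 1 ⊕ var)) , λ e l acc → begin
    suc (size (ψ e l) + size acc)
      ≤⟨ s≤s (+-monoˡ-≤ (size acc) (≤-trans (size-bound c (node e l)) (≤-reflexive (sym (⟦⟧-⊚ (bound c) (con 1 ⊕ var) _))))) ⟩
    suc (⟦ bound c ⊚ (con 1 ⊕ var) ⟧ (size e + size l) + size acc)
      ≡⟨ +-comm (suc (⟦ bound c ⊚ (con 1 ⊕ var) ⟧ (size e + size l))) (size acc) ⟩
    size acc + suc (⟦ bound c ⊚ (con 1 ⊕ var) ⟧ (size e + size l))
      ≤⟨ +-monoʳ-≤ (size acc) (n≤1+n _) ⟩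
    size acc + (2 + ⟦ bound c ⊚ (con 1 ⊕ var) ⟧ (size e + size l)) ∎
    where
    open ≤-Reasoning
    c : PolyTime {Tree} id (λ x → ψ (leftOf x) (rightOf x))
    c = Ψ (leftₚ idₚ) (rightₚ idₚ)

-- Ending the result in `b` instead of `leaf` makes appending two lists an instance.
mapT : (Tree → Tree → Tree) → Tree → Tree → Tree → Tree
mapT ψ e b leaf       = b
mapT ψ e b (node h t) = node (ψ e (node h t)) (mapT ψ e b t)

suffixes : Tree → Tree → Tree
suffixes = foldlT (λ _ l acc → node l acc) leaf

-- A right fold is a left fold over the reversed list of suffixes.
mapT-suffixes : ∀ ψ e b l acc →
  foldlT (λ e l r → node (ψ e (leftOf l)) r) e (suffixes l acc) b ≡
  foldlT (λ e l r → node (ψ e (leftOf l)) r) e acc (mapT ψ e b l)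
mapT-suffixes ψ e b leaf       acc = refl
mapT-suffixes ψ e b (node h t) acc = mapT-suffixes ψ e b t (node (node h t) acc)

opaque
  mapₚ : ∀ {ψ} → Op₂ ψ → Op₃ (mapT ψ)
  mapₚ {ψ} Ψ {x = e} {b} {l} E B L =
    congₚ (λ a → mapT-suffixes ψ (e a) (b a) (l a) leaf)
      (foldlₚ (λ E L R → nodeₚ (Ψ E (leftₚ L)) R) (consGrowth (λ E L → Ψ E (leftₚ L)))
        E (foldlₚ (λ _ L R → nodeₚ L R) (consGrowth (λ _ L → L)) leafₚ L leafₚ) B)

-- Circuit combinators and their values

open Circuit

private variable
  m m′ l w w′ w″ : ℕ

weakenGate : ∀ r → Gate w → Gate (w + r)
weakenGate r (const b) = const b
weakenGate r (not i)   = not (i ↑ˡ r)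
weakenGate r (and i j) = and (i ↑ˡ r) (j ↑ˡ r)
weakenGate r (or i j)  = or (i ↑ˡ r) (j ↑ˡ r)

weaken : ∀ r → Gates w w′ → Gates (w + r) (w′ + r)
weaken r []       = []
weaken r (g ∷ gs) = weakenGate r g ∷ weaken r gs

evalGate-weaken : ∀ {r} (g : Gate w) ws (rs : Word r) →
  evalGate (weakenGate r g) (ws ++ rs) ≡ evalGate g ws
evalGate-weaken (const b) ws rs = refl
evalGate-weaken (not i)   ws rs = cong ¬ᵇ (lookup-++ˡ ws rs i)
evalGate-weaken (and i j) ws rs = cong₂ _∧_ (lookup-++ˡ ws rs i) (lookup-++ˡ ws rs j)
evalGate-weaken (or i j)  ws rs = cong₂ _∨_ (lookup-++ˡ ws rs i) (lookup-++ˡ ws rs j)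

evalGates-weaken : ∀ {r} (gs : Gates w w′) ws (rs : Word r) →
  evalGates (weaken r gs) (ws ++ rs) ≡ evalGates gs ws ++ rs
evalGates-weaken []       ws rs = refl
evalGates-weaken (g ∷ gs) ws rs rewrite evalGate-weaken g ws rs =
  evalGates-weaken gs (evalGate g ws ∷ ws) rs

infixr 5 _++ᵍ_

_++ᵍ_ : Gates w w′ → Gates w′ w″ → Gates w w″
[]       ++ᵍ hs = hs
(g ∷ gs) ++ᵍ hs = g ∷ (gs ++ᵍ hs)

evalGates-++ : (gs : Gates w w′) (hs : Gates w′ w″) → ∀ ws →
  evalGates (gs ++ᵍ hs) ws ≡ evalGates hs (evalGates gs ws)
evalGates-++ []       hs ws = refl
evalGates-++ (g ∷ gs) hs ws = evalGates-++ gs hs _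

data BinOp : Set where
  ∧-op ∨-op : BinOp

applyOp : BinOp → Bool → Bool → Bool
applyOp ∧-op = _∧_
applyOp ∨-op = _∨_

opGate : BinOp → Fin w → Fin w → Gate w
opGate ∧-op = and
opGate ∨-op = or

evalGate-op : ∀ ⊙ (i j : Fin w) ws → evalGate (opGate ⊙ i j) ws ≡ applyOp ⊙ (lookup ws i) (lookup ws j)
evalGate-op ∧-op i j ws = refl
evalGate-op ∨-op i j ws = refl

-- Gates run from the last component of the vectors to the first, so that the results end
-- up in the right order in front of the old wires.
zipThen : BinOp → Vec (Fin w) m′ → Vec (Fin w) m′ → Gates (m′ + w) w′ → Gates w w′
zipThen ⊙ []                 []       rest = rest
zipThen ⊙ (_∷_ {n = m′} x xs) (y ∷ ys) rest =
  zipThen ⊙ xs ys (opGate ⊙ (m′ ↑ʳ x) (m′ ↑ʳ y) ∷ rest)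

evalGates-zip : ∀ ⊙ (xs ys : Vec (Fin w) m′) (rest : Gates (m′ + w) w′) ws →
  evalGates (zipThen ⊙ xs ys rest) ws ≡
  evalGates rest (zipWith (applyOp ⊙) (map (lookup ws) xs) (map (lookup ws) ys) ++ ws)
evalGates-zip ⊙ [] [] rest ws = refl
evalGates-zip ⊙ (_∷_ {n = m′} x xs) (y ∷ ys) rest ws
  rewrite evalGates-zip ⊙ xs ys (opGate ⊙ (m′ ↑ʳ x) (m′ ↑ʳ y) ∷ rest) ws
        | evalGate-op ⊙ (m′ ↑ʳ x) (m′ ↑ʳ y) (zipWith (applyOp ⊙) (map (lookup ws) xs) (map (lookup ws) ys) ++ ws)
        | lookup-++ʳ (zipWith (applyOp ⊙) (map (lookup ws) xs) (map (lookup ws) ys)) ws x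
        | lookup-++ʳ (zipWith (applyOp ⊙) (map (lookup ws) xs) (map (lookup ws) ys)) ws y = refl

-- No gate merely copies a wire, but the disjunction of a wire with itself has this effect.
copyThen : Vec (Fin w) m′ → Gates (m′ + w) w′ → Gates w w′
copyThen xs = zipThen ∨-op xs xs

zipWith-∨-idem : (xs : Word m′) → zipWith _∨_ xs xs ≡ xs
zipWith-∨-idem []       = refl
zipWith-∨-idem (x ∷ xs) = cong₂ _∷_ (∨-idem x) (zipWith-∨-idem xs)

-- Running a circuit on some of the wires.  Its gates are reused verbatim, since its inputs
-- are first copied to the front.
attach : Gates m w → Vec (Fin w) m′ → (D : Circuit m′ l) → Gates m (wires D + w)
attach {w = w} gs xs D = gs ++ᵍ copyThen xs (weaken w (gates D))

evalGates-attach : ∀ (gs : Gates m w) (xs : Vec (Fin w) m′) (D : Circuit m′ l) x →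
  evalGates (attach gs xs D) x ≡
  evalGates (gates D) (map (lookup (evalGates gs x)) xs) ++ evalGates gs x
evalGates-attach {w = w} gs xs D x
  rewrite evalGates-++ gs (copyThen xs (weaken w (gates D))) x
        | evalGates-zip ∨-op xs xs (weaken w (gates D)) (evalGates gs x)
        | zipWith-∨-idem (map (lookup (evalGates gs x)) xs)
  = evalGates-weaken (gates D) _ _

inputWire : Gates m w → Fin m → Fin w
inputWire []       i = i
inputWire (g ∷ gs) i = inputWire gs (suc i)

lookup-inputWire : (gs : Gates m w) → ∀ x i → lookup (evalGates gs x) (inputWire gs i) ≡ lookup x i
lookup-inputWire []       x i = refl
lookup-inputWire (g ∷ gs) x i = lookup-inputWire gs (_ ∷ x) (suc i)

toℕ-inputWire : (gs : Gates m w) → ∀ i → toℕ (inputWire gs i) ≡ countGates gs + toℕ i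
toℕ-inputWire []       i = refl
toℕ-inputWire (g ∷ gs) i = trans (toℕ-inputWire gs (suc i)) (+-suc (countGates gs) (toℕ i))

wires≡ : (gs : Gates m w) → w ≡ countGates gs + m
wires≡ []       = refl
wires≡ {m} (g ∷ gs) = trans (wires≡ gs) (+-suc (countGates gs) m)

map-lookup-↑ˡ : ∀ {A : Set} (xs : Vec A m) (ys : Vec A m′) (is : Vec (Fin m) l) →
  map (lookup (xs ++ ys)) (map (_↑ˡ m′) is) ≡ map (lookup xs) is
map-lookup-↑ˡ xs ys is = trans (sym (map-∘ _ _ is)) (map-cong (lookup-++ˡ xs ys) is)

map-lookup-↑ʳ : ∀ {A : Set} (xs : Vec A m) (ys : Vec A m′) (is : Vec (Fin m′) l) →
  map (lookup (xs ++ ys)) (map (m ↑ʳ_) is) ≡ map (lookup ys) is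
map-lookup-↑ʳ xs ys is = trans (sym (map-∘ _ _ is)) (map-cong (lookup-++ʳ xs ys) is)

map-lookup-tabulate : ∀ {A : Set} (xs : Vec A m) (ys : Vec A m′) (f : Fin m′ → Fin m) →
  (∀ i → lookup xs (f i) ≡ lookup ys i) → map (lookup xs) (tabulate f) ≡ ys
map-lookup-tabulate xs ys f eq =
  trans (sym (tabulate-∘ (lookup xs) f)) (trans (tabulate-cong eq) (tabulate∘lookup ys))

infixr 9 _⨾_
infixr 7 _△_

opaque
  _⨾_ : Circuit m m′ → Circuit m′ l → Circuit m l
  C ⨾ D = circuit (attach (gates C) (outputs C) D) (map (_↑ˡ wires C) (outputs D))

  eval-⨾ : (C : Circuit m m′) (D : Circuit m′ l) → ∀ x → eval (C ⨾ D) x ≡ eval D (eval C x)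
  eval-⨾ C D x rewrite evalGates-attach (gates C) (outputs C) D x = map-lookup-↑ˡ (evalGates (gates D) (eval C x)) (evalGates (gates C) x) (outputs D)

opaque
  _△_ : Circuit m m′ → Circuit m l → Circuit m (m′ + l)
  C △ D = circuit (attach (gates C) (tabulate (inputWire (gates C))) D)
    -- `D` runs second, so its wires lie in front and those of `C` are pushed back by `wires D`.
    (map (wires D ↑ʳ_) (outputs C) ++ map (_↑ˡ wires C) (outputs D))

  eval-△ : (C : Circuit m m′) (D : Circuit m l) → ∀ x → eval (C △ D) x ≡ eval C x ++ eval D x
  eval-△ C D x
    rewrite evalGates-attach (gates C) (tabulate (inputWire (gates C))) D x
          | map-lookup-tabulate (evalGates (gates C) x) x (inputWire (gates C)) (lookup-inputWire (gates C) x)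
    = trans (map-++ _ (map (wires D ↑ʳ_) (outputs C)) _)
        (cong₂ _++_ (map-lookup-↑ʳ (evalGates (gates D) x) (evalGates (gates C) x) (outputs C))
                      (map-lookup-↑ˡ (evalGates (gates D) x) (evalGates (gates C) x) (outputs D)))

opaque
  lowWires : ∀ m m′ → Circuit (m + m′) m
  lowWires m m′ = circuit [] (tabulate (_↑ˡ m′))

  eval-low : (x : Word m) (y : Word m′) → eval (lowWires m m′) (x ++ y) ≡ x
  eval-low x y = map-lookup-tabulate (x ++ y) x (_↑ˡ _) (lookup-++ˡ x y)

opaque
  highWires : ∀ m m′ → Circuit (m + m′) m′
  highWires m m′ = circuit [] (tabulate (m ↑ʳ_))

  eval-high : (x : Word m) (y : Word m′) → eval (highWires m m′) (x ++ y) ≡ y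
  eval-high x y = map-lookup-tabulate (x ++ y) y (_ ↑ʳ_) (lookup-++ʳ x y)

opaque
  fanout : ∀ m′ → Circuit 1 m′
  fanout m′ = circuit [] (replicate m′ zero)

  eval-fanout : ∀ m′ b → eval (fanout m′) [ b ] ≡ replicate m′ b
  eval-fanout zero    b = refl
  eval-fanout (suc m′) b = cong (b ∷_) (eval-fanout m′ b)

opaque
  bitwise : BinOp → ∀ m′ → Circuit (m′ + m′) m′
  bitwise ⊙ m′ = circuit (zipThen ⊙ (tabulate (_↑ˡ m′)) (tabulate (m′ ↑ʳ_)) []) (tabulate (_↑ˡ (m′ + m′)))

opaque
  unfolding bitwise lowWires highWires

  eval-bitwise : ∀ ⊙ (x y : Word m′) → eval (bitwise ⊙ m′) (x ++ y) ≡ zipWith (applyOp ⊙) x y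
  eval-bitwise {m′} ⊙ x y
    rewrite evalGates-zip ⊙ (tabulate (_↑ˡ m′)) (tabulate (m′ ↑ʳ_)) [] (x ++ y)
          | eval-low x y | eval-high x y = map-lookup-tabulate (zipWith (applyOp ⊙) x y ++ (x ++ y)) _ _ (lookup-++ˡ (zipWith (applyOp ⊙) x y) (x ++ y))

opaque
  constBit : Bool → Circuit m 1
  constBit b = circuit (const b ∷ []) [ zero ]

  eval-constBit : ∀ b (x : Word m) → eval (constBit b) x ≡ [ b ]
  eval-constBit b x = refl

opaque
  negate : Circuit 1 1
  negate = circuit (not zero ∷ []) [ zero ]

  eval-negate : ∀ b → eval negate [ b ] ≡ [ ¬ᵇ b ]
  eval-negate b = refl

opaque
  mux : Circuit m 1 → Circuit m m′ → Circuit m m′ → Circuit m m′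
  mux {m′ = m′} S C D =
    ((((S ⨾ fanout m′) △ C) ⨾ bitwise ∧-op m′) △ ((((S ⨾ negate) ⨾ fanout m′) △ D) ⨾ bitwise ∧-op m′))
    ⨾ bitwise ∨-op m′

select : Bool → Word m′ → Word m′ → Word m′
select b x y = zipWith _∨_ (zipWith _∧_ (replicate _ b) x) (zipWith _∧_ (replicate _ (¬ᵇ b)) y)

select-if : ∀ b (x y : Word m′) → select b x y ≡ (if b then x else y)
select-if true  [] [] = refl
select-if false [] [] = refl
select-if true  (x ∷ xs) (y ∷ ys) = cong₂ _∷_ (∨-identityʳ x) (select-if true xs ys)
select-if false (x ∷ xs) (y ∷ ys) = cong (y ∷_) (select-if false xs ys)

opaque
  unfolding mux

  eval-mux : (S : Circuit m 1) (C D : Circuit m m′) → ∀ x {b} → eval S x ≡ [ b ] →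
    eval (mux S C D) x ≡ (if b then eval C x else eval D x)
  eval-mux {m′ = m′} S C D x {b} eq
    rewrite eval-⨾ ((((S ⨾ fanout m′) △ C) ⨾ bitwise ∧-op m′) △ ((((S ⨾ negate) ⨾ fanout m′) △ D) ⨾ bitwise ∧-op m′))
              (bitwise ∨-op m′) x
          | eval-△ (((S ⨾ fanout m′) △ C) ⨾ bitwise ∧-op m′) ((((S ⨾ negate) ⨾ fanout m′) △ D) ⨾ bitwise ∧-op m′) x
          | eval-bitwise ∨-op (eval (((S ⨾ fanout m′) △ C) ⨾ bitwise ∧-op m′) x)
              (eval ((((S ⨾ negate) ⨾ fanout m′) △ D) ⨾ bitwise ∧-op m′) x)
          | eval-⨾ ((S ⨾ fanout m′) △ C) (bitwise ∧-op m′) x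
          | eval-⨾ (((S ⨾ negate) ⨾ fanout m′) △ D) (bitwise ∧-op m′) x
          | eval-△ (S ⨾ fanout m′) C x
          | eval-△ ((S ⨾ negate) ⨾ fanout m′) D x
          | eval-bitwise ∧-op (eval (S ⨾ fanout m′) x) (eval C x)
          | eval-bitwise ∧-op (eval ((S ⨾ negate) ⨾ fanout m′) x) (eval D x)
          | eval-⨾ S (fanout m′) x
          | eval-⨾ (S ⨾ negate) (fanout m′) x
          | eval-⨾ S negate x
          | eq
          | eval-negate b
          | eval-fanout m′ b
          | eval-fanout m′ (¬ᵇ b)
    = select-if b (eval C x) (eval D x)

opaque
  -- Shannon expansion along the first input. The circuit is exponential in `m`, so truth tables are
  -- applied only to fields whose width does not depend on `n`.
  bitTable : (Word m → Bool) → Circuit m 1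
  bitTable {zero}  F = constBit (F [])
  bitTable {suc m} F = mux (lowWires 1 m) (highWires 1 m ⨾ bitTable (F ∘ (true ∷_)))
                                          (highWires 1 m ⨾ bitTable (F ∘ (false ∷_)))

  eval-bitTable : ∀ (F : Word m → Bool) x → eval (bitTable F) x ≡ [ F x ]
  eval-bitTable {zero}  F []      = eval-constBit (F []) []
  eval-bitTable {suc m} F (b ∷ x) =
    trans (eval-mux (lowWires 1 m) _ _ (b ∷ x) (eval-low [ b ] x)) (branches b)
    where
    high : ∀ b (G : Word m → Bool) → eval (highWires 1 m ⨾ bitTable G) (b ∷ x) ≡ [ G x ]
    high b G = trans (eval-⨾ (highWires 1 m) (bitTable G) (b ∷ x))
      (trans (cong (eval (bitTable G)) (eval-high [ b ] x)) (eval-bitTable G x))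
    branches : ∀ b → (if b then eval (highWires 1 m ⨾ bitTable (F ∘ (true ∷_))) (b ∷ x)
                           else eval (highWires 1 m ⨾ bitTable (F ∘ (false ∷_))) (b ∷ x)) ≡ [ F (b ∷ x) ]
    branches true  = high true _
    branches false = high false _

opaque
  table : (Word m → Word m′) → Circuit m m′
  table {m′ = zero}  F = circuit [] []
  table {m′ = suc m′} F = bitTable (head ∘ F) △ table (tail ∘ F)

  eval-table : ∀ (F : Word m → Word m′) x → eval (table F) x ≡ F x
  eval-table {m′ = zero}  F x with F x
  ... | [] = refl
  eval-table {m′ = suc m′} F x
    rewrite eval-△ (bitTable (head ∘ F)) (table (tail ∘ F)) x
          | eval-bitTable (head ∘ F) x | eval-table (tail ∘ F) x with F x
  ... | _ ∷ _ = refl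

-- List operations and circuit evaluation on trees

appendT : Tree → Tree → Tree
appendT xs ys = mapT (λ _ l → leftOf l) leaf ys xs

appendₚ : Op₂ appendT
appendₚ X Y = mapₚ (λ _ L → leftₚ L) leafₚ Y X

lengthT : Tree → Tree
lengthT = mapT (λ _ _ → leaf) leaf leaf

lengthₚ : Op₁ lengthT
lengthₚ X = mapₚ (λ _ _ → leafₚ) leafₚ leafₚ X

shiftT : Tree → Tree → Tree
shiftT k = mapT (λ e l → appendT e (leftOf l)) k leaf

shiftₚ : Op₂ shiftT
shiftₚ K X = mapₚ (λ E L → appendₚ E (leftₚ L)) K leafₚ X

rangeT : Tree → Tree → Tree
rangeT s m′ = foldlT (λ e l acc → node (appendT e (rightOf l)) acc) s m′ leaf

rangeₚ : Op₂ rangeT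
rangeₚ S N = foldlₚ (λ E L R → nodeₚ (appendₚ E (rightₚ L)) R) (consGrowth λ E L → appendₚ E (rightₚ L)) S N leafₚ

repeatT : Tree → Tree → Tree → Tree
repeatT = foldlT (λ e _ acc → node e acc)

repeatₚ : Op₃ repeatT
repeatₚ = foldlₚ (λ E _ R → nodeₚ E R) (consGrowth λ E _ → E)

-- The tag 3 stands for `or`. In `zipThen` the gate of the head runs after those of the tail, so its
-- operand is raised by the length of the tail.
copyGateT : Tree → Tree → Tree
copyGateT _ l = node (encodeℕ 3) (node x x)
  where x = appendT (lengthT (rightOf l)) (leftOf l)

copyGateₚ : Op₂ copyGateT
copyGateₚ _ L = nodeₚ (constₚ (encodeℕ 3)) (nodeₚ X X)
  where X = appendₚ (lengthₚ (rightₚ L)) (leftₚ L)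

copyT : Tree → Tree → Tree
copyT = foldlT (λ e l acc → node (copyGateT e l) acc) leaf

copyₚ : Op₂ copyT
copyₚ X R = foldlₚ (λ E L R → nodeₚ (copyGateₚ E L) R) (consGrowth {ψ = copyGateT} copyGateₚ) leafₚ X R

dropT : Tree → Tree → Tree
dropT k xs = foldlT (λ _ _ acc → rightOf acc) leaf k xs

dropₚ : Op₂ dropT
dropₚ K X = foldlₚ (λ _ _ R → rightₚ R)
  (con 0 , λ _ _ acc → ≤-trans (size-rightOf acc) (m≤m+n _ 0)) leafₚ K X

lookupT : Tree → Tree → Tree
lookupT xs k = leftOf (dropT k xs)

lookupₚ : Op₂ lookupT
lookupₚ X K = leftₚ (dropₚ K X)

tt ff : Tree
tt = encodeBool true
ff = encodeBool false

-- `Growth` quantifies over all trees, not only over encodings. Normalising a result to an encoded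
-- Boolean bounds its size by 3 in every case.
boolT notT : Tree → Tree
boolT x = ifT x tt ff
notT  x = ifT x ff tt

boolₚ : Op₁ boolT
boolₚ X = ifₚ X (constₚ tt) leafₚ

notₚ : Op₁ notT
notₚ X = ifₚ X leafₚ (constₚ tt)

size-if : ∀ {k} c {x y} → size x ≤ k → size y ≤ k → size (ifT c x y) ≤ k
size-if (node _ _) x≤ y≤ = x≤
size-if leaf       x≤ y≤ = y≤

size-bool : ∀ x → size (boolT x) ≤ 3
size-bool x = size-if x ≤-refl (s≤s z≤n)

size-not : ∀ x → size (notT x) ≤ 3
size-not x = size-if x (s≤s z≤n) ≤-refl

-- The nested tests peel the unary tag of the gate: 0 is a constant, 1 a negation, 2 a conjunction
-- and 3 a disjunction.
evalGateT : Tree → Tree → Tree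
evalGateT g ws =
  ifT (leftOf g)
    (ifT (rightOf (leftOf g))
      (ifT (rightOf (rightOf (leftOf g)))
        (ifT (lookupT ws (leftOf (rightOf g))) tt (boolT (lookupT ws (rightOf (rightOf g)))))
        (ifT (lookupT ws (leftOf (rightOf g))) (boolT (lookupT ws (rightOf (rightOf g)))) ff))
      (notT (lookupT ws (rightOf g))))
    (boolT (rightOf g))

evalGateₚ : Op₂ evalGateT
evalGateₚ G W = ifₚ (leftₚ G)
    (ifₚ (rightₚ (leftₚ G))
      (ifₚ (rightₚ (rightₚ (leftₚ G)))
        (ifₚ (lookupₚ W (leftₚ (rightₚ G))) (constₚ tt) (boolₚ (lookupₚ W (rightₚ (rightₚ G)))))
        (ifₚ (lookupₚ W (leftₚ (rightₚ G))) (boolₚ (lookupₚ W (rightₚ (rightₚ G)))) leafₚ))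
      (notₚ (lookupₚ W (rightₚ G))))
    (boolₚ (rightₚ G))

size-evalGate : ∀ g ws → size (evalGateT g ws) ≤ 3
size-evalGate g ws =
  size-if (leftOf g)
    (size-if (rightOf (leftOf g))
      (size-if (rightOf (rightOf (leftOf g)))
        (size-if (lookupT ws (leftOf (rightOf g))) ≤-refl (size-bool (lookupT ws (rightOf (rightOf g)))))
        (size-if (lookupT ws (leftOf (rightOf g))) (size-bool (lookupT ws (rightOf (rightOf g)))) (s≤s z≤n)))
      (size-not (lookupT ws (rightOf g))))
    (size-bool (rightOf g))

evalGatesT : Tree → Tree → Tree
evalGatesT = foldlT (λ _ l acc → node (evalGateT (leftOf l) acc) acc) leaf

evalGatesₚ : Op₂ evalGatesT
evalGatesₚ G W = foldlₚ (λ _ L R → nodeₚ (evalGateₚ (leftₚ L) R) R)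
  -- Three for the new bit and one for the node that holds it.
  (con 4 , λ _ l acc → ≤-trans (s≤s (+-monoˡ-≤ (size acc) (size-evalGate (leftOf l) acc)))
                               (≤-reflexive (+-comm 4 (size acc))))
  leafₚ G W

evalT : Tree → Tree → Tree
evalT C x = mapT (λ e l → lookupT e (leftOf l)) (evalGatesT (leftOf C) x) leaf (rightOf C)

opaque
  evalₚ : Op₂ evalT
  evalₚ C X = mapₚ (λ E L → lookupₚ E (leftₚ L)) (evalGatesₚ (leftₚ C) X) leafₚ (rightₚ C)

sameBitT : Tree → Tree → Tree
sameBitT x y = ifT x (boolT y) (notT y)

-- The accumulator pairs a flag with the unread part of the second word. The initial flag is
-- arbitrary so that `same-encode` can be proved by induction on the words.
sameT : Tree → Tree → Tree → Tree
sameT b xs ys = leftOf (foldlT (λ _ l acc →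
  node (ifT (leftOf acc) (sameBitT (leftOf l) (leftOf (rightOf acc))) ff) (rightOf (rightOf acc))) leaf xs (node b ys))

opaque
  sameₚ : Op₃ sameT
  sameₚ B X Y = leftₚ (foldlₚ
    (λ _ L R → nodeₚ (ifₚ (leftₚ R) (ifₚ (leftₚ L) (boolₚ (leftₚ (rightₚ R))) (notₚ (leftₚ (rightₚ R)))) leafₚ)
                 (rightₚ (rightₚ R)))
    (con 4 , λ _ l acc → ≤-trans (s≤s (+-mono-≤
        (size-if {3} (leftOf acc) (size-if (leftOf l) (size-bool (leftOf (rightOf acc))) (size-not (leftOf (rightOf acc)))) (s≤s z≤n))
        (≤-trans (size-rightOf (rightOf acc)) (size-rightOf acc))))
      (≤-reflexive (+-comm 4 (size acc))))
    leafₚ X (nodeₚ B Y))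

-- Effect of the tree operations on encodings

encodeℕ-+ : ∀ m m′ → appendT (encodeℕ m) (encodeℕ m′) ≡ encodeℕ (m + m′)
encodeℕ-+ zero    m′ = refl
encodeℕ-+ (suc m) m′ = cong (node leaf) (encodeℕ-+ m m′)

encodeFin≡ : (i : Fin m′) → encodeFin i ≡ encodeℕ (toℕ i)
encodeFin≡ zero    = refl
encodeFin≡ (suc i) = cong (node leaf) (encodeFin≡ i)

encodeFin-↑ˡ : ∀ (i : Fin m′) m → encodeFin (i ↑ˡ m) ≡ encodeFin i
encodeFin-↑ˡ zero    m = refl
encodeFin-↑ˡ (suc i) m = cong (node leaf) (encodeFin-↑ˡ i m)

encodeFin-↑ʳ : ∀ m (i : Fin m′) → encodeFin (m ↑ʳ i) ≡ appendT (encodeℕ m) (encodeFin i)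
encodeFin-↑ʳ zero    i = refl
encodeFin-↑ʳ (suc m) i = cong (node leaf) (encodeFin-↑ʳ m i)

encodeVec-++ : ∀ {A : Set} (enc : A → Tree) (xs : Vec A m) (ys : Vec A m′) →
  appendT (encodeVec enc xs) (encodeVec enc ys) ≡ encodeVec enc (xs ++ ys)
encodeVec-++ enc []       ys = refl
encodeVec-++ enc (x ∷ xs) ys = cong (node (enc x)) (encodeVec-++ enc xs ys)

length-encodeVec : ∀ {A : Set} (enc : A → Tree) (xs : Vec A m′) → lengthT (encodeVec enc xs) ≡ encodeℕ m′
length-encodeVec enc []       = refl
length-encodeVec enc (x ∷ xs) = cong (node leaf) (length-encodeVec enc xs)

encodeVec-↑ʳ : ∀ r (is : Vec (Fin m) m′) →
  shiftT (encodeℕ r) (encodeVec encodeFin is) ≡ encodeVec encodeFin (map (r ↑ʳ_) is)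
encodeVec-↑ʳ r []       = refl
encodeVec-↑ʳ r (i ∷ is) = cong₂ node (sym (encodeFin-↑ʳ r i)) (encodeVec-↑ʳ r is)

encodeVec-↑ˡ : ∀ r (is : Vec (Fin m) m′) → encodeVec encodeFin (map (_↑ˡ r) is) ≡ encodeVec encodeFin is
encodeVec-↑ˡ r []       = refl
encodeVec-↑ˡ r (i ∷ is) = cong₂ node (encodeFin-↑ˡ i r) (encodeVec-↑ˡ r is)

encodeGates-++ : (gs : Gates w w′) (hs : Gates w′ w″) →
  appendT (encodeGates gs) (encodeGates hs) ≡ encodeGates (gs ++ᵍ hs)
encodeGates-++ []       hs = refl
encodeGates-++ (g ∷ gs) hs = cong (node (encodeGate g)) (encodeGates-++ gs hs)

encodeGate-weaken : ∀ r (g : Gate w) → encodeGate (weakenGate r g) ≡ encodeGate g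
encodeGate-weaken r (const b) = refl
encodeGate-weaken r (not i)   = cong (node _) (encodeFin-↑ˡ i r)
encodeGate-weaken r (and i j) = cong (node _) (cong₂ node (encodeFin-↑ˡ i r) (encodeFin-↑ˡ j r))
encodeGate-weaken r (or i j)  = cong (node _) (cong₂ node (encodeFin-↑ˡ i r) (encodeFin-↑ˡ j r))

encodeGates-weaken : ∀ r (gs : Gates w w′) → encodeGates (weaken r gs) ≡ encodeGates gs
encodeGates-weaken r []       = refl
encodeGates-weaken r (g ∷ gs) = cong₂ node (encodeGate-weaken r g) (encodeGates-weaken r gs)

length-encodeGates : (gs : Gates w w′) → lengthT (encodeGates gs) ≡ encodeℕ (countGates gs)
length-encodeGates []       = refl
length-encodeGates (g ∷ gs) = cong (node leaf) (length-encodeGates gs)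

encodeGates-copy : ∀ (is : Vec (Fin w) m′) (rest : Gates (m′ + w) w′) →
  copyT (encodeVec encodeFin is) (encodeGates rest) ≡ encodeGates (copyThen is rest)
encodeGates-copy []       rest = refl
encodeGates-copy (_∷_ {n = m′} i is) rest =
  trans (cong (λ x → copyT (encodeVec encodeFin is) (node (node (encodeℕ 3) (node x x)) (encodeGates rest)))
          (trans (cong (λ x → appendT x (encodeFin i)) (length-encodeVec encodeFin is)) (sym (encodeFin-↑ʳ m′ i))))
        (encodeGates-copy is (or (m′ ↑ʳ i) (m′ ↑ʳ i) ∷ rest))

private
  rangeFrom : ℕ → ℕ → Tree → Tree
  rangeFrom s zero    acc = acc
  rangeFrom s (suc m′) acc = node (encodeℕ s) (rangeFrom (suc s) m′ acc)

  -- The fold in `rangeT` meets the largest number first and conses downwards, whereas `rangeFrom`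
  -- recurses from the smallest; this step reconciles the two.
  rangeFrom-snoc : ∀ s m′ acc → rangeFrom s m′ (node (encodeℕ (s + m′)) acc) ≡ rangeFrom s (suc m′) acc
  rangeFrom-snoc s zero    acc = cong (λ k → node (encodeℕ k) acc) (+-identityʳ s)
  rangeFrom-snoc s (suc m′) acc = cong (node (encodeℕ s))
    (trans (cong (λ k → rangeFrom (suc s) m′ (node (encodeℕ k) acc)) (+-suc s m′)) (rangeFrom-snoc (suc s) m′ acc))

  range≡rangeFrom : ∀ s m′ acc →
    foldlT (λ e l acc → node (appendT e (rightOf l)) acc) (encodeℕ s) (encodeℕ m′) acc ≡ rangeFrom s m′ acc
  range≡rangeFrom s zero    acc = refl
  range≡rangeFrom s (suc m′) acc rewrite encodeℕ-+ s m′ =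
    trans (range≡rangeFrom s m′ _) (rangeFrom-snoc s m′ acc)

  encodeVec-tabulate′ : ∀ s (f : Fin m′ → Fin m) → (∀ i → toℕ (f i) ≡ s + toℕ i) →
    rangeFrom s m′ leaf ≡ encodeVec encodeFin (tabulate f)
  encodeVec-tabulate′ {zero}  s f eq = refl
  encodeVec-tabulate′ {suc m′} s f eq = cong₂ node
    (sym (trans (encodeFin≡ (f zero)) (cong encodeℕ (trans (eq zero) (+-identityʳ s)))))
    (encodeVec-tabulate′ (suc s) (f ∘ suc) (λ i → trans (eq (suc i)) (+-suc s (toℕ i))))

encodeVec-tabulate : ∀ s (f : Fin m′ → Fin m) → (∀ i → toℕ (f i) ≡ s + toℕ i) →
  rangeT (encodeℕ s) (encodeℕ m′) ≡ encodeVec encodeFin (tabulate f)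
encodeVec-tabulate {m′} s f eq = trans (range≡rangeFrom s m′ leaf) (encodeVec-tabulate′ s f eq)

encodeVec-replicate : ∀ {A : Set} (enc : A → Tree) (x : A) m′ →
  repeatT (enc x) (encodeℕ m′) leaf ≡ encodeVec enc (replicate m′ x)
encodeVec-replicate enc x zero    = refl
encodeVec-replicate enc x (suc m′) =
  trans (cons m′ leaf) (cong (node (enc x)) (encodeVec-replicate enc x m′))
  where
  cons : ∀ m′ acc → repeatT (enc x) (encodeℕ m′) (node (enc x) acc) ≡ node (enc x) (repeatT (enc x) (encodeℕ m′) acc)
  cons zero    acc = refl
  cons (suc m′) acc = cons m′ (node (enc x) acc)

opCode : BinOp → Tree
opCode ∧-op = encodeℕ 2
opCode ∨-op = encodeℕ 3

encodeGate-op : ∀ ⊙ (i j : Fin w) → encodeGate (opGate ⊙ i j) ≡ node (opCode ⊙) (node (encodeFin i) (encodeFin j))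
encodeGate-op ∧-op i j = refl
encodeGate-op ∨-op i j = refl

-- Each gate shifts the old wires by one while the operands move back by one, so all the
-- gates have the same encoding.
encodeGates-zip : ∀ ⊙ {s t k l} (f g : Fin m′ → Fin w) (rest : Gates (m′ + w) w′) →
  (∀ i → toℕ (f i) ≡ s + toℕ i) → (∀ i → toℕ (g i) ≡ t + toℕ i) →
  suc k ≡ m′ + s → suc l ≡ m′ + t →
  repeatT (node (opCode ⊙) (node (encodeℕ k) (encodeℕ l))) (encodeℕ m′) (encodeGates rest) ≡
  encodeGates (zipThen ⊙ (tabulate f) (tabulate g) rest)
encodeGates-zip {zero}  ⊙ f g rest f≡ g≡ k≡ l≡ = refl
encodeGates-zip {suc m′} ⊙ {s} {t} {k} {l} f g rest f≡ g≡ k≡ l≡ =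
  trans (cong (λ x → repeatT (node (opCode ⊙) (node (encodeℕ k) (encodeℕ l))) (encodeℕ m′) (node x (encodeGates rest)))
          (sym (trans (encodeGate-op ⊙ (m′ ↑ʳ f zero) (m′ ↑ʳ g zero))
            (cong (node (opCode ⊙)) (cong₂ node (operand (f zero) (f≡ zero) k≡) (operand (g zero) (g≡ zero) l≡))))))
    (encodeGates-zip ⊙ (f ∘ suc) (g ∘ suc) (opGate ⊙ (m′ ↑ʳ f zero) (m′ ↑ʳ g zero) ∷ rest)
      (λ i → trans (f≡ (suc i)) (+-suc s (toℕ i))) (λ i → trans (g≡ (suc i)) (+-suc t (toℕ i)))
      (trans k≡ (sym (+-suc m′ s))) (trans l≡ (sym (+-suc m′ t))))
  where
  operand : ∀ {s k} (i : Fin _) → toℕ i ≡ s + 0 → suc k ≡ suc m′ + s → encodeFin (m′ ↑ʳ i) ≡ encodeℕ k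
  operand {s} i i≡ k≡ = trans (encodeFin≡ (m′ ↑ʳ i)) (cong encodeℕ
    (trans (toℕ-↑ʳ m′ i) (trans (cong (m′ +_) (trans i≡ (+-identityʳ s))) (sym (suc-injective k≡)))))

bool-encode : ∀ b → boolT (encodeBool b) ≡ encodeBool b
bool-encode true  = refl
bool-encode false = refl

not-encode : ∀ b → notT (encodeBool b) ≡ encodeBool (¬ᵇ b)
not-encode true  = refl
not-encode false = refl

lookup-encode : ∀ (x : Word w) i → lookupT (encodeWord x) (encodeFin i) ≡ encodeBool (lookup x i)
lookup-encode (b ∷ x) zero    = refl
lookup-encode (b ∷ x) (suc i) = lookup-encode x i

evalGate-encode : ∀ (g : Gate w) x → evalGateT (encodeGate g) (encodeWord x) ≡ encodeBool (evalGate g x)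
evalGate-encode (const b) x = bool-encode b
evalGate-encode (not i)   x rewrite lookup-encode x i = not-encode (lookup x i)
evalGate-encode (and i j) x rewrite lookup-encode x i | lookup-encode x j with lookup x i
... | true  = bool-encode (lookup x j)
... | false = refl
evalGate-encode (or i j)  x rewrite lookup-encode x i | lookup-encode x j with lookup x i
... | true  = refl
... | false = bool-encode (lookup x j)

evalGates-encode : ∀ (gs : Gates w w′) x →
  evalGatesT (encodeGates gs) (encodeWord x) ≡ encodeWord (evalGates gs x)
evalGates-encode []       x = refl
evalGates-encode (g ∷ gs) x rewrite evalGate-encode g x = evalGates-encode gs (evalGate g x ∷ x)

eval-encode : ∀ (C : Circuit m m′) x → evalT (encodeCircuit C) (encodeWord x) ≡ encodeWord (eval C x)
eval-encode C x rewrite evalGates-encode (gates C) x = go (evalGates (gates C) x) (outputs C)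
  where
  go : ∀ (ws : Word w) (is : Vec (Fin w) m′) →
    mapT (λ e l → lookupT e (leftOf l)) (encodeWord ws) leaf (encodeVec encodeFin is) ≡ encodeWord (map (lookup ws) is)
  go ws []       = refl
  go ws (i ∷ is) = cong₂ node (lookup-encode ws i) (go ws is)

infix 4 _≟ʷ_

_≟ʷ_ : DecidableEquality (Word w)
_≟ʷ_ = ≡-dec _≟ᵇ_

sameBit-encode : ∀ b c d → ifT (encodeBool b) (sameBitT (encodeBool c) (encodeBool d)) ff ≡ encodeBool (b ∧ does (c ≟ᵇ d))
sameBit-encode true  true  true  = refl
sameBit-encode true  true  false = refl
sameBit-encode true  false true  = refl
sameBit-encode true  false false = refl
sameBit-encode false c     d     = refl

same-encode : ∀ b (x y : Word w) →
  sameT (encodeBool b) (encodeWord x) (encodeWord y) ≡ encodeBool (b ∧ does (x ≟ʷ y))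
same-encode true  [] [] = refl
same-encode false [] [] = refl
same-encode b (c ∷ x) (d ∷ y) rewrite sameBit-encode b c d =
  trans (same-encode (b ∧ does (c ≟ᵇ d)) x y)
        (cong encodeBool (∧-assoc b (does (c ≟ᵇ d)) (does (x ≟ʷ y))))

-- Uniform families of numbers, words and circuits

-- N is the parameter in which numbers and circuit sizes have to be polynomial.
module Uniform {A : Set} (i : A → Tree) (N : A → ℕ) where

  record UniformNumber (n : A → ℕ) : Set where
    field
      unary  : PolyTime i (λ a → encodeℕ (n a))
      degree : Poly
      below  : ∀ a → n a ≤ ⟦ degree ⟧ (N a)

  record UniformWord {w : A → ℕ} (x : ∀ a → Word (w a)) : Set where
    field digits : PolyTime i (λ a → encodeWord (x a))

  -- The two bounds have different variables: `code` asks for time polynomial in the size of the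
  -- input, `small` for a gate count polynomial in `N`. The polynomial `degree` becomes the size
  -- bound of the target problem.
  record UniformCircuit {m n : A → ℕ} (C : ∀ a → Circuit (m a) (n a)) : Set where
    field
      code   : PolyTime i (λ a → encodeCircuit (C a))
      degree : Poly
      small  : ∀ a → circuitSize (C a) ≤ ⟦ degree ⟧ (N a)

  open UniformNumber
  open UniformWord
  open UniformCircuit

  constNumber : ∀ c → UniformNumber (λ _ → c)
  constNumber c = record { unary = constₚ (encodeℕ c) ; degree = con c ; below = λ _ → ≤-refl }

  infixl 6 _+ᵤ_

  opaque
    _+ᵤ_ : ∀ {m n} → UniformNumber m → UniformNumber n → UniformNumber (λ a → m a + n a)
    _+ᵤ_ {m} {n} M M′ = record
      { unary  = congₚ (λ a → encodeℕ-+ (m a) (n a)) (appendₚ (unary M) (unary M′))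
      ; degree = degree M ⊕ degree M′
      ; below  = λ a → +-mono-≤ (below M a) (below M′ a)
      }

  opaque
    constCircuit : ∀ {m n} (C : Circuit m n) → UniformCircuit (λ _ → C)
    constCircuit C = record { code = constₚ (encodeCircuit C) ; degree = con (circuitSize C) ; small = λ _ → ≤-refl }

  opaque
    unfolding constBit

    constBitᵤ : ∀ b {m : A → ℕ} → UniformCircuit (λ a → constBit {m a} b)
    -- The encoding does not mention the number of inputs, so the one for no inputs serves for every
    -- `m`.
    constBitᵤ b = record { code = constₚ (encodeCircuit (constBit {0} b)) ; degree = con 1 ; small = λ _ → ≤-refl }

  countGates-++ : ∀ {w w′ w″} (gs : Gates w w′) (hs : Gates w′ w″) →
    countGates (gs ++ᵍ hs) ≡ countGates gs + countGates hs
  countGates-++ []       hs = refl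
  countGates-++ (g ∷ gs) hs = cong suc (countGates-++ gs hs)

  countGates-zip : ∀ ⊙ {w w′ n} (xs ys : Vec (Fin w) n) (rest : Gates (n + w) w′) →
    countGates (zipThen ⊙ xs ys rest) ≡ n + countGates rest
  countGates-zip ⊙ [] [] rest = refl
  countGates-zip ⊙ (_∷_ {n = n} x xs) (y ∷ ys) rest = trans (countGates-zip ⊙ xs ys _) (+-suc n _)

  countGates-weaken : ∀ r {w w′} (gs : Gates w w′) → countGates (weaken r gs) ≡ countGates gs
  countGates-weaken r []       = refl
  countGates-weaken r (g ∷ gs) = cong suc (countGates-weaken r gs)

  countGates-attach : ∀ {m w n l} (gs : Gates m w) (xs : Vec (Fin w) n) (D : Circuit n l) →
    countGates (attach gs xs D) ≡ countGates gs + (n + circuitSize D)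
  countGates-attach {w = w} {n} gs xs D =
    trans (countGates-++ gs _) (cong (countGates gs +_)
      (trans (countGates-zip ∨-op xs xs _) (cong (n +_) (countGates-weaken w (gates D)))))

  encodeGates-attach : ∀ {m w n l} (gs : Gates m w) (xs : Vec (Fin w) n) (D : Circuit n l) →
    appendT (encodeGates gs) (copyT (encodeVec encodeFin xs) (encodeGates (gates D))) ≡ encodeGates (attach gs xs D)
  encodeGates-attach {w = w} gs xs D =
    trans (cong (λ t → appendT (encodeGates gs) (copyT (encodeVec encodeFin xs) t)) (sym (encodeGates-weaken w (gates D))))
      (trans (cong (appendT (encodeGates gs)) (encodeGates-copy xs (weaken w (gates D))))
             (encodeGates-++ gs (copyThen xs (weaken w (gates D)))))

  module _ {m n l : A → ℕ} {C : ∀ a → Circuit (m a) (n a)} where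

    opaque
      unfolding _⨾_

      seqᵤ : ∀ {D : ∀ a → Circuit (n a) (l a)} →
        UniformNumber n → UniformCircuit C → UniformCircuit D → UniformCircuit (λ a → C a ⨾ D a)
      seqᵤ {D} Nn UC UD = record
        { code   = congₚ (λ a → cong₂ node (encodeGates-attach (gates (C a)) (outputs (C a)) (D a))
                                           (sym (encodeVec-↑ˡ (wires (C a)) (outputs (D a)))))
            (nodeₚ (appendₚ (leftₚ (code UC)) (copyₚ (rightₚ (code UC)) (leftₚ (code UD)))) (rightₚ (code UD)))
        ; degree = degree UC ⊕ (degree Nn ⊕ degree UD)
        ; small  = λ a → ≤-trans (≤-reflexive (countGates-attach (gates (C a)) (outputs (C a)) (D a)))
            (+-mono-≤ (small UC a) (+-mono-≤ (below Nn a) (small UD a)))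
        }

    opaque
      unfolding _△_

      pairᵤ : ∀ {D : ∀ a → Circuit (m a) (l a)} →
        UniformNumber m → UniformCircuit C → UniformCircuit D → UniformCircuit (λ a → C a △ D a)
      pairᵤ {D} Nm UC UD = record
        { code   = congₚ (λ a → cong₂ node (gates≡ a) (outputs≡ a))
            (nodeₚ (appendₚ (leftₚ (code UC))
                            (copyₚ (rangeₚ (lengthₚ (leftₚ (code UC))) (unary Nm)) (leftₚ (code UD))))
                   (appendₚ (shiftₚ (appendₚ (lengthₚ (leftₚ (code UD))) (unary Nm)) (rightₚ (code UC)))
                            (rightₚ (code UD))))
        ; degree = degree UC ⊕ (degree Nm ⊕ degree UD)
        ; small  = λ a → ≤-trans (≤-reflexive (countGates-attach (gates (C a)) (tabulate (inputWire (gates (C a)))) (D a)))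
            (+-mono-≤ (small UC a) (+-mono-≤ (below Nm a) (small UD a)))
        }
        where
        gates≡ : ∀ a → appendT (encodeGates (gates (C a)))
            (copyT (rangeT (lengthT (encodeGates (gates (C a)))) (encodeℕ (m a))) (encodeGates (gates (D a)))) ≡
          encodeGates (gates (C a △ D a))
        gates≡ a = trans
          (cong (λ t → appendT (encodeGates (gates (C a))) (copyT t (encodeGates (gates (D a)))))
            (trans (cong (λ t → rangeT t (encodeℕ (m a))) (length-encodeGates (gates (C a))))
              (encodeVec-tabulate (countGates (gates (C a))) (inputWire (gates (C a))) (toℕ-inputWire (gates (C a))))))
          (encodeGates-attach (gates (C a)) (tabulate (inputWire (gates (C a)))) (D a))
        outputs≡ : ∀ a → appendT
            (shiftT (appendT (lengthT (encodeGates (gates (D a)))) (encodeℕ (m a))) (encodeVec encodeFin (outputs (C a))))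
            (encodeVec encodeFin (outputs (D a))) ≡
          encodeVec encodeFin (outputs (C a △ D a))
        outputs≡ a = trans
          (cong₂ appendT
            (trans (cong (λ t → shiftT t (encodeVec encodeFin (outputs (C a))))
                (trans (cong (λ t → appendT t (encodeℕ (m a))) (length-encodeGates (gates (D a))))
                  (trans (encodeℕ-+ (circuitSize (D a)) (m a)) (cong encodeℕ (sym (wires≡ (gates (D a))))))))
              (encodeVec-↑ʳ (wires (D a)) (outputs (C a))))
            (sym (encodeVec-↑ˡ (wires (C a)) (outputs (D a)))))
          (encodeVec-++ encodeFin (map (wires (D a) ↑ʳ_) (outputs (C a))) _)

  opaque
    unfolding lowWires

    lowᵤ : ∀ {m} (n : A → ℕ) → UniformNumber m → UniformCircuit (λ a → lowWires (m a) (n a))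
    lowᵤ n M = record
      { code   = nodeₚ leafₚ (congₚ (λ a → encodeVec-tabulate 0 (_↑ˡ n a) (λ j → toℕ-↑ˡ j (n a)))
                   (rangeₚ leafₚ (unary M)))
      ; degree = con 0
      ; small  = λ _ → z≤n
      }

  opaque
    unfolding highWires

    highᵤ : ∀ {m n} → UniformNumber m → UniformNumber n → UniformCircuit (λ a → highWires (m a) (n a))
    highᵤ {m} M M′ = record
      { code   = nodeₚ leafₚ (congₚ (λ a → encodeVec-tabulate (m a) (m a ↑ʳ_) (toℕ-↑ʳ (m a)))
                   (rangeₚ (unary M) (unary M′)))
      ; degree = con 0
      ; small  = λ _ → z≤n
      }

  opaque
    unfolding fanout

    fanoutᵤ : ∀ {n} → UniformNumber n → UniformCircuit (λ a → fanout (n a))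
    fanoutᵤ {n} M = record
      { code   = nodeₚ leafₚ (congₚ (λ a → encodeVec-replicate encodeFin zero (n a)) (repeatₚ leafₚ (unary M) leafₚ))
      ; degree = con 0
      ; small  = λ _ → z≤n
      }

  opaque
    unfolding bitwise

    bitwiseᵤ : ∀ ⊙ {n} → UniformNumber n → UniformCircuit (λ a → bitwise ⊙ (n a))
    bitwiseᵤ ⊙ {n} M = record
      { code   = nodeₚ
          (congₚ (λ a → gates≡ (n a))
            -- The first gate to run joins the last components, on wires `n - 1` and `n + n - 1`,
            -- and all later gates have the same code. For `n = 0` the truncated predecessor does no
            -- harm, as nothing is repeated.
            (repeatₚ (nodeₚ (constₚ (opCode ⊙)) (nodeₚ (rightₚ (unary M)) (appendₚ (unary M) (rightₚ (unary M)))))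
                     (unary M) leafₚ))
          (congₚ (λ a → encodeVec-tabulate 0 (_↑ˡ (n a + n a)) (λ j → toℕ-↑ˡ j (n a + n a))) (rangeₚ leafₚ (unary M)))
      ; degree = degree M ⊕ con 0
      ; small  = λ a → ≤-trans (≤-reflexive (countGates-zip ⊙ (tabulate (_↑ˡ n a)) (tabulate (n a ↑ʳ_)) []))
                               (+-monoˡ-≤ 0 (below M a))
      }
      where
      gates≡ : ∀ n → repeatT (node (opCode ⊙) (node (rightOf (encodeℕ n)) (appendT (encodeℕ n) (rightOf (encodeℕ n)))))
          (encodeℕ n) leaf ≡ encodeGates (zipThen ⊙ (tabulate (_↑ˡ n)) (tabulate (n ↑ʳ_)) [])
      gates≡ zero    = refl
      gates≡ (suc n) = trans
        (cong (λ t → repeatT (node (opCode ⊙) (node (encodeℕ n) t)) (encodeℕ (suc n)) leaf) (encodeℕ-+ (suc n) n))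
        (encodeGates-zip ⊙ (_↑ˡ suc n) (suc n ↑ʳ_) [] (λ j → toℕ-↑ˡ j (suc n)) (toℕ-↑ʳ (suc n))
          (cong suc (sym (+-identityʳ n))) (sym (+-suc (suc n) n)))

  opaque
    unfolding mux

    muxᵤ : ∀ {m n} {S : ∀ a → Circuit (m a) 1} {C D : ∀ a → Circuit (m a) (n a)} →
      UniformNumber m → UniformNumber n → UniformCircuit S → UniformCircuit C → UniformCircuit D →
      UniformCircuit (λ a → mux (S a) (C a) (D a))
    muxᵤ Nm Nn US UC UD = seqᵤ (Nn +ᵤ Nn)
      (pairᵤ Nm (seqᵤ (Nn +ᵤ Nn) (pairᵤ Nm (seqᵤ (constNumber 1) US (fanoutᵤ Nn)) UC) (bitwiseᵤ ∧-op Nn))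
                (seqᵤ (Nn +ᵤ Nn) (pairᵤ Nm (seqᵤ (constNumber 1) (seqᵤ (constNumber 1) US (constCircuit negate)) (fanoutᵤ Nn)) UD) (bitwiseᵤ ∧-op Nn)))
      (bitwiseᵤ ∨-op Nn)

  opaque
    evalᵤ : ∀ {m n : A → ℕ} {C : ∀ a → Circuit (m a) (n a)} {x : ∀ a → Word (m a)} →
      UniformCircuit C → UniformWord x → UniformWord (λ a → eval (C a) (x a))
    evalᵤ {C = C} {x} UC UX = record
      { digits = congₚ (λ a → eval-encode (C a) (x a)) (evalₚ (code UC) (digits UX)) }

  opaque
    zerosᵤ : ∀ {n} → UniformNumber n → UniformWord (λ a → replicate (n a) false)
    zerosᵤ {n} M = record
      { digits = congₚ (λ a → encodeVec-replicate encodeBool false (n a)) (repeatₚ leafₚ (unary M) leafₚ) }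

  UniformBool : (A → Bool) → Set
  UniformBool b = PolyTime i (λ a → encodeBool (b a))

  opaque
    equalᵤ : ∀ {w : A → ℕ} {x y : ∀ a → Word (w a)} → UniformWord x → UniformWord y →
      UniformBool (λ a → does (x a ≟ʷ y a))
    equalᵤ {x = x} {y} X Y = congₚ (λ a → same-encode true (x a) (y a)) (sameₚ (constₚ tt) (digits X) (digits Y))

module _ {A B : Set} {i : A → Tree} {N : A → ℕ} {j : B → Tree} (h : B → A) (H : PolyTime j (i ∘ h)) where

  open Uniform

  opaque
    -- Solution maps receive an instance paired with a solution. With `h` the projection to the
    -- instance, whatever is computed from instances becomes available to them.
    reindexNumber : ∀ {n} → UniformNumber i N n → UniformNumber j (N ∘ h) (n ∘ h)
    reindexNumber M = record
      { unary = thenₚ H (restrict h (UniformNumber.unary M)) ; degree = UniformNumber.degree M ; below = UniformNumber.below M ∘ h }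

  opaque
    reindexCircuit : ∀ {m n : A → ℕ} {C : ∀ a → Circuit (m a) (n a)} →
      UniformCircuit i N C → UniformCircuit j (N ∘ h) (C ∘ h)
    reindexCircuit UC = record
      { code = thenₚ H (restrict h (UniformCircuit.code UC)) ; degree = UniformCircuit.degree UC ; small = UniformCircuit.small UC ∘ h }

-- Words as numbers; low bits and blocks

import Induction.WellFounded as WF

take-++ : ∀ {A : Set} (xs : Vec A m) (ys : Vec A m′) → take m (xs ++ ys) ≡ xs
take-++ {m} xs ys = ++-injectiveˡ (take m (xs ++ ys)) xs (take++drop≡id m (xs ++ ys))

drop-++ : ∀ {A : Set} (xs : Vec A m) (ys : Vec A m′) → drop m (xs ++ ys) ≡ ys
drop-++ {m} xs ys = ++-injectiveʳ (take m (xs ++ ys)) xs (take++drop≡id m (xs ++ ys))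

eval-low≡take : ∀ m (x : Word (m + m′)) → eval (lowWires m m′) x ≡ take m x
eval-low≡take {m′} m x = trans (cong (eval (lowWires m m′)) (sym (take++drop≡id m x))) (eval-low (take m x) (drop m x))

eval-high≡drop : ∀ m (x : Word (m + m′)) → eval (highWires m m′) x ≡ drop m x
eval-high≡drop {m′} m x = trans (cong (eval (highWires m m′)) (sym (take++drop≡id m x))) (eval-high (take m x) (drop m x))

take-drop-injective : ∀ {A : Set} m (xs ys : Vec A (m + m′)) → take m xs ≡ take m ys → drop m xs ≡ drop m ys → xs ≡ ys
take-drop-injective m xs ys p q = trans (sym (take++drop≡id m xs)) (trans (cong₂ _++_ p q) (take++drop≡id m ys))

value-++ : (x : Word m) (y : Word m′) → value (x ++ y) ≡ value x + 2 ^ m * value y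
value-++ []      y = sym (+-identityʳ (value y))
value-++ {suc m} (false ∷ x) y = trans (cong (2 *_) (value-++ x y))
  (trans (*-distribˡ-+ 2 (value x) (2 ^ m * value y)) (cong (2 * value x +_) (sym (*-assoc 2 (2 ^ m) (value y)))))
value-++ {suc m} (true ∷ x) y = cong suc (trans (cong (2 *_) (value-++ x y))
  (trans (*-distribˡ-+ 2 (value x) (2 ^ m * value y)) (cong (2 * value x +_) (sym (*-assoc 2 (2 ^ m) (value y))))))

value-split : ∀ m (x : Word (m + m′)) → value x ≡ value (take m x) + 2 ^ m * value (drop m x)
value-split m x = trans (cong value (sym (take++drop≡id m x))) (value-++ (take m x) (drop m x))

value< : (x : Word w) → value x < 2 ^ w
value< []          = s≤s z≤n
value< {suc w} (false ∷ x) = *-monoʳ-< 2 (value< x)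
value< {suc w} (true ∷ x)  = ≤-trans (≤-reflexive (sym (*-suc 2 (value x)))) (*-monoʳ-≤ 2 (value< x))

value-injective : (x y : Word w) → value x ≡ value y → x ≡ y
value-injective [] [] eq = refl
value-injective (false ∷ x) (false ∷ y) eq = cong (false ∷_) (value-injective x y (*-cancelˡ-≡ _ _ 2 eq))
value-injective (true ∷ x) (true ∷ y) eq = cong (true ∷_) (value-injective x y (*-cancelˡ-≡ _ _ 2 (suc-injective eq)))
value-injective (false ∷ x) (true ∷ y) eq = ⊥-elim (even≢odd (value x) (value y) eq)
value-injective (true ∷ x) (false ∷ y) eq = ⊥-elim (even≢odd (value y) (value x) (sym eq))

value-zeros : ∀ w → value (replicate w false) ≡ 0
value-zeros zero    = refl
value-zeros (suc w) = cong (2 *_) (value-zeros w)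

increment : Word w → Word w
increment []          = []
increment (false ∷ x) = true ∷ x
increment (true ∷ x)  = false ∷ increment x

value-increment : (x : Word w) → suc (value x) < 2 ^ w → value (increment x) ≡ suc (value x)
value-increment []          (s≤s ())
value-increment (false ∷ x) lt = refl
value-increment {suc w} (true ∷ x) lt = trans (cong (2 *_) (value-increment x (*-cancelˡ-< 2 _ _
  (≤-trans (s≤s (≤-reflexive (*-suc 2 (value x)))) lt)))) (*-suc 2 (value x))

toWord : ∀ w → ℕ → Word w
toWord w zero    = replicate w false
toWord w (suc k) = increment (toWord w k)

value-toWord : ∀ w k → k < 2 ^ w → value (toWord w k) ≡ k
value-toWord w zero    lt = value-zeros w
value-toWord w (suc k) lt = trans (value-increment (toWord w k) (subst (λ z → suc z < 2 ^ w) (sym ih) lt)) (cong suc ih)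
  where ih = value-toWord w k (≤-trans (n≤1+n _) lt)

-- Halving with rounding up is undone by doubling. The accessibility proof is arbitrary because
-- `⌈log2⌉` recurses on it and passes on a different one.
2^⌈log2⌉ : ∀ k (rec : WF.Acc _<_ k) → k ≤ 2 ^ ⌈log2⌉ k rec
2^⌈log2⌉ zero          _        = z≤n
2^⌈log2⌉ (suc zero)    _        = s≤s z≤n
2^⌈log2⌉ (suc (suc k)) (WF.acc rs) = begin
  2 + k                           ≡⟨ cong (2 +_) (sym (⌊n/2⌋+⌈n/2⌉≡n k)) ⟩
  2 + (⌊ k /2⌋ + ⌈ k /2⌉)         ≤⟨ +-monoʳ-≤ 2 (+-monoˡ-≤ ⌈ k /2⌉ (⌊n/2⌋≤⌈n/2⌉ k)) ⟩
  2 + (⌈ k /2⌉ + ⌈ k /2⌉)         ≡⟨ solve 1 (λ h → con 2 :+ (h :+ h) := con 2 :* (con 1 :+ h)) refl ⌈ k /2⌉ ⟩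
  2 * suc ⌈ k /2⌉                 ≤⟨ *-monoʳ-≤ 2 (2^⌈log2⌉ (suc ⌈ k /2⌉) _) ⟩
  2 * 2 ^ ⌈log2⌉ (suc ⌈ k /2⌉) _  ∎
  where
  open ≤-Reasoning
  open +-*-Solver

k≤2^⌈log₂k⌉ : ∀ k → k ≤ 2 ^ ⌈log₂ k ⌉
k≤2^⌈log₂k⌉ k = 2^⌈log2⌉ k (<-wellFounded k)

choose2 : ∀ k → suc k choose 2 ≡ k + (k choose 2)
choose2 k = trans (sym (nCk+nC[k+1]≡[n+1]C[k+1] k 1)) (cong (_+ (k choose 2)) (nC1≡n k))

-- Being below a multiple of `2 ^ m′` is a condition on the block number alone; `high-vertex` is the
-- converse.
vertex-high : ∀ {K} (v : Word (m′ + w)) → value v < K * 2 ^ m′ → value (drop m′ v) < K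
vertex-high {m′} {w} {K} v lt = *-cancelʳ-< (2 ^ m′) _ _ (begin-strict
  value (drop m′ v) * 2 ^ m′                      ≡⟨ *-comm (value (drop m′ v)) (2 ^ m′) ⟩
  2 ^ m′ * value (drop m′ v)                      ≤⟨ m≤n+m _ (value (take m′ v)) ⟩
  value (take m′ v) + 2 ^ m′ * value (drop m′ v)   ≡⟨ sym (value-split m′ v) ⟩
  value v                                       <⟨ lt ⟩
  K * 2 ^ m′                                     ∎)
  where open ≤-Reasoning

high-vertex : ∀ {K} (x : Word m′) (h : Word w) → value h < K → value (x ++ h) < K * 2 ^ m′
high-vertex {m′} {w} {K} x h lt = begin-strict
  value (x ++ h)             ≡⟨ value-++ x h ⟩
  value x + 2 ^ m′ * value h  <⟨ +-monoˡ-< (2 ^ m′ * value h) (value< x) ⟩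
  2 ^ m′ + 2 ^ m′ * value h    ≡⟨ sym (*-suc (2 ^ m′) (value h)) ⟩
  2 ^ m′ * suc (value h)      ≤⟨ *-monoʳ-≤ (2 ^ m′) lt ⟩
  2 ^ m′ * K                  ≡⟨ *-comm (2 ^ m′) K ⟩
  K * 2 ^ m′                  ∎
  where open ≤-Reasoning

-- Composition of reductions

Reduces-trans : ∀ {A B C} → Reduces A B → Reduces B C → Reduces A C
Reduces-trans {A} {B} {C} R S = record
  { f = λ I → S.f (R.f I)
  ; g = λ I s → R.g I (S.g (R.f I) s)
  ; f-polyTime = thenₚ R.f-polyTime (restrict R.f S.f-polyTime)
  ; g-polyTime = thenₚ
      (nodeₚ (leftₚ idₚ)
        -- `S.g` needs the encoding of `R.f I`, which the input does not contain; it is recomputed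
        -- from that of `I`.
        (thenₚ (nodeₚ (thenₚ (leftₚ idₚ) (restrict proj₁ R.f-polyTime)) (rightₚ idₚ))
               (restrict (λ (I , s) → R.f I , s) S.g-polyTime)))
      (restrict (λ (I , s) → I , S.g (R.f I) s) R.g-polyTime)
  }
  where
  module R = Reduces R
  module S = Reduces S

open SearchProblem

-- From Collision to Bad 2-Coloring

module CollisionToColoring (p : Poly) where

  -- The two values are 1 and 2 with the least significant digit first; 0 is not a colour.
  colour : Word 1 → Word 2
  colour (false ∷ []) = true ∷ false ∷ []
  colour (true ∷ [])  = false ∷ true ∷ []

  module _ (n : ℕ) where
    xPart yPart : Circuit ((n + n) + 1) n
    xPart = lowWires (n + n) 1 ⨾ lowWires n n
    yPart = lowWires (n + n) 1 ⨾ highWires n n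

    lastPart : Circuit ((n + n) + 1) 1
    lastPart = highWires (n + n) 1

    -- The top bit of an index singles out the added edge, both of whose ends have zero low bits.
    maskedBy : Circuit n n → Circuit ((n + n) + 1) n → Circuit ((n + n) + 1) n
    maskedBy C Z = mux lastPart (constBit false ⨾ fanout n) (Z ⨾ C)

    -- The last bit of a vertex names its side of the bipartite graph. The first end always lies on
    -- side `false` and the second on side `true`, so equal unordered pairs are equal as ordered
    -- pairs. In particular the added edge joins two different vertices.
    edges : Circuit n n → Circuit ((n + n) + 1) ((n + 1) + (n + 1))
    edges C = (maskedBy C xPart △ constBit false) △ (maskedBy C yPart △ constBit true)

    colours : Circuit (n + 1) 2
    colours = highWires n 1 ⨾ table colour

  module _ {n : ℕ} where
    x y : Word ((n + n) + 1) → Word n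
    x i = eval (xPart n) i
    y i = eval (yPart n) i

    last : Word ((n + n) + 1) → Word 1
    last i = eval (lastPart n) i

    rebuild : ∀ i → (x i ++ y i) ++ last i ≡ i
    rebuild i = begin
      (x i ++ y i) ++ last i
        ≡⟨ cong₂ _++_ (cong₂ _++_
             (trans (eval-⨾ (lowWires (n + n) 1) (lowWires n n) i) (eval-low≡take n (eval (lowWires (n + n) 1) i)))
             (trans (eval-⨾ (lowWires (n + n) 1) (highWires n n) i) (eval-high≡drop n (eval (lowWires (n + n) 1) i))))
             (eval-high≡drop (n + n) i) ⟩
      (take n (eval (lowWires (n + n) 1) i) ++ drop n (eval (lowWires (n + n) 1) i)) ++ drop (n + n) i
        ≡⟨ cong (_++ drop (n + n) i) (trans (take++drop≡id n (eval (lowWires (n + n) 1) i)) (eval-low≡take (n + n) i)) ⟩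
      take (n + n) i ++ drop (n + n) i
        ≡⟨ take++drop≡id (n + n) i ⟩
      i ∎
      where open ≡-Reasoning

    zeros : Word n
    zeros = replicate n false

    masked : Circuit n n → Word 1 → Word n → Word n
    masked C b z = if head b then zeros else eval C z

    eval-masked : ∀ C (Z : Circuit ((n + n) + 1) n) i → eval (maskedBy n C Z) i ≡ masked C (last i) (eval Z i)
    eval-masked C Z i = trans
      (eval-mux (lastPart n) (constBit false ⨾ fanout n) (Z ⨾ C) i (η (last i)))
      (cong₂ (if_then_else_ (head (last i)))
        (trans (eval-⨾ (constBit false) (fanout n) i)
          (trans (cong (eval (fanout n)) (eval-constBit false i)) (eval-fanout n false))) (eval-⨾ Z C i))
      where
      η : (b : Word 1) → b ≡ [ head b ]
      η (b ∷ []) = refl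

    eval-edges : ∀ C i → eval (edges n C) i ≡
      (masked C (last i) (x i) ++ [ false ]) ++ (masked C (last i) (y i) ++ [ true ])
    eval-edges C i = trans (eval-△ (maskedBy n C (xPart n) △ constBit false) _ i) (cong₂ _++_
      (trans (eval-△ (maskedBy n C (xPart n)) (constBit false) i) (cong₂ _++_ (eval-masked C (xPart n) i) (eval-constBit false i)))
      (trans (eval-△ (maskedBy n C (yPart n)) (constBit true) i) (cong₂ _++_ (eval-masked C (yPart n) i) (eval-constBit true i))))

    edge≡ : ∀ C i → edge 2 n (edges n C) i ≡
      (masked C (last i) (x i) ++ [ false ] , masked C (last i) (y i) ++ [ true ])
    edge≡ C i = cong₂ _,_ (trans (cong (take (n + 1)) (eval-edges C i)) (take-++ (masked C (last i) (x i) ++ [ false ]) _))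
                          (trans (cong (drop (n + 1)) (eval-edges C i)) (drop-++ (masked C (last i) (x i) ++ [ false ]) _))

    eval-colours : ∀ (z : Word n) b → eval (colours n) (z ++ [ b ]) ≡ colour [ b ]
    eval-colours z b = trans (eval-⨾ (highWires n 1) (table colour) (z ++ [ b ]))
      (trans (eval-table colour (eval (highWires n 1) (z ++ [ b ]))) (cong colour (eval-high z [ b ])))

    inRange : ∀ (v : Word (n + 1)) → IsVertex 2 n v
    inRange v = subst (value v <_) (trans (^-distribˡ-+-* 2 n 1) (*-comm (2 ^ n) 2)) (value< v)

    coloursInRange : ∀ v → IsVertex 2 n v → IsColour 2 (eval (colours n) v)
    coloursInRange v _ = subst (λ v → IsColour 2 (eval (colours n) v)) (take++drop≡id n v)
      (go (take n v) (drop n v))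
      where
      go : ∀ z (b : Word 1) → IsColour 2 (eval (colours n) (z ++ b))
      go z (false ∷ []) rewrite eval-colours z false = s≤s z≤n , s≤s z≤n
      go z (true ∷ [])  rewrite eval-colours z true  = s≤s z≤n , s≤s (s≤s z≤n)

    colour-false≢true : colour [ false ] ≢ colour [ true ]
    colour-false≢true ()

    -- The colour is read off the side bit, so this holds whatever `C` computes, and for the added
    -- edge as well. It leaves repetitions as the only possible solutions.
    bichromatic : ∀ C i → eval (colours n) (proj₁ (edge 2 n (edges n C) i)) ≢ eval (colours n) (proj₂ (edge 2 n (edges n C) i))
    bichromatic C i eq = colour-false≢true (begin
      colour [ false ]
        ≡⟨ sym (eval-colours (masked C (last i) (x i)) false) ⟩
      eval (colours n) (masked C (last i) (x i) ++ [ false ])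
        ≡⟨ cong (eval (colours n) ∘ proj₁) (sym (edge≡ C i)) ⟩
      eval (colours n) (proj₁ (edge 2 n (edges n C) i))
        ≡⟨ eq ⟩
      eval (colours n) (proj₂ (edge 2 n (edges n C) i))
        ≡⟨ cong (eval (colours n) ∘ proj₂) (edge≡ C i) ⟩
      eval (colours n) (masked C (last i) (y i) ++ [ true ])
        ≡⟨ eval-colours (masked C (last i) (y i)) true ⟩
      colour [ true ] ∎)
      where open ≡-Reasoning

    samePair-++ : ∀ (u v u′ v′ : Word n) →
      SamePair (u ++ [ false ] , v ++ [ true ]) (u′ ++ [ false ] , v′ ++ [ true ]) → u ≡ u′ × v ≡ v′
    samePair-++ u v u′ v′ (inj₁ (p , q)) = ++-injectiveˡ u u′ p , ++-injectiveˡ v v′ q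
    samePair-++ u v u′ v′ (inj₂ (p , _)) with ++-injectiveʳ u v′ p
    ... | ()

    same : ∀ C i j → SamePair (edge 2 n (edges n C) i) (edge 2 n (edges n C) j) →
      masked C (last i) (x i) ≡ masked C (last j) (x j) × masked C (last i) (y i) ≡ masked C (last j) (y j)
    same C i j s = samePair-++ _ _ _ _ (subst₂ SamePair (edge≡ C i) (edge≡ C j) s)

    -- The range of indices ends at `2 ^ (2 * n)`, so a set top bit forces all other bits to vanish.
    -- Two distinct indices therefore never both stand for the added edge.
    lastIndex : ∀ i → IsIndex 2 n i → last i ≡ [ true ] → i ≡ (zeros ++ zeros) ++ [ true ]
    lastIndex i i≤ eq = trans (sym (rebuild i)) (cong₂ _++_ lo≡ eq)
      where
      z = x i ++ y i
      value≤ : value z + 2 ^ (n + n) * 1 ≤ 0 + 2 ^ (n + n) * 1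
      value≤ = begin
        value z + 2 ^ (n + n) * 1          ≡⟨ sym (value-++ z [ true ]) ⟩
        value (z ++ [ true ])              ≡⟨ cong (λ b → value (z ++ b)) (sym eq) ⟩
        value (z ++ last i)                ≡⟨ cong value (rebuild i) ⟩
        value i                            ≤⟨ i≤ ⟩
        1 * 2 ^ (2 * n)                    ≡⟨ *-comm 1 (2 ^ (2 * n)) ⟩
        2 ^ (2 * n) * 1                    ≡⟨ cong (λ k → 2 ^ (n + k) * 1) (+-identityʳ n) ⟩
        2 ^ (n + n) * 1                    ∎
        where open ≤-Reasoning
      value-zeros² : value (zeros ++ zeros) ≡ 0
      value-zeros² = trans (value-++ zeros zeros) (cong₂ _+_ (value-zeros n) (trans (cong (2 ^ n *_) (value-zeros n)) (*-zeroʳ (2 ^ n))))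
      lo≡ : z ≡ zeros ++ zeros
      lo≡ = value-injective z (zeros ++ zeros)
        (trans (n≤0⇒n≡0 (+-cancelʳ-≤ (2 ^ (n + n) * 1) (value z) 0 value≤)) (sym value-zeros²))

  module _ where
    open Uniform (encodeInstance (Collision p)) CollisionInstance.n

    numberᵤ : UniformNumber CollisionInstance.n
    numberᵤ = record { unary = leftₚ idₚ ; degree = var ; below = λ _ → ≤-refl }

    circuitᵤ : UniformCircuit CollisionInstance.C
    circuitᵤ = record { code = rightₚ idₚ ; degree = p ; small = CollisionInstance.C-small }

    xPartᵤ : UniformCircuit (xPart ∘ CollisionInstance.n)
    xPartᵤ = seqᵤ (numberᵤ +ᵤ numberᵤ) (lowᵤ (λ _ → 1) (numberᵤ +ᵤ numberᵤ)) (lowᵤ CollisionInstance.n numberᵤ)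

    yPartᵤ : UniformCircuit (yPart ∘ CollisionInstance.n)
    yPartᵤ = seqᵤ (numberᵤ +ᵤ numberᵤ) (lowᵤ (λ _ → 1) (numberᵤ +ᵤ numberᵤ)) (highᵤ numberᵤ numberᵤ)

    lastPartᵤ : UniformCircuit (lastPart ∘ CollisionInstance.n)
    lastPartᵤ = highᵤ (numberᵤ +ᵤ numberᵤ) (constNumber 1)

    indexᵤ : UniformNumber (λ I → (CollisionInstance.n I + CollisionInstance.n I) + 1)
    indexᵤ = (numberᵤ +ᵤ numberᵤ) +ᵤ constNumber 1

    maskedᵤ : ∀ {Z : ∀ I → Circuit (CollisionInstance.n I + CollisionInstance.n I + 1) (CollisionInstance.n I)} →
      UniformCircuit Z → UniformCircuit (λ I → maskedBy (CollisionInstance.n I) (CollisionInstance.C I) (Z I))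
    maskedᵤ Z = muxᵤ indexᵤ numberᵤ lastPartᵤ
      (seqᵤ (constNumber 1) (constBitᵤ false) (fanoutᵤ numberᵤ)) (seqᵤ numberᵤ Z circuitᵤ)

    edgesᵤ : UniformCircuit (λ I → edges (CollisionInstance.n I) (CollisionInstance.C I))
    edgesᵤ = pairᵤ indexᵤ (pairᵤ indexᵤ (maskedᵤ xPartᵤ) (constBitᵤ false)) (pairᵤ indexᵤ (maskedᵤ yPartᵤ) (constBitᵤ true))

    coloursᵤ : UniformCircuit (λ I → colours (CollisionInstance.n I))
    coloursᵤ = seqᵤ (constNumber 1) (highᵤ numberᵤ (constNumber 1)) (constCircuit (table colour))

    open UniformCircuit

    q : Poly
    q = degree edgesᵤ ⊕ degree coloursᵤ

    coloring : CollisionInstance p → BadColoringInstance 2 q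
    coloring I = record
      { n = n ; E = edges n C ; C = colours n
      ; E-small = ≤-trans (small edgesᵤ I) (m≤m+n _ _)
      ; C-small = ≤-trans (small coloursᵤ I) (m≤n+m _ (⟦ degree edgesᵤ ⟧ n))
      ; E-inRange = λ i _ → inRange {n} (proj₁ (edge 2 n (edges n C) i)) , inRange {n} (proj₂ (edge 2 n (edges n C) i))
      ; C-inRange = coloursInRange
      }
      where open CollisionInstance I

  module _ {n : ℕ} (C : Circuit n n) where

    masked-true : ∀ {b z} → b ≡ [ true ] → masked C b z ≡ zeros
    masked-true refl = refl

    not-true : {b : Word 1} → b ≢ [ true ] → b ≡ [ false ]
    not-true {false ∷ []} _  = refl
    not-true {true ∷ []}  b≢ = ⊥-elim (b≢ refl)

    masked-false : ∀ {b z} → b ≢ [ true ] → masked C b z ≡ eval C z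
    masked-false b≢ rewrite not-true b≢ = refl

  module _ (I : CollisionInstance p) where
    open CollisionInstance I

    -- If one index is the added edge, then the other is not, and `C` sends its `x` to zero.
    -- Otherwise `C` agrees on the two `x` and on the two `y`, and distinct indices differ in one of
    -- these pairs. The decisions are arguments so that `answer≡` can split on them.
    solve : ∀ i j → IsIndex 2 n i → IsIndex 2 n j → i ≢ j →
      SamePair (edge 2 n (edges n C) i) (edge 2 n (edges n C) j) →
      Dec (last {n} i ≡ [ true ]) → Dec (last {n} j ≡ [ true ]) → Dec (x {n} i ≡ x {n} j) → CollisionSolution p I
    solve i j i≤ j≤ i≢j s (yes li) lj _ = preimage (x {n} j) (eq lj)
      where
      eq : Dec (last {n} j ≡ [ true ]) → eval C (x {n} j) ≡ zeros
      eq (yes lj) = ⊥-elim (i≢j (trans (lastIndex {n} i i≤ li) (sym (lastIndex {n} j j≤ lj))))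
      eq (no lj)  = trans (sym (masked-false C lj)) (trans (sym (proj₁ (same C i j s))) (masked-true C li))
    solve i j i≤ j≤ i≢j s (no li) (yes lj) _ = preimage (x {n} i)
      (trans (sym (masked-false C li)) (trans (proj₁ (same C i j s)) (masked-true C lj)))
    solve i j i≤ j≤ i≢j s (no li) (no lj) (yes xi≡xj) = collide (y {n} i) (y {n} j)
      (λ yi≡yj → i≢j (trans (sym (rebuild i)) (trans
        (cong₂ _++_ (cong₂ _++_ xi≡xj yi≡yj) (trans (not-true C li) (sym (not-true C lj)))) (rebuild j))))
      (trans (sym (masked-false C li)) (trans (proj₂ (same C i j s)) (masked-false C lj)))
    solve i j i≤ j≤ i≢j s (no li) (no lj) (no xi≢xj) = collide (x {n} i) (x {n} j) xi≢xj
      (trans (sym (masked-false C li)) (trans (proj₁ (same C i j s)) (masked-false C lj)))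

    -- The case distinction of `solve` on the bare words, in the form that a program can carry out.
    answer : Word ((n + n) + 1) → Word ((n + n) + 1) → Tree
    answer i j = ifT (encodeBool (does (last {n} i ≟ʷ [ true ]))) (node (encodeℕ 0) (encodeWord (x {n} j)))
      (ifT (encodeBool (does (last {n} j ≟ʷ [ true ]))) (node (encodeℕ 0) (encodeWord (x {n} i)))
        (ifT (encodeBool (does (x {n} i ≟ʷ x {n} j))) (node (encodeℕ 1) (node (encodeWord (y {n} i)) (encodeWord (y {n} j))))
          (node (encodeℕ 1) (node (encodeWord (x {n} i)) (encodeWord (x {n} j))))))

    answer≡ : ∀ i j i≤ j≤ i≢j s →
      answer i j ≡ encodeCollisionSolution p (solve i j i≤ j≤ i≢j s (last {n} i ≟ʷ [ true ]) (last {n} j ≟ʷ [ true ]) (x {n} i ≟ʷ x {n} j))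
    answer≡ i j i≤ j≤ i≢j s with last {n} i ≟ʷ [ true ] | last {n} j ≟ʷ [ true ] | x {n} i ≟ʷ x {n} j
    ... | yes _ | _     | _     = refl
    ... | no _  | yes _ | _     = refl
    ... | no _  | no _  | yes _ = refl
    ... | no _  | no _  | no _  = refl

    collision : BadColoringSolution 2 q (coloring I) → CollisionSolution p I
    collision (repeated i j i≤ j≤ i≢j s) =
      solve i j i≤ j≤ i≢j s (last {n} i ≟ʷ [ true ]) (last {n} j ≟ʷ [ true ]) (x {n} i ≟ʷ x {n} j)
    collision (monochromatic i _ eq) = ⊥-elim (bichromatic C i eq)

  Query : Set
  Query = Σ (CollisionInstance p) λ I → let open CollisionInstance I in Word ((n + n) + 1) × Word ((n + n) + 1)

  query : Query → Tree
  query (I , i , j) = node (encodeInstance (Collision p) I) (node leaf (node (encodeWord i) (encodeWord j)))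

  answerₚ : PolyTime query (λ (I , i , j) → answer I i j)
  answerₚ = ifₚ (equalᵤ lastᵢ trueᵤ) (nodeₚ leafₚ (digits xⱼ))
    (ifₚ (equalᵤ lastⱼ trueᵤ) (nodeₚ leafₚ (digits xᵢ))
      (ifₚ (equalᵤ xᵢ xⱼ) (nodeₚ (constₚ (encodeℕ 1)) (nodeₚ (digits yᵢ) (digits yⱼ)))
        (nodeₚ (constₚ (encodeℕ 1)) (nodeₚ (digits xᵢ) (digits xⱼ)))))
    where
    open Uniform query (CollisionInstance.n ∘ proj₁)
    open UniformWord
    trueᵤ : UniformWord (λ _ → [ true ])
    trueᵤ = record { digits = constₚ (encodeWord [ true ]) }
    iᵤ : UniformWord (λ (I , i , j) → i)
    iᵤ = record { digits = leftₚ (rightₚ (rightₚ idₚ)) }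
    jᵤ : UniformWord (λ (I , i , j) → j)
    jᵤ = record { digits = rightₚ (rightₚ (rightₚ idₚ)) }
    X = reindexCircuit proj₁ (leftₚ idₚ) xPartᵤ
    Y = reindexCircuit proj₁ (leftₚ idₚ) yPartᵤ
    L = reindexCircuit proj₁ (leftₚ idₚ) lastPartᵤ
    xᵢ = evalᵤ X iᵤ
    xⱼ = evalᵤ X jᵤ
    yᵢ = evalᵤ Y iᵤ
    yⱼ = evalᵤ Y jᵤ
    lastᵢ = evalᵤ L iᵤ
    lastⱼ = evalᵤ L jᵤ

  reduction : Reduces (Collision p) (BadColoring 2 q)
  reduction = record
    { f = coloring
    ; g = collision
    ; f-polyTime = nodeₚ (leftₚ idₚ) (nodeₚ (Uniform.UniformCircuit.code edgesᵤ) (Uniform.UniformCircuit.code coloursᵤ))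
    -- No solution is `monochromatic`, so the program for that tag is given on an empty domain.
    ; g-polyTime = branchₚ (leftₚ (rightₚ idₚ)) impossible answerₚ λ where
        (I , repeated i j i≤ j≤ i≢j s) → inj₂ (refl , (I , i , j) , refl , answer≡ I i j i≤ j≤ i≢j s)
        (I , monochromatic i _ eq) → ⊥-elim (bichromatic (CollisionInstance.C I) i eq)
    }
    where
    impossible : PolyTime {⊥} (λ _ → leaf) (λ _ → leaf)
    impossible = idₚ

-- From Bad k-Coloring to k-Turán

∈-map⁻ : ∀ {A B : Set} (f : A → B) {m y} {xs : Vec A m} → y ∈ map f xs → ∃[ x ] (x ∈ xs × y ≡ f x)
∈-map⁻ f {xs = x ∷ xs} (here eq)  = x , here refl , eq
∈-map⁻ f {xs = x ∷ xs} (there y∈) = let (x′ , x′∈ , eq) = ∈-map⁻ f y∈ in x′ , there x′∈ , eq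

firstOr : ∀ {A : Set} {m} → (A → Bool) → A → Vec A m → A
firstOr P z []       = z
firstOr P z (x ∷ xs) = if P x then x else firstOr P z xs

firstOr-holds : ∀ {A : Set} {m} (P : A → Bool) z {x} {xs : Vec A m} → x ∈ xs → P x ≡ true →
  firstOr P z xs ∈ xs × P (firstOr P z xs) ≡ true
firstOr-holds P z {xs = y ∷ xs} x∈ Px with P y in Py
... | true = here refl , Py
firstOr-holds P z {xs = y ∷ xs} (here refl) Px | false with () ← trans (sym Py) Px
firstOr-holds P z {xs = y ∷ xs} (there x∈)  Px | false =
  let (f∈ , Pf) = firstOr-holds P z x∈ Px in there f∈ , Pf

if-app : ∀ {A : Set} (f : A → Tree) b x y → ifT (encodeBool b) (f x) (f y) ≡ f (if b then x else y)
if-app f true  x y = refl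
if-app f false x y = refl

module _ {A : Set} (i : A → Tree) (N : A → ℕ) where
  open Uniform i N
  open UniformWord

  headₚ : ∀ {w : A → ℕ} {m} {xs : ∀ a → Vec (Word (w a)) (suc m)} →
    PolyTime i (λ a → encodeVec encodeWord (xs a)) → UniformWord (λ a → head (xs a))
  headₚ {xs = xs} X = record { digits = congₚ (λ a → leftOf-encodeVec (xs a)) (leftₚ X) }
    where
    leftOf-encodeVec : ∀ {w m} (xs : Vec (Word w) (suc m)) → leftOf (encodeVec encodeWord xs) ≡ encodeWord (head xs)
    leftOf-encodeVec (x ∷ xs) = refl

  tailₚ : ∀ {w : A → ℕ} {m} {xs : ∀ a → Vec (Word (w a)) (suc m)} →
    PolyTime i (λ a → encodeVec encodeWord (xs a)) → PolyTime i (λ a → encodeVec encodeWord (tail (xs a)))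
  tailₚ {xs = xs} X = congₚ (λ a → rightOf-encodeVec (xs a)) (rightₚ X)
    where
    rightOf-encodeVec : ∀ {w m} (xs : Vec (Word w) (suc m)) → rightOf (encodeVec encodeWord xs) ≡ encodeVec encodeWord (tail xs)
    rightOf-encodeVec (x ∷ xs) = refl

  -- The length `m` is the same for all inputs, so the search is unrolled into `m` nested
  -- conditionals and needs no loop.
  firstOrᵤ : ∀ {w : A → ℕ} (P : ∀ a → Word (w a) → Bool) →
    (∀ {x : ∀ a → Word (w a)} → UniformWord x → UniformBool (λ a → P a (x a))) →
    ∀ {z} → UniformWord z → ∀ {m} {xs : ∀ a → Vec (Word (w a)) m} →
    PolyTime i (λ a → encodeVec encodeWord (xs a)) → UniformWord (λ a → firstOr (P a) (z a) (xs a))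
  firstOrᵤ P Pᵤ {z} Z {zero} {xs} X = record { digits = congₚ (λ a → cong encodeWord (sym (firstOr-[] (P a) (z a) (xs a)))) (digits Z) }
    where
    firstOr-[] : ∀ {A : Set} (P : A → Bool) z xs → firstOr P z xs ≡ z
    firstOr-[] P z [] = refl
  firstOrᵤ P Pᵤ {z} Z {suc m} {xs} X = record { digits = congₚ
    (λ a → trans (if-app encodeWord (P a (head (xs a))) (head (xs a)) (firstOr (P a) (z a) (tail (xs a))))
                 (cong encodeWord (firstOr-∷ (P a) (z a) (xs a))))
    (ifₚ (Pᵤ (headₚ X)) (digits (headₚ X)) (digits (firstOrᵤ P Pᵤ Z (tailₚ X)))) }
    where
    firstOr-∷ : ∀ {A : Set} {m} (P : A → Bool) z (xs : Vec A (suc m)) →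
      (if P (head xs) then head xs else firstOr P z (tail xs)) ≡ firstOr P z xs
    firstOr-∷ P z (x ∷ xs) = refl

module _ {k p} {J : Set} (encodeJ : J → Tree) (F : J → TuránInstance k p) where

  private
    W : J → Set
    W I = Word (indexBits k (TuránInstance.n (F I)))

  -- Encoded solutions contain indices but no proofs, so one program per constructor suffices, each
  -- working on bare indices. The tests peel the unary tag: 0 for `loop`, 1 for `repeated`, 2 for
  -- `clique`.
  turánSolutionsₚ : (o : Σ J (TuránSolution k p ∘ F) → Tree) →
    {o₁ : Σ J W → Tree} {o₂ : Σ J (λ I → W I × W I) → Tree} {o₃ : Σ J (λ I → Vec (W I) (suc k choose 2)) → Tree} →
    PolyTime (λ (I , i) → node (encodeJ I) (node (encodeℕ 0) (encodeWord i))) o₁ →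
    PolyTime (λ (I , i , j) → node (encodeJ I) (node (encodeℕ 1) (node (encodeWord i) (encodeWord j)))) o₂ →
    PolyTime (λ (I , is) → node (encodeJ I) (node (encodeℕ 2) (encodeVec encodeWord is))) o₃ →
    (∀ I i i≤ l → o₁ (I , i) ≡ o (I , loop i i≤ l)) →
    (∀ I i j i≤ j≤ i≢j s → o₂ (I , i , j) ≡ o (I , repeated i j i≤ j≤ i≢j s)) →
    (∀ I is is≤ u c → o₃ (I , is) ≡ o (I , clique is is≤ u c)) →
    PolyTime (λ (I , s) → node (encodeJ I) (encodeTuránSolution k p s)) o
  turánSolutionsₚ o {o₁} {o₂} {o₃} P₁ P₂ P₃ eq₁ eq₂ eq₃ =
    branchₚ {B₁ = Σ J λ I → (W I × W I) ⊎ Vec (W I) (suc k choose 2)} {i₁ = input} {o₁ = output}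
      (leftₚ (rightₚ idₚ))
      (branchₚ (rightₚ (leftₚ (rightₚ idₚ))) P₃ P₂ λ where
        (I , inj₁ (i , j)) → inj₂ (refl , (I , i , j) , refl , refl)
        (I , inj₂ is)      → inj₁ (_ , _ , refl , (I , is) , refl , refl))
      P₁ λ where
        (I , loop i i≤ l) → inj₂ (refl , (I , i) , refl , eq₁ I i i≤ l)
        (I , repeated i j i≤ j≤ i≢j s) → inj₁ (_ , _ , refl , (I , inj₁ (i , j)) , refl , eq₂ I i j i≤ j≤ i≢j s)
        (I , clique is is≤ u c) → inj₁ (_ , _ , refl , (I , inj₂ is) , refl , eq₃ I is is≤ u c)
    where
    input output : (Σ J λ I → (W I × W I) ⊎ Vec (W I) (suc k choose 2)) → Tree
    input (I , inj₁ (i , j)) = node (encodeJ I) (node (encodeℕ 1) (node (encodeWord i) (encodeWord j)))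
    input (I , inj₂ is)      = node (encodeJ I) (node (encodeℕ 2) (encodeVec encodeWord is))
    output (I , inj₁ (i , j)) = o₂ (I , i , j)
    output (I , inj₂ is)      = o₃ (I , is)

module ColoringToTurán (k′ : ℕ) (p : Poly) where

  k : ℕ
  k = suc k′

  turán : BadColoringInstance k p → TuránInstance k p
  turán I = record { n = n ; E = E ; E-small = E-small ; E-inRange = E-inRange }
    where open BadColoringInstance I

  endpoint₁ endpoint₂ : ∀ {n} → EdgeCircuit k n → Circuit (vertexBits k n) (colourBits k) → Circuit (indexBits k n) (colourBits k)
  endpoint₁ {n} E C = E ⨾ lowWires (vertexBits k n) (vertexBits k n) ⨾ C
  endpoint₂ {n} E C = E ⨾ highWires (vertexBits k n) (vertexBits k n) ⨾ C

  module _ (I : BadColoringInstance k p) where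
    open BadColoringInstance I

    eval-endpoint₁ : ∀ i → eval (endpoint₁ {n} E C) i ≡ eval C (proj₁ (edge k n E i))
    eval-endpoint₁ i = trans (eval-⨾ E _ i) (trans (eval-⨾ (lowWires _ _) C (eval E i))
      (cong (eval C) (eval-low≡take (vertexBits k n) (eval E i))))

    eval-endpoint₂ : ∀ i → eval (endpoint₂ {n} E C) i ≡ eval C (proj₂ (edge k n E i))
    eval-endpoint₂ i = trans (eval-⨾ E _ i) (trans (eval-⨾ (highWires _ _) C (eval E i))
      (cong (eval C) (eval-high≡drop (vertexBits k n) (eval E i))))

    isMonochromatic : Word (indexBits k n) → Bool
    isMonochromatic i = does (eval (endpoint₁ {n} E C) i ≟ʷ eval (endpoint₂ {n} E C) i)

    isMonochromatic⁻ : ∀ i → isMonochromatic i ≡ true → eval C (proj₁ (edge k n E i)) ≡ eval C (proj₂ (edge k n E i))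
    isMonochromatic⁻ i eq with eval (endpoint₁ {n} E C) i ≟ʷ eval (endpoint₂ {n} E C) i
    ... | yes same = trans (sym (eval-endpoint₁ i)) (trans same (eval-endpoint₂ i))

    isMonochromatic⁺ : ∀ i → eval C (proj₁ (edge k n E i)) ≡ eval C (proj₂ (edge k n E i)) → isMonochromatic i ≡ true
    isMonochromatic⁺ i eq with eval (endpoint₁ {n} E C) i ≟ʷ eval (endpoint₂ {n} E C) i
    ... | yes _   = refl
    ... | no diff = ⊥-elim (diff (trans (eval-endpoint₁ i) (trans eq (sym (eval-endpoint₂ i)))))

    -- Colours start at 1, hence `∸ 1`. The minimum with `k′` changes nothing on vertices; it makes
    -- the map total, since `FormClique` does not itself say that its words are vertices. The range
    -- is needed only at the ends of the edge found by the pigeonhole principle, where `E-inRange`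
    -- provides it.
    colourOf : Word (vertexBits k n) → Fin k
    colourOf v = fromℕ< {(value (eval C v) ∸ 1) ⊓ k′} (s≤s (m⊓n≤n (value (eval C v) ∸ 1) k′))

    colourOf-injective : ∀ u v → IsVertex k n u → IsVertex k n v → colourOf u ≡ colourOf v → eval C u ≡ eval C v
    colourOf-injective u v u< v< eq = value-injective _ _ (∸-cancelʳ-≡ (proj₁ (C-inRange u u<)) (proj₁ (C-inRange v v<))
      (trans (sym (toℕ-colourOf u u<)) (trans (cong toℕ eq) (toℕ-colourOf v v<))))
      where
      toℕ-colourOf : ∀ v → IsVertex k n v → toℕ (colourOf v) ≡ value (eval C v) ∸ 1
      toℕ-colourOf v v< = trans (toℕ-fromℕ< _) (m≤n⇒m⊓n≡m (∸-monoˡ-≤ 1 (proj₂ (C-inRange v v<))))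

    clique⇒monochromatic : ∀ {m} (is : Vec (Word (indexBits k n)) m) → All (IsIndex k n) is →
      FormClique (suc k) (map (edge k n E) is) →
      ∃[ i ] (i ∈ is × eval C (proj₁ (edge k n E i)) ≡ eval C (proj₂ (edge k n E i)))
    clique⇒monochromatic is is≤ (vs , unique , _ , covered)
      with a , b , a<b , eq ← pigeonhole (n<1+n k) (colourOf ∘ lookup vs)
      with e , e∈ , same ← covered (∈-lookup a vs) (∈-lookup b vs) (λ eq → <ᶠ⇒≢ a<b (lookup-injective unique a b eq))
      with i , i∈ , refl ← ∈-map⁻ (edge k n E) e∈
      = i , i∈ , colours same
      where
      ends = E-inRange i (All-lookup is≤ i∈)
      colours : SamePair (edge k n E i) (lookup vs a , lookup vs b) →
        eval C (proj₁ (edge k n E i)) ≡ eval C (proj₂ (edge k n E i))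
      colours (inj₁ (p , q)) = colourOf-injective _ _ (proj₁ ends) (proj₂ ends)
        (trans (cong colourOf p) (trans eq (cong colourOf (sym q))))
      colours (inj₂ (p , q)) = colourOf-injective _ _ (proj₁ ends) (proj₂ ends)
        (trans (cong colourOf p) (trans (sym eq) (cong colourOf (sym q))))

    -- The pigeonhole argument only guarantees a hit. It is found by testing the listed edges one by
    -- one, and the default word is then never returned.
    monochromaticIndex : ∀ {m} → Vec (Word (indexBits k n)) m → Word (indexBits k n)
    monochromaticIndex = firstOr isMonochromatic (replicate (indexBits k n) false)

    badColoring : TuránSolution k p (turán I) → BadColoringSolution k p I
    badColoring (loop i i≤ eq) = monochromatic i i≤ (cong (eval C) eq)
    badColoring (repeated i j i≤ j≤ i≢j s) = repeated i j i≤ j≤ i≢j s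
    badColoring (clique is is≤ _ c) = monochromatic (monochromaticIndex is)
      (All-lookup is≤ (proj₁ found)) (isMonochromatic⁻ _ (proj₂ found))
      where
      mono = clique⇒monochromatic is is≤ c
      found = firstOr-holds isMonochromatic (replicate (indexBits k n) false) (proj₁ (proj₂ mono))
        (isMonochromatic⁺ (proj₁ mono) (proj₂ (proj₂ mono)))

  open BadColoringInstance

  module _ where
    open Uniform (encodeInstance (BadColoring k p)) n

    numberᵤ : UniformNumber n
    numberᵤ = record { unary = leftₚ idₚ ; degree = var ; below = λ _ → ≤-refl }

    vertexBitsᵤ : UniformNumber (λ I → vertexBits k (n I))
    vertexBitsᵤ = numberᵤ +ᵤ constNumber _

    indexBitsᵤ : UniformNumber (λ I → indexBits k (n I))
    indexBitsᵤ = (numberᵤ +ᵤ numberᵤ) +ᵤ constNumber _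

    Eᵤ : UniformCircuit E
    Eᵤ = record { code = leftₚ (rightₚ idₚ) ; degree = p ; small = E-small }

    Cᵤ : UniformCircuit C
    Cᵤ = record { code = rightₚ (rightₚ idₚ) ; degree = p ; small = C-small }

    endpoint₁ᵤ : UniformCircuit (λ I → endpoint₁ {n I} (E I) (C I))
    endpoint₁ᵤ = seqᵤ (vertexBitsᵤ +ᵤ vertexBitsᵤ) Eᵤ (seqᵤ vertexBitsᵤ (lowᵤ _ vertexBitsᵤ) Cᵤ)

    endpoint₂ᵤ : UniformCircuit (λ I → endpoint₂ {n I} (E I) (C I))
    endpoint₂ᵤ = seqᵤ (vertexBitsᵤ +ᵤ vertexBitsᵤ) Eᵤ (seqᵤ vertexBitsᵤ (highᵤ vertexBitsᵤ vertexBitsᵤ) Cᵤ)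

  monochromaticIndexₚ : ∀ {m} → PolyTime {Σ (BadColoringInstance k p) λ I → Vec (Word (indexBits k (n I))) m}
    (λ (I , is) → node (encodeInstance (BadColoring k p) I) (node (encodeℕ 2) (encodeVec encodeWord is)))
    (λ (I , is) → encodeWord (monochromaticIndex I is))
  monochromaticIndexₚ {m} = digits (firstOrᵤ input (n ∘ proj₁) (isMonochromatic ∘ proj₁)
    (λ X → equalᵤ (evalᵤ (reindexCircuit proj₁ (leftₚ idₚ) endpoint₁ᵤ) X)
                  (evalᵤ (reindexCircuit proj₁ (leftₚ idₚ) endpoint₂ᵤ) X))
    (zerosᵤ (reindexNumber proj₁ (leftₚ idₚ) indexBitsᵤ)) (rightₚ (rightₚ idₚ)))
    where
    input : (Σ (BadColoringInstance k p) λ I → Vec (Word (indexBits k (n I))) m) → Tree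
    input (I , is) = node (encodeInstance (BadColoring k p) I) (node (encodeℕ 2) (encodeVec encodeWord is))
    open Uniform input (n ∘ proj₁)
    open UniformWord

  reduction : Reduces (BadColoring k p) (Turán k p)
  reduction = record
    { f = turán
    ; g = badColoring
    ; f-polyTime = nodeₚ (leftₚ idₚ) (leftₚ (rightₚ idₚ))
    ; g-polyTime = turánSolutionsₚ (encodeInstance (BadColoring k p)) turán
        (λ (I , s) → encodeBadColoringSolution k p (badColoring I s))
        (nodeₚ (constₚ (encodeℕ 1)) (rightₚ (rightₚ idₚ)))
        (nodeₚ leafₚ (rightₚ (rightₚ idₚ)))
        (nodeₚ (constₚ (encodeℕ 1)) monochromaticIndexₚ)
        (λ _ _ _ _ → refl) (λ _ _ _ _ _ _ _ → refl) (λ _ _ _ _ _ → refl)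
    }

-- From k to k + 1: the extended graph

<ᵇ-true : ∀ {m n} → m < n → (m <ᵇ n) ≡ true
<ᵇ-true {m} {n} m<n with m <ᵇ n | <⇒<ᵇ m<n
... | true | _ = refl

<ᵇ-false : ∀ {m n} → n ≤ m → (m <ᵇ n) ≡ false
<ᵇ-false {m} {n} n≤m with m <ᵇ n in eq
... | false = refl
... | true  = ⊥-elim (<⇒≱ (<ᵇ⇒< m n (subst T (sym eq) _)) n≤m)

SamePair-sym : ∀ {A : Set} {e f : A × A} → SamePair e f → SamePair f e
SamePair-sym (inj₁ (p , q)) = inj₁ (sym p , sym q)
SamePair-sym (inj₂ (p , q)) = inj₂ (sym q , sym p)

eval-low⨾ : ∀ {m n l} (C : Circuit m l) x → eval (lowWires m n ⨾ C) x ≡ eval C (take m x)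
eval-low⨾ C x = trans (eval-⨾ (lowWires _ _) C x) (cong (eval C) (eval-low≡take _ x))

eval-high⨾ : ∀ {m n l} (C : Circuit n l) x → eval (highWires m n ⨾ C) x ≡ eval C (drop m x)
eval-high⨾ C x = trans (eval-⨾ (highWires _ _) C x) (cong (eval C) (eval-high≡drop _ x))

eval-high⨾table : ∀ {m n l} (F : Word n → Word l) (x : Word (m + n)) → eval (highWires m n ⨾ table F) x ≡ F (drop m x)
eval-high⨾table F x = trans (eval-high⨾ (table F) x) (eval-table F _)

-- The graph on k 2ⁿ vertices is extended by 2ⁿ further vertices, whose block has number k,
-- joined to all the old ones.  An index whose block h is less than k stands for the new edge
-- from x in block h to y in block k; the other indices are those of E, shifted by k blocks.
module Extension (k : ℕ) where

  -- Widths of the block numbers of vertices (`vb`) and of indices (`ib`); primes refer to `suc k`.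
  vb vb′ ib ib′ : ℕ
  vb  = ⌈log₂ k ⌉
  vb′ = ⌈log₂ suc k ⌉
  ib  = ⌈log₂ suc (k choose 2) ⌉
  ib′ = ⌈log₂ suc (suc k choose 2) ⌉

  blockBit : Word ib′ → Word 1
  blockBit h = [ value h <ᵇ k ]

  shiftBlock : Word ib′ → Word ib
  shiftBlock h = toWord ib (value h ∸ k)

  widen : ∀ {w} → Word w → Word vb′
  widen h = toWord vb′ (value h)

  narrow : Word vb′ → Word vb
  narrow h = toWord vb (value h)

  module _ (n : ℕ) where
    isNew : Circuit ((n + n) + ib′) 1
    isNew = highWires (n + n) ib′ ⨾ table blockBit

    strip : Circuit ((n + n) + ib′) ((n + n) + ib)
    strip = lowWires (n + n) ib′ △ (highWires (n + n) ib′ ⨾ table shiftBlock)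

    embed : Circuit (n + vb) (n + vb′)
    embed = lowWires n vb △ (highWires n vb ⨾ table widen)

    oldEdge : EdgeCircuit k n → Circuit ((n + n) + ib′) ((n + vb′) + (n + vb′))
    oldEdge E = strip ⨾ E ⨾ ((lowWires (n + vb) (n + vb) ⨾ embed) △ (highWires (n + vb) (n + vb) ⨾ embed))

    newEdge : Circuit ((n + n) + ib′) ((n + vb′) + (n + vb′))
    newEdge =
      ((lowWires (n + n) ib′ ⨾ lowWires n n) △ (highWires (n + n) ib′ ⨾ table widen)) △
      ((lowWires (n + n) ib′ ⨾ highWires n n) △ (highWires (n + n) ib′ ⨾ table (λ _ → toWord vb′ k)))

    edges : EdgeCircuit k n → EdgeCircuit (suc k) n
    edges E = mux isNew newEdge (oldEdge E)

  module _ {n : ℕ} where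
    x y : Word ((n + n) + ib′) → Word n
    x i = take n (take (n + n) i)
    y i = drop n (take (n + n) i)

    block : Word ((n + n) + ib′) → Word ib′
    block i = drop (n + n) i

    New Old : Word ((n + n) + ib′) → Set
    New i = value (block i) < k
    Old i = k ≤ value (block i)

    stripped : Word ((n + n) + ib′) → Word ((n + n) + ib)
    stripped i = take (n + n) i ++ shiftBlock (block i)

    embedded : Word (n + vb) → Word (n + vb′)
    embedded v = take n v ++ widen (drop n v)

    eval-isNew : ∀ i → eval (isNew n) i ≡ [ value (block i) <ᵇ k ]
    eval-isNew = eval-high⨾table blockBit

    eval-strip : ∀ i → eval (strip n) i ≡ stripped i
    eval-strip i = trans (eval-△ (lowWires (n + n) ib′) _ i)
      (cong₂ _++_ (eval-low≡take (n + n) i) (eval-high⨾table shiftBlock i))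

    eval-embed : ∀ v → eval (embed n) v ≡ embedded v
    eval-embed v = trans (eval-△ (lowWires n vb) _ v)
      (cong₂ _++_ (eval-low≡take n v) (eval-high⨾table widen v))

    eval-oldEdge : ∀ E i → eval (oldEdge n E) i ≡
      embedded (proj₁ (edge k n E (stripped i))) ++ embedded (proj₂ (edge k n E (stripped i)))
    eval-oldEdge E i = begin
      eval (oldEdge n E) i
        ≡⟨ eval-⨾ (strip n) _ i ⟩
      eval (E ⨾ rest) (eval (strip n) i)
        ≡⟨ eval-⨾ E rest (eval (strip n) i) ⟩
      eval rest (eval E (eval (strip n) i))
        ≡⟨ cong (eval rest ∘ eval E) (eval-strip i) ⟩
      eval rest (eval E (stripped i))
        ≡⟨ eval-△ (lowWires (n + vb) (n + vb) ⨾ embed n) _ (eval E (stripped i)) ⟩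
      eval (lowWires (n + vb) (n + vb) ⨾ embed n) (eval E (stripped i)) ++
      eval (highWires (n + vb) (n + vb) ⨾ embed n) (eval E (stripped i))
        ≡⟨ cong₂ _++_ (trans (eval-low⨾ (embed n) (eval E (stripped i))) (eval-embed _))
                      (trans (eval-high⨾ (embed n) (eval E (stripped i))) (eval-embed _)) ⟩
      embedded (proj₁ (edge k n E (stripped i))) ++ embedded (proj₂ (edge k n E (stripped i))) ∎
      where
      open ≡-Reasoning
      rest = (lowWires (n + vb) (n + vb) ⨾ embed n) △ (highWires (n + vb) (n + vb) ⨾ embed n)

    eval-newEdge : ∀ i → eval (newEdge n) i ≡ (x i ++ widen (block i)) ++ (y i ++ toWord vb′ k)
    eval-newEdge i = trans (eval-△ (X △ H) (Y △ K) i) (cong₂ _++_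
      (trans (eval-△ X H i) (cong₂ _++_
        (trans (eval-low⨾ (lowWires n n) i) (eval-low≡take n _)) (eval-high⨾table widen i)))
      (trans (eval-△ Y K i) (cong₂ _++_
        (trans (eval-low⨾ (highWires n n) i) (eval-high≡drop n _)) (eval-high⨾table (λ _ → toWord vb′ k) i))))
      where
      X = lowWires (n + n) ib′ ⨾ lowWires n n
      H = highWires (n + n) ib′ ⨾ table widen
      Y = lowWires (n + n) ib′ ⨾ highWires n n
      K = highWires (n + n) ib′ ⨾ table (λ _ → toWord vb′ k)

    edge-pair : (E : EdgeCircuit (suc k) n) → ∀ i {u v} → eval E i ≡ u ++ v → edge (suc k) n E i ≡ (u , v)
    edge-pair E i {u} {v} eq = cong₂ _,_ (trans (cong (take (n + vb′)) eq) (take-++ u v))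
                                         (trans (cong (drop (n + vb′)) eq) (drop-++ u v))

    edge-new : ∀ E i → New i → edge (suc k) n (edges n E) i ≡ (x i ++ widen (block i) , y i ++ toWord vb′ k)
    edge-new E i new = edge-pair (edges n E) i (trans
      (eval-mux (isNew n) (newEdge n) (oldEdge n E) i (trans (eval-isNew i) (cong [_] (<ᵇ-true new))))
      (eval-newEdge i))

    edge-old : ∀ E i → Old i → edge (suc k) n (edges n E) i ≡
      (embedded (proj₁ (edge k n E (stripped i))) , embedded (proj₂ (edge k n E (stripped i))))
    edge-old E i old = edge-pair (edges n E) i (trans
      (eval-mux (isNew n) (newEdge n) (oldEdge n E) i (trans (eval-isNew i) (cong [_] (<ᵇ-false old))))
      (eval-oldEdge E i))

    OldVertex NewVertex : Word (n + vb′) → Set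
    OldVertex v = value (drop n v) < k
    NewVertex v = value (drop n v) ≡ k

    old≢new : ∀ {u v} → OldVertex u → NewVertex v → u ≢ v
    old≢new u< v≡ refl = <-irrefl v≡ u<

    k<2^vb′ : k < 2 ^ vb′
    k<2^vb′ = k≤2^⌈log₂k⌉ (suc k)

    value-widen : ∀ {w} (h : Word w) → value h < k → value (widen h) ≡ value h
    value-widen h h< = value-toWord vb′ (value h) (<-trans h< k<2^vb′)

    widen-injective : ∀ {w} (g h : Word w) → value g < k → value h < k → widen g ≡ widen h → g ≡ h
    widen-injective g h g< h< eq = value-injective g h
      (trans (sym (value-widen g g<)) (trans (cong value eq) (value-widen h h<)))

    embedded-old : ∀ v → IsVertex k n v → OldVertex (embedded v)
    embedded-old v v< = subst (_< k) (sym (trans (cong value (drop-++ (take n v) (widen (drop n v))))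
      (value-widen (drop n v) v′<))) v′<
      where
      v′< : value (drop n v) < k
      v′< = vertex-high {n} {vb} v v<

    embedded-injective : ∀ u v → IsVertex k n u → IsVertex k n v → embedded u ≡ embedded v → u ≡ v
    embedded-injective u v u< v< eq = take-drop-injective n u v
      (++-injectiveˡ (take n u) (take n v) eq)
      (widen-injective (drop n u) (drop n v) (vertex-high {n} {vb} u u<) (vertex-high {n} {vb} v v<) (++-injectiveʳ (take n u) (take n v) eq))

    -- Inverse to `embedded` between the vertices for `k` and the old vertices; on new vertices its
    -- value has no meaning.
    restricted : Word (n + vb′) → Word (n + vb)
    restricted v = take n v ++ narrow (drop n v)

    value-narrow : ∀ h → value h < k → value (narrow h) ≡ value h
    value-narrow h h< = value-toWord vb (value h) (<-≤-trans h< (k≤2^⌈log₂k⌉ k))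

    restricted-embedded : ∀ v → IsVertex k n v → restricted (embedded v) ≡ v
    restricted-embedded v v< = begin
      take n (embedded v) ++ narrow (drop n (embedded v))
        ≡⟨ cong₂ (λ lo h → lo ++ narrow h) (take-++ (take n v) (widen (drop n v))) (drop-++ (take n v) (widen (drop n v))) ⟩
      take n v ++ narrow (widen (drop n v))
        ≡⟨ cong (take n v ++_) (value-injective _ _ (trans (value-narrow (widen (drop n v)) (subst (_< k) (sym widen≡) v′<)) widen≡)) ⟩
      take n v ++ drop n v
        ≡⟨ take++drop≡id n v ⟩
      v ∎
      where
      open ≡-Reasoning
      v′< : value (drop n v) < k
      v′< = vertex-high {n} {vb} v v<
      widen≡ = value-widen (drop n v) v′<

    restricted-vertex : ∀ v → OldVertex v → IsVertex k n (restricted v)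
    restricted-vertex v v< = high-vertex (take n v) (narrow (drop n v)) (subst (_< k) (sym (value-narrow (drop n v) v<)) v<)

    embedded-restricted : ∀ v → OldVertex v → embedded (restricted v) ≡ v
    embedded-restricted v v< = begin
      take n (restricted v) ++ widen (drop n (restricted v))
        ≡⟨ cong₂ (λ lo h → lo ++ widen h) (take-++ (take n v) (narrow (drop n v))) (drop-++ (take n v) (narrow (drop n v))) ⟩
      take n v ++ widen (narrow (drop n v))
        ≡⟨ cong (take n v ++_) (value-injective _ _ (trans (value-widen (narrow (drop n v)) (subst (_< k) (sym narrow≡) v<)) narrow≡)) ⟩
      take n v ++ drop n v
        ≡⟨ take++drop≡id n v ⟩
      v ∎
      where
      open ≡-Reasoning
      narrow≡ = value-narrow (drop n v) v<

    new-ends : ∀ E i → New i → OldVertex (proj₁ (edge (suc k) n (edges n E) i)) × NewVertex (proj₂ (edge (suc k) n (edges n E) i))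
    new-ends E i new =
      subst (OldVertex ∘ proj₁) (sym (edge-new E i new))
        (subst (_< k) (sym (trans (cong value (drop-++ (x i) (widen (block i)))) (value-widen (block i) new))) new) ,
      subst (NewVertex ∘ proj₂) (sym (edge-new E i new))
        (trans (cong value (drop-++ (y i) (toWord vb′ k))) (value-toWord vb′ k k<2^vb′))

    private
      -- The new edges take up `k` blocks of 2²ⁿ indices. Removing them from the range for `suc k`
      -- leaves exactly the range for `k`, by `choose2`. The bound is stated with `∸ k` because it
      -- is what shows, in `value-shiftBlock`, that `shiftBlock` does not overflow.
      shifted-bound : ∀ i → IsIndex (suc k) n i → Old i →
        value (take (n + n) i) + 2 ^ (n + n) * (value (block i) ∸ k) ≤ (k choose 2) * 2 ^ (n + n)
      shifted-bound i i≤ old = +-cancelˡ-≤ (k * 2 ^ (n + n)) _ _ (begin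
        k * P + (lo + P * (vh ∸ k))   ≡⟨ solve 4 (λ k P lo d → k :* P :+ (lo :+ P :* d) := lo :+ P :* (k :+ d)) refl k P lo (vh ∸ k) ⟩
        lo + P * (k + (vh ∸ k))       ≡⟨ cong (λ z → lo + P * z) (m+[n∸m]≡n old) ⟩
        lo + P * vh                   ≡⟨ sym (value-split (n + n) i) ⟩
        value i                       ≤⟨ i≤ ⟩
        (suc k choose 2) * 2 ^ (2 * n)  ≡⟨ cong₂ _*_ (choose2 k) (cong (λ m → 2 ^ (n + m)) (+-identityʳ n)) ⟩
        (k + (k choose 2)) * P        ≡⟨ *-distribʳ-+ P k (k choose 2) ⟩
        k * P + (k choose 2) * P      ∎)
        where
        open ≤-Reasoning
        open +-*-Solver
        P  = 2 ^ (n + n)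
        lo = value (take (n + n) i)
        vh = value (block i)

      value-shiftBlock : ∀ i → IsIndex (suc k) n i → Old i → value (shiftBlock (block i)) ≡ value (block i) ∸ k
      value-shiftBlock i i≤ old = value-toWord ib (value (block i) ∸ k)
        -- The shifted block number is at most `k choose 2`, a value taken only at the very last
        -- index; this is why `ib` has room for `suc (k choose 2)` numbers.
        (≤-trans (s≤s (*-cancelʳ-≤ _ _ (2 ^ (n + n)) {{m^n≢0 2 (n + n)}} (begin
          (value (block i) ∸ k) * 2 ^ (n + n)  ≡⟨ *-comm (value (block i) ∸ k) (2 ^ (n + n)) ⟩
          2 ^ (n + n) * (value (block i) ∸ k)  ≤⟨ m≤n+m _ (value (take (n + n) i)) ⟩
          _                                    ≤⟨ shifted-bound i i≤ old ⟩
          (k choose 2) * 2 ^ (n + n)           ∎)))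
          (k≤2^⌈log₂k⌉ (suc (k choose 2))))
        where open ≤-Reasoning

    stripped-index : ∀ i → IsIndex (suc k) n i → Old i → IsIndex k n (stripped i)
    stripped-index i i≤ old = begin
      value (stripped i)
        ≡⟨ value-++ (take (n + n) i) (shiftBlock (block i)) ⟩
      value (take (n + n) i) + 2 ^ (n + n) * value (shiftBlock (block i))
        ≡⟨ cong (λ z → value (take (n + n) i) + 2 ^ (n + n) * z) (value-shiftBlock i i≤ old) ⟩
      value (take (n + n) i) + 2 ^ (n + n) * (value (block i) ∸ k)
        ≤⟨ shifted-bound i i≤ old ⟩
      (k choose 2) * 2 ^ (n + n)
        ≡⟨ cong (λ m → (k choose 2) * 2 ^ (n + m)) (sym (+-identityʳ n)) ⟩
      (k choose 2) * 2 ^ (2 * n) ∎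
      where open ≤-Reasoning

    stripped-injective : ∀ i j → IsIndex (suc k) n i → IsIndex (suc k) n j → Old i → Old j →
      stripped i ≡ stripped j → i ≡ j
    stripped-injective i j i≤ j≤ iold jold eq = take-drop-injective (n + n) i j
      (++-injectiveˡ (take (n + n) i) (take (n + n) j) eq)
      (value-injective (block i) (block j) (∸-cancelʳ-≡ iold jold
        (trans (sym (value-shiftBlock i i≤ iold))
          (trans (cong value (++-injectiveʳ (take (n + n) i) (take (n + n) j) eq)) (value-shiftBlock j j≤ jold)))))

    module _ (E : EdgeCircuit k n) (inRange : EdgesInRange k n E) where

      private
        e′ : Word ((n + n) + ib′) → Word (n + vb′) × Word (n + vb′)
        e′ = edge (suc k) n (edges n E)

      old-ends : ∀ i → IsIndex (suc k) n i → Old i → OldVertex (proj₁ (e′ i)) × OldVertex (proj₂ (e′ i))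
      old-ends i i≤ old =
        subst (OldVertex ∘ proj₁) (sym (edge-old E i old)) (embedded-old _ (proj₁ ends)) ,
        subst (OldVertex ∘ proj₂) (sym (edge-old E i old)) (embedded-old _ (proj₂ ends))
        where ends = inRange (stripped i) (stripped-index i i≤ old)

      proj₁-old : ∀ i → IsIndex (suc k) n i → OldVertex (proj₁ (e′ i))
      proj₁-old i i≤ with value (block i) <? k
      ... | yes new = proj₁ (new-ends E i new)
      ... | no ¬new = proj₁ (old-ends i i≤ (≮⇒≥ ¬new))

      edges-inRange : EdgesInRange (suc k) n (edges n E)
      edges-inRange i i≤ = isVertex (m<n⇒m<1+n (proj₁-old i i≤)) , isVertex (proj₂< (value (block i) <? k))
        where
        isVertex : ∀ {v : Word (n + vb′)} → value (drop n v) < suc k → IsVertex (suc k) n v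
        isVertex {v} v< = subst (IsVertex (suc k) n) (take++drop≡id n v) (high-vertex (take n v) (drop n v) v<)
        proj₂< : Dec (New i) → value (drop n (proj₂ (e′ i))) < suc k
        proj₂< (yes new) = s≤s (≤-reflexive (proj₂ (new-ends E i new)))
        proj₂< (no ¬new) = m<n⇒m<1+n (proj₂ (old-ends i i≤ (≮⇒≥ ¬new)))

      new-incident : ∀ i → IsIndex (suc k) n i → ∀ {u v} → SamePair (e′ i) (u , v) → NewVertex v → New i
      new-incident i i≤ s v-new with value (block i) <? k
      ... | yes new = new
      new-incident i i≤ (inj₁ (_ , q)) v-new | no ¬new = ⊥-elim (old≢new (proj₂ (old-ends i i≤ (≮⇒≥ ¬new))) v-new q)
      new-incident i i≤ (inj₂ (p , _)) v-new | no ¬new = ⊥-elim (old≢new (proj₁ (old-ends i i≤ (≮⇒≥ ¬new))) v-new p)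

      SamePair-embedded : ∀ i → IsIndex (suc k) n i → Old i → ∀ {u v} → IsVertex k n u → IsVertex k n v →
        SamePair (e′ i) (embedded u , embedded v) → SamePair (edge k n E (stripped i)) (u , v)
      SamePair-embedded i i≤ old u< v< s with subst (λ e → SamePair e _) (edge-old E i old) s
      ... | inj₁ (p , q) = inj₁ (embedded-injective _ _ (proj₁ ends) u< p , embedded-injective _ _ (proj₂ ends) v< q)
        where ends = inRange (stripped i) (stripped-index i i≤ old)
      ... | inj₂ (p , q) = inj₂ (embedded-injective _ _ (proj₁ ends) v< p , embedded-injective _ _ (proj₂ ends) u< q)
        where ends = inRange (stripped i) (stripped-index i i≤ old)

      -- The first end determines `x` and the block, the second determines `y`. The crossed case
      -- would identify an old vertex with a new one.
      new-edge-injective : ∀ i j → New i → New j → SamePair (e′ i) (e′ j) → i ≡ j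
      new-edge-injective i j inew jnew (inj₂ (p , _)) =
        ⊥-elim (old≢new (proj₁ (new-ends E i inew)) (proj₂ (new-ends E j jnew)) p)
      new-edge-injective i j inew jnew (inj₁ (p , q)) =
        take-drop-injective (n + n) i j
          (take-drop-injective n (take (n + n) i) (take (n + n) j)
            (++-injectiveˡ (x i) (x j) p′) (++-injectiveˡ (y i) (y j) q′))
          (widen-injective (block i) (block j) inew jnew (++-injectiveʳ (x i) (x j) p′))
        where
        p′ : x i ++ widen (block i) ≡ x j ++ widen (block j)
        p′ = trans (sym (cong proj₁ (edge-new E i inew))) (trans p (cong proj₁ (edge-new E j jnew)))
        q′ : y i ++ toWord vb′ k ≡ y j ++ toWord vb′ k
        q′ = trans (sym (cong proj₂ (edge-new E i inew))) (trans q (cong proj₂ (edge-new E j jnew)))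

      -- Distinct new indices give distinct edges, and an old edge has no new end and so equals none
      -- of them. A repetition must therefore come from `E`.
      repeated-old : ∀ i j → IsIndex (suc k) n i → IsIndex (suc k) n j → i ≢ j → SamePair (e′ i) (e′ j) →
        Old i × Old j × stripped i ≢ stripped j × SamePair (edge k n E (stripped i)) (edge k n E (stripped j))
      repeated-old i j i≤ j≤ i≢j s = cases (value (block i) <? k) (value (block j) <? k)
        where
        cases : Dec (New i) → Dec (New j) → Old i × Old j × stripped i ≢ stripped j × SamePair (edge k n E (stripped i)) (edge k n E (stripped j))
        cases (yes inew) (yes jnew) = ⊥-elim (i≢j (new-edge-injective i j inew jnew s))
        cases (yes inew) (no ¬jnew) = ⊥-elim (¬jnew (new-incident j j≤ (SamePair-sym s) (proj₂ (new-ends E i inew))))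
        cases (no ¬inew) (yes jnew) = ⊥-elim (¬inew (new-incident i i≤ s (proj₂ (new-ends E j jnew))))
        cases (no ¬inew) (no ¬jnew) = iold , jold , i≢j ∘ stripped-injective i j i≤ j≤ iold jold ,
          SamePair-embedded i i≤ iold (proj₁ ends) (proj₂ ends) (subst (SamePair (e′ i)) (edge-old E j jold) s)
          where
          iold = ≮⇒≥ ¬inew
          jold = ≮⇒≥ ¬jnew
          ends = inRange (stripped j) (stripped-index j j≤ jold)

  module _ {A : Set} {i : A → Tree} {N n : A → ℕ} (Nn : Uniform.UniformNumber i N n) where
    open Uniform i N

    private
      c : ∀ m → UniformNumber (λ _ → m)
      c = constNumber

      low²ᵤ : UniformCircuit (λ a → lowWires (n a + n a) ib′)
      low²ᵤ = lowᵤ _ (Nn +ᵤ Nn)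

      blockᵤ : ∀ {w} (F : Word ib′ → Word w) → UniformCircuit (λ a → highWires (n a + n a) ib′ ⨾ table F)
      blockᵤ F = seqᵤ (c ib′) (highᵤ (Nn +ᵤ Nn) (c ib′)) (constCircuit (table F))

      bits : UniformNumber (λ a → (n a + n a) + ib′)
      bits = (Nn +ᵤ Nn) +ᵤ c ib′

    indexBitsᵤ : UniformNumber (λ a → indexBits k (n a))
    indexBitsᵤ = (Nn +ᵤ Nn) +ᵤ c ib

    vertexBitsᵤ : UniformNumber (λ a → vertexBits k (n a))
    vertexBitsᵤ = Nn +ᵤ c vb

    vertexBitsᵤ′ : UniformNumber (λ a → vertexBits (suc k) (n a))
    vertexBitsᵤ′ = Nn +ᵤ c vb′

    isNewᵤ : UniformCircuit (isNew ∘ n)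
    isNewᵤ = blockᵤ blockBit

    stripᵤ : UniformCircuit (strip ∘ n)
    stripᵤ = pairᵤ bits low²ᵤ (blockᵤ shiftBlock)

    embedᵤ : UniformCircuit (embed ∘ n)
    embedᵤ = pairᵤ vertexBitsᵤ (lowᵤ _ Nn) (seqᵤ (c vb) (highᵤ Nn (c vb)) (constCircuit (table widen)))

    newEdgeᵤ : UniformCircuit (newEdge ∘ n)
    newEdgeᵤ = pairᵤ bits
      (pairᵤ bits (seqᵤ (Nn +ᵤ Nn) low²ᵤ (lowᵤ n Nn)) (blockᵤ widen))
      (pairᵤ bits (seqᵤ (Nn +ᵤ Nn) low²ᵤ (highᵤ Nn Nn)) (blockᵤ (λ _ → toWord vb′ k)))

    edgesᵤ : ∀ {E : ∀ a → EdgeCircuit k (n a)} → UniformCircuit E → UniformCircuit (λ a → edges (n a) (E a))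
    edgesᵤ E = muxᵤ bits (vertexBitsᵤ′ +ᵤ vertexBitsᵤ′) isNewᵤ newEdgeᵤ
      (seqᵤ indexBitsᵤ stripᵤ (seqᵤ (vertexBitsᵤ +ᵤ vertexBitsᵤ) E
        (pairᵤ (vertexBitsᵤ +ᵤ vertexBitsᵤ)
          (seqᵤ vertexBitsᵤ (lowᵤ _ vertexBitsᵤ) embedᵤ)
          (seqᵤ vertexBitsᵤ (highᵤ vertexBitsᵤ vertexBitsᵤ) embedᵤ))))

    strippedᵤ : ∀ {j : ∀ a → Word (indexBits (suc k) (n a))} → UniformWord j → UniformWord (λ a → stripped {n a} (j a))
    strippedᵤ {j} J = record { digits = congₚ (λ a → cong encodeWord (eval-strip {n a} (j a)))
      (UniformWord.digits (evalᵤ stripᵤ J)) }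

-- Counting the edges of a clique

all-∈ : ∀ {A : Set} {P : A → Set} {m} {xs : Vec A m} → (∀ {x} → x ∈ xs → P x) → All P xs
all-∈ {xs = []}     h = []
all-∈ {xs = x ∷ xs} h = h (here refl) ∷ all-∈ (h ∘ there)

module _ {A : Set} where

  Unique-map : ∀ {B : Set} (f : A → B) {m} {xs : Vec A m} →
    (∀ {x y} → x ∈ xs → y ∈ xs → f x ≡ f y → x ≡ y) → Unique xs → Unique (map f xs)
  Unique-map f inj []       = []
  Unique-map f {xs = x ∷ xs} inj (x∉ ∷ u) =
    all-∈ (λ z∈ fx≡z → let (y , y∈ , z≡fy) = ∈-map⁻ f z∈ in
      All-lookup x∉ y∈ (inj (here refl) (there y∈) (trans fx≡z z≡fy))) ∷
    Unique-map f (λ x∈ y∈ → inj (there x∈) (there y∈)) u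

  -- Sending each position in `xs` to a position of the same element in `ys` is injective.
  Unique-⊆⇒≤ : ∀ {m n} {xs : Vec A m} {ys : Vec A n} → Unique xs → (∀ {x} → x ∈ xs → x ∈ ys) → m ≤ n
  Unique-⊆⇒≤ {xs = xs} {ys} u sub = injective⇒≤ {f = pos} λ {i} {j} eq → lookup-injective u i j
    (trans (lookup-index (sub (∈-lookup i xs))) (trans (cong (lookup ys) eq) (sym (lookup-index (sub (∈-lookup j xs))))))
    where
    pos : Fin _ → Fin _
    pos i = index (sub (∈-lookup i xs))

  -- The length of a filtered vector is part of its type. This form lets `keep` and `kept` reduce
  -- together.
  consIf : (b : Bool) → A → ∀ {m} → Vec A m → Vec A ((if b then 1 else 0) + m)
  consIf true  x xs = x ∷ xs
  consIf false x xs = xs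

  kept : (A → Bool) → ∀ {m} → Vec A m → ℕ
  kept P []       = 0
  kept P (x ∷ xs) = (if P x then 1 else 0) + kept P xs

  keep : (P : A → Bool) → ∀ {m} (xs : Vec A m) → Vec A (kept P xs)
  keep P []       = []
  keep P (x ∷ xs) = consIf (P x) x (keep P xs)

  ∈-keep⁺ : ∀ P {m x} {xs : Vec A m} → x ∈ xs → P x ≡ true → x ∈ keep P xs
  ∈-keep⁺ P {xs = y ∷ xs} (here refl) Px rewrite Px = here refl
  ∈-keep⁺ P {xs = y ∷ xs} (there x∈)  Px with P y
  ... | true  = there (∈-keep⁺ P x∈ Px)
  ... | false = ∈-keep⁺ P x∈ Px

  ∈-keep⁻ : ∀ P {m x} {xs : Vec A m} → x ∈ keep P xs → x ∈ xs × P x ≡ true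
  ∈-keep⁻ P {xs = y ∷ xs} x∈ with P y in Py
  ∈-keep⁻ P {xs = y ∷ xs} (here refl) | true = here refl , Py
  ∈-keep⁻ P {xs = y ∷ xs} (there x∈)  | true = let (x∈′ , Px) = ∈-keep⁻ P x∈ in there x∈′ , Px
  ∈-keep⁻ P {xs = y ∷ xs} x∈          | false = let (x∈′ , Px) = ∈-keep⁻ P x∈ in there x∈′ , Px

  Unique-keep : ∀ P {m} {xs : Vec A m} → Unique xs → Unique (keep P xs)
  Unique-keep P []       = []
  Unique-keep P {xs = x ∷ xs} (x∉ ∷ u) with P x
  ... | true  = all-∈ (λ y∈ → All-lookup x∉ (proj₁ (∈-keep⁻ P y∈))) ∷ Unique-keep P u
  ... | false = Unique-keep P u

  kept-complement : ∀ P {m} (xs : Vec A m) → kept P xs + kept (¬ᵇ ∘ P) xs ≡ m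
  kept-complement P []       = refl
  kept-complement P (x ∷ xs) with P x
  ... | true  = cong suc (kept-complement P xs)
  ... | false = trans (+-suc (kept P xs) _) (cong suc (kept-complement P xs))

  remove : ∀ {m x} (xs : Vec A (suc m)) → x ∈ xs → Vec A m
  remove (x ∷ xs)     (here _)   = xs
  remove (x ∷ y ∷ xs) (there x∈) = x ∷ remove (y ∷ xs) x∈

  ∈-remove⁻ : ∀ {m x y} (xs : Vec A (suc m)) (x∈ : x ∈ xs) → y ∈ remove xs x∈ → y ∈ xs
  ∈-remove⁻ (x ∷ xs)     (here _)   y∈          = there y∈
  ∈-remove⁻ (x ∷ z ∷ xs) (there x∈) (here eq)   = here eq
  ∈-remove⁻ (x ∷ z ∷ xs) (there x∈) (there y∈)  = there (∈-remove⁻ (z ∷ xs) x∈ y∈)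

  ∈-remove⁺ : ∀ {m x y} (xs : Vec A (suc m)) (x∈ : x ∈ xs) → y ∈ xs → y ≢ x → y ∈ remove xs x∈
  ∈-remove⁺ (x ∷ xs)     (here refl) (here refl) y≢ = ⊥-elim (y≢ refl)
  ∈-remove⁺ (x ∷ xs)     (here refl) (there y∈)  y≢ = y∈
  ∈-remove⁺ (x ∷ z ∷ xs) (there x∈)  (here eq)   y≢ = here eq
  ∈-remove⁺ (x ∷ z ∷ xs) (there x∈)  (there y∈)  y≢ = there (∈-remove⁺ (z ∷ xs) x∈ y∈ y≢)

  remove-≢ : ∀ {m x y} (xs : Vec A (suc m)) (x∈ : x ∈ xs) → Unique xs → y ∈ remove xs x∈ → y ≢ x
  remove-≢ (x ∷ xs)     (here refl) (x∉ ∷ u) y∈          y≡x = All-lookup x∉ y∈ (sym y≡x)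
  remove-≢ (z ∷ w ∷ xs) (there x∈)  (z∉ ∷ u) (here refl) z≡x = All-lookup z∉ x∈ z≡x
  remove-≢ (z ∷ w ∷ xs) (there x∈)  (z∉ ∷ u) (there y∈)      = remove-≢ (w ∷ xs) x∈ u y∈

  Unique-remove : ∀ {m x} (xs : Vec A (suc m)) (x∈ : x ∈ xs) → Unique xs → Unique (remove xs x∈)
  Unique-remove (x ∷ xs)     (here _)   (_ ∷ u)  = u
  Unique-remove (z ∷ w ∷ xs) (there x∈) (z∉ ∷ u) =
    all-∈ (λ y∈ → All-lookup z∉ (∈-remove⁻ (w ∷ xs) x∈ y∈)) ∷ Unique-remove (w ∷ xs) x∈ u

module Cliques {V I : Set} (_≟_ : DecidableEquality V) (e : I → V × V) where

  avoids : V → I → Bool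
  avoids w i = if does (proj₁ (e i) ≟ w) then false else ¬ᵇ (does (proj₂ (e i) ≟ w))

  avoids⁺ : ∀ {w i} → proj₁ (e i) ≢ w → proj₂ (e i) ≢ w → avoids w i ≡ true
  avoids⁺ {w} {i} p q with proj₁ (e i) ≟ w | proj₂ (e i) ≟ w
  ... | yes eq | _      = ⊥-elim (p eq)
  ... | no _   | yes eq = ⊥-elim (q eq)
  ... | no _   | no _   = refl

  avoids⁻ : ∀ {w i} → avoids w i ≡ true → proj₁ (e i) ≢ w × proj₂ (e i) ≢ w
  avoids⁻ {w} {i} av with proj₁ (e i) ≟ w | proj₂ (e i) ≟ w
  ... | no p | no q = p , q

  incident : ∀ {w i v} → SamePair (e i) (w , v) → ¬ᵇ (avoids w i) ≡ true
  incident {w} {i} s with avoids w i in av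
  ... | false = refl
  incident (inj₁ (p , _)) | true = ⊥-elim (proj₁ (avoids⁻ av) p)
  incident (inj₂ (_ , q)) | true = ⊥-elim (proj₂ (avoids⁻ av) q)

  Covers : ∀ {r m} → Vec V r → Vec I m → Set
  Covers vs is = ∀ {u v} → u ∈ vs → v ∈ vs → u ≢ v → ∃[ i ] (i ∈ is × SamePair (e i) (u , v))

  -- An edge between two vertices other than `w` avoids `w`, so the filter discards none of the
  -- edges that are still needed.
  covers-avoiding : ∀ {r r′ m w} {vs : Vec V r} {vs′ : Vec V r′} {is : Vec I m} → Covers vs is →
    (∀ {v} → v ∈ vs′ → v ∈ vs × v ≢ w) → Covers vs′ (keep (avoids w) is)
  covers-avoiding {w = w} cov sub u∈ v∈ u≢v with sub u∈ | sub v∈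
  ... | u∈′ , u≢w | v∈′ , v≢w with cov u∈′ v∈′ u≢v
  ...   | i , i∈ , inj₁ (p , q) = i , ∈-keep⁺ (avoids w) i∈ (avoids⁺ (u≢w ∘ trans (sym p)) (v≢w ∘ trans (sym q))) , inj₁ (p , q)
  ...   | i , i∈ , inj₂ (p , q) = i , ∈-keep⁺ (avoids w) i∈ (avoids⁺ (v≢w ∘ trans (sym p)) (u≢w ∘ trans (sym q))) , inj₂ (p , q)

  -- Taking each edge at `w` to its end `other` than `w` reaches every element of `vs`, so there are
  -- at least `r` such edges.
  star : ∀ {r m w} {vs : Vec V r} (is : Vec I m) → Unique vs → (∀ {v} → v ∈ vs → v ≢ w) →
    (∀ {v} → v ∈ vs → ∃[ i ] (i ∈ is × SamePair (e i) (w , v))) → r ≤ kept (¬ᵇ ∘ avoids w) is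
  star {w = w} {vs} is u ≢w cov = Unique-⊆⇒≤ {ys = map other (keep (¬ᵇ ∘ avoids w) is)} u λ v∈ →
    let (i , i∈ , s) = cov v∈ in
    subst (_∈ map other (keep (¬ᵇ ∘ avoids w) is)) (other≡ i s (≢w v∈)) (∈-map⁺ other (∈-keep⁺ (¬ᵇ ∘ avoids w) i∈ (incident s)))
    where
    other : I → V
    other i = if does (proj₁ (e i) ≟ w) then proj₂ (e i) else proj₁ (e i)
    other≡ : ∀ i {v} → SamePair (e i) (w , v) → v ≢ w → other i ≡ v
    other≡ i s v≢w with proj₁ (e i) ≟ w
    other≡ i (inj₁ (p , q)) v≢w | yes _ = q
    other≡ i (inj₂ (p , q)) v≢w | yes p′ = ⊥-elim (v≢w (trans (sym p) p′))
    other≡ i (inj₁ (p , q)) v≢w | no ¬p = ⊥-elim (¬p p)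
    other≡ i (inj₂ (p , q)) v≢w | no _ = p

  -- Induction on the vertices: at least `r` indices belong to edges at `w`, and the indices that
  -- avoid `w` still cover the other vertices.
  covers⇒≤ : ∀ {r m} (vs : Vec V r) (is : Vec I m) → Unique vs → Covers vs is → r choose 2 ≤ m
  covers⇒≤ []       is u cov = z≤n
  covers⇒≤ {suc r} {m} (w ∷ vs) is (w∉ ∷ u) cov = begin
    suc r choose 2                                      ≡⟨ choose2 r ⟩
    r + (r choose 2)                                    ≡⟨ +-comm r (r choose 2) ⟩
    (r choose 2) + r                                    ≤⟨ +-mono-≤
      (covers⇒≤ vs (keep (avoids w) is) u (covers-avoiding {vs = w ∷ vs} cov λ v∈ → there v∈ , All-lookup w∉ v∈ ∘ sym))
      (star is u (λ v∈ → All-lookup w∉ v∈ ∘ sym) (λ v∈ → cov (here refl) (there v∈) (All-lookup w∉ v∈))) ⟩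
    kept (avoids w) is + kept (¬ᵇ ∘ avoids w) is        ≡⟨ kept-complement (avoids w) is ⟩
    m                                                   ∎
    where open ≤-Reasoning

  -- Both inequalities of the count (at least r edges at w, at least r choose 2 away from w)
  -- are tight, since the total is (r + 1) choose 2.
  kept-avoiding : ∀ {r m} (vs : Vec V (suc r)) (is : Vec I m) {w} → m ≡ suc r choose 2 → w ∈ vs → Unique vs → Covers vs is →
    kept (avoids w) is ≡ r choose 2
  kept-avoiding {r} {m} vs is {w} m≡ w∈ u cov = ≤-antisym
    (+-cancelʳ-≤ r _ _ (begin
      kept (avoids w) is + r                        ≤⟨ +-monoʳ-≤ (kept (avoids w) is)
        (star is (Unique-remove vs w∈ u) (remove-≢ vs w∈ u)
          (λ v∈ → cov w∈ (∈-remove⁻ vs w∈ v∈) (remove-≢ vs w∈ u v∈ ∘ sym))) ⟩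
      kept (avoids w) is + kept (¬ᵇ ∘ avoids w) is  ≡⟨ kept-complement (avoids w) is ⟩
      m                                             ≡⟨ m≡ ⟩
      suc r choose 2                                ≡⟨ choose2 r ⟩
      r + (r choose 2)                              ≡⟨ +-comm r (r choose 2) ⟩
      (r choose 2) + r                              ∎))
    (covers⇒≤ (remove vs w∈) (keep (avoids w) is) (Unique-remove vs w∈ u)
      (covers-avoiding {vs = vs} cov λ v∈ → ∈-remove⁻ vs w∈ v∈ , remove-≢ vs w∈ u v∈))
    where open ≤-Reasoning

-- Removing a vertex from a clique of the extended graph

module Residual {V I V₀ I₀ : Set} (_≟_ : DecidableEquality V)
  (e : I → V × V) (e₀ : I₀ → V₀ × V₀) (new : I → Bool) (strip : I → I₀) (restrict : V → V₀) where

  open Cliques _≟_ e public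

  -- The vertex to drop from a clique: the new one, if there is any, since new vertices are
  -- pairwise not adjacent.
  pick : V → ∀ {m} → Vec I m → V
  pick d []       = d
  pick d (i ∷ is) = if new i then proj₂ (e i) else pick (proj₁ (e i)) is

  remaining : ∀ (d : V) {m} (is : Vec I m) → Vec I₀ (kept (avoids (pick d is)) is)
  remaining d is = map strip (keep (avoids (pick d is)) is)

  Picked : V → ∀ {m} → Vec I m → Set
  Picked w is = (∃[ i ] (i ∈ is × new i ≡ true × w ≡ proj₂ (e i))) ⊎
    ((∀ {i} → i ∈ is → new i ≡ false) × ∃[ i ] (i ∈ is × w ≡ proj₁ (e i)))

  -- Each old edge passed replaces the default by its own first end. On a nonempty list the result
  -- is thus an end of a listed edge, never the initial `d`.
  picked : ∀ d {m} i (is : Vec I m) → Picked (pick d (i ∷ is)) (i ∷ is)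
  picked d i is with new i in eq
  picked d i is       | true  = inj₁ (i , here refl , eq , refl)
  picked d i []       | false = inj₂ ((λ where (here refl) → eq) , i , here refl , refl)
  picked d i (j ∷ is) | false with picked (proj₁ (e i)) j is
  ... | inj₁ (l , l∈ , l-new , w≡) = inj₁ (l , there l∈ , l-new , w≡)
  ... | inj₂ (old , l , l∈ , w≡)   = inj₂ ((λ where (here refl) → eq ; (there i∈) → old i∈) , l , there l∈ , w≡)

  module _ (Valid : I → Set) (OldVertex : V → Set)
    (new-ends : ∀ i → new i ≡ true → OldVertex (proj₁ (e i)) × ¬ OldVertex (proj₂ (e i)))
    (old-ends : ∀ i → Valid i → new i ≡ false → OldVertex (proj₁ (e i)) × OldVertex (proj₂ (e i)))
    (strip-injective : ∀ i j → Valid i → Valid j → new i ≡ false → new j ≡ false → strip i ≡ strip j → i ≡ j)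
    (restrict-injective : ∀ u v → OldVertex u → OldVertex v → restrict u ≡ restrict v → u ≡ v)
    (stripped-edge : ∀ i → Valid i → new i ≡ false → e₀ (strip i) ≡ (restrict (proj₁ (e i)) , restrict (proj₂ (e i))))
    {k : ℕ} (d : V) {m : ℕ} (is : Vec I m) (valid : All Valid is) (is-unique : Unique is)
    (form : FormClique (suc (suc k)) (map e is)) where

    private
      vs : Vec V (suc (suc k))
      vs = proj₁ form

      vs-unique : Unique vs
      vs-unique = proj₁ (proj₂ form)

      ends : ∀ {i} → i ∈ is → proj₁ (e i) ∈ vs × proj₂ (e i) ∈ vs × proj₁ (e i) ≢ proj₂ (e i)
      ends i∈ = All-lookup (proj₁ (proj₂ (proj₂ form))) (∈-map⁺ e i∈)

      covers : Covers vs is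
      covers u∈ v∈ u≢v with proj₂ (proj₂ (proj₂ form)) u∈ v∈ u≢v
      ... | _ , e∈ , s with ∈-map⁻ e e∈
      ...   | i , i∈ , refl = i , i∈ , s

      apex : V
      apex = pick d is

      w-picked : Picked apex is
      -- The list is not empty: the clique has at least two vertices, and it lists an edge between
      -- the first two.
      w-picked = nonempty is (proj₁ (proj₂ (covers (∈-lookup zero vs) (∈-lookup (suc zero) vs)
        (λ eq → 0≢1+nᶠ (lookup-injective vs-unique zero (suc zero) eq)))))
        where
        nonempty : ∀ {m i} (is : Vec I m) → i ∈ is → Picked (pick d is) is
        nonempty (i ∷ is) _ = picked d i is

      w∈vs : apex ∈ vs
      w∈vs with w-picked
      ... | inj₁ (i , i∈ , _ , eq) = subst (_∈ vs) (sym eq) (proj₁ (proj₂ (ends i∈)))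
      ... | inj₂ (_ , i , i∈ , eq) = subst (_∈ vs) (sym eq) (proj₁ (ends i∈))

      proj₁-old : ∀ {i} → i ∈ is → OldVertex (proj₁ (e i))
      proj₁-old {i} i∈ with new i in eq
      ... | true  = proj₁ (new-ends i eq)
      ... | false = proj₁ (old-ends i (All-lookup valid i∈) eq)

      -- If the new end of `i` were not the apex, the clique would contain an edge between two new
      -- vertices. Its first end would not be old, contrary to `proj₁-old`.
      new-ends-at-w : ∀ {i} → i ∈ is → new i ≡ true → proj₂ (e i) ≡ apex
      new-ends-at-w {i} i∈ i-new with w-picked
      ... | inj₂ (old , _) with () ← trans (sym i-new) (old i∈)
      new-ends-at-w {i} i∈ i-new | inj₁ (j , j∈ , j-new , w≡) with proj₂ (e i) ≟ apex
      ... | yes eq = eq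
      ... | no ≢w with covers (proj₁ (proj₂ (ends i∈))) w∈vs ≢w
      ...   | l , l∈ , inj₁ (p , _) = ⊥-elim (proj₂ (new-ends i i-new) (subst OldVertex p (proj₁-old l∈)))
      ...   | l , l∈ , inj₂ (p , _) = ⊥-elim (proj₂ (new-ends j j-new) (subst OldVertex (trans p w≡) (proj₁-old l∈)))

      -- Consider the edge between `v` and the apex. If `v` is its first end, then `v` is old. If
      -- `v` is its second end, then the edge is old, as a new one would make `v` the apex.
      old-vertex : ∀ {v} → v ∈ vs → v ≢ apex → OldVertex v
      old-vertex {v} v∈ v≢w with covers v∈ w∈vs v≢w
      ... | i , i∈ , inj₁ (p , _) = subst OldVertex p (proj₁-old i∈)
      ... | i , i∈ , inj₂ (p , q) with new i in eq
      ...   | true  = ⊥-elim (v≢w (trans (sym q) (new-ends-at-w i∈ eq)))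
      ...   | false = subst OldVertex q (proj₂ (old-ends i (All-lookup valid i∈) eq))

      ks : Vec I (kept (avoids apex) is)
      ks = keep (avoids apex) is

      ks⊆is : ∀ {i} → i ∈ ks → i ∈ is
      ks⊆is i∈ = proj₁ (∈-keep⁻ (avoids apex) {xs = is} i∈)

      ks-avoid : ∀ {i} → i ∈ ks → proj₁ (e i) ≢ apex × proj₂ (e i) ≢ apex
      ks-avoid i∈ = avoids⁻ (proj₂ (∈-keep⁻ (avoids apex) {xs = is} i∈))

      -- The indices kept avoid the apex, whereas every new edge of the clique ends there.
      ks-old : ∀ {i} → i ∈ ks → new i ≡ false
      ks-old {i} i∈ with new i in eq
      ... | false = refl
      ... | true  = ⊥-elim (proj₂ (ks-avoid i∈) (new-ends-at-w (ks⊆is i∈) eq))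

      ks-valid : ∀ {i} → i ∈ ks → Valid i
      ks-valid i∈ = All-lookup valid (ks⊆is i∈)

      vs′ : Vec V (suc k)
      vs′ = remove vs w∈vs

      vs′⊆vs : ∀ {v} → v ∈ vs′ → v ∈ vs × v ≢ apex
      vs′⊆vs v∈ = ∈-remove⁻ vs w∈vs v∈ , remove-≢ vs w∈vs vs-unique v∈

      vs′-old : ∀ {v} → v ∈ vs′ → OldVertex v
      vs′-old v∈ = let (v∈vs , v≢w) = vs′⊆vs v∈ in old-vertex v∈vs v≢w

      edges-inside : ∀ {f} → f ∈ map e₀ (remaining d is) →
        proj₁ f ∈ map restrict vs′ × proj₂ f ∈ map restrict vs′ × proj₁ f ≢ proj₂ f
      edges-inside f∈ with ∈-map⁻ e₀ f∈
      ... | j , j∈ , refl with ∈-map⁻ strip j∈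
      ...   | i , i∈ , refl rewrite stripped-edge i (ks-valid i∈) (ks-old i∈) =
        let (u∈ , v∈ , u≢v) = ends (ks⊆is i∈)
            (u≢w , v≢w) = ks-avoid i∈
            u∈′ = ∈-remove⁺ vs w∈vs u∈ u≢w
            v∈′ = ∈-remove⁺ vs w∈vs v∈ v≢w
        in ∈-map⁺ restrict u∈′ , ∈-map⁺ restrict v∈′ ,
           u≢v ∘ restrict-injective _ _ (vs′-old u∈′) (vs′-old v∈′)

      SamePair-map : ∀ {e u v} → SamePair e (u , v) → SamePair (restrict (proj₁ e) , restrict (proj₂ e)) (restrict u , restrict v)
      SamePair-map (inj₁ (p , q)) = inj₁ (cong restrict p , cong restrict q)
      SamePair-map (inj₂ (p , q)) = inj₂ (cong restrict p , cong restrict q)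

      covered : ∀ {a b} → a ∈ map restrict vs′ → b ∈ map restrict vs′ → a ≢ b →
        ∃[ f ] (f ∈ map e₀ (remaining d is) × SamePair f (a , b))
      covered a∈ b∈ a≢b with ∈-map⁻ restrict a∈ | ∈-map⁻ restrict b∈
      ... | u , u∈ , refl | v , v∈ , refl
        with covers-avoiding {vs = vs} {vs′} {is} covers vs′⊆vs u∈ v∈ (a≢b ∘ cong restrict)
      ...   | i , i∈ , s = e₀ (strip i) , ∈-map⁺ e₀ (∈-map⁺ strip i∈) ,
        subst (λ f → SamePair f _) (sym (stripped-edge i (ks-valid i∈) (ks-old i∈))) (SamePair-map s)

    remaining-old : ∀ {j} → j ∈ remaining d is → ∃[ i ] (Valid i × new i ≡ false × j ≡ strip i)
    remaining-old j∈ = let (i , i∈ , eq) = ∈-map⁻ strip j∈ in i , ks-valid i∈ , ks-old i∈ , eq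

    remaining-unique : Unique (remaining d is)
    remaining-unique = Unique-map strip {xs = ks}
      (λ i∈ j∈ → strip-injective _ _ (ks-valid i∈) (ks-valid j∈) (ks-old i∈) (ks-old j∈)) (Unique-keep (avoids apex) {xs = is} is-unique)

    remaining-clique : FormClique (suc k) (map e₀ (remaining d is))
    remaining-clique = map restrict vs′ ,
      Unique-map restrict (λ u∈ v∈ → restrict-injective _ _ (vs′-old u∈) (vs′-old v∈)) (Unique-remove vs w∈vs vs-unique) ,
      all-∈ edges-inside , covered

    -- The length of `remaining` is computed by a filter and does not reduce to the number required
    -- of a solution; this equation allows the cast.
    remaining-count : m ≡ suc (suc k) choose 2 → kept (avoids (pick d is)) is ≡ suc k choose 2
    remaining-count m≡ = kept-avoiding vs is m≡ w∈vs vs-unique covers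

-- From Bad k-Coloring to Bad (k + 1)-Coloring

module ColoringToColoring (k : ℕ) (p : Poly) where

  open Extension k

  cb cb′ : ℕ
  cb  = colourBits k
  cb′ = colourBits (suc k)

  widenColour : Word cb → Word cb′
  widenColour c = toWord cb′ (value c)

  module _ (n : ℕ) where
    narrowed : Circuit (n + vb′) (n + vb)
    narrowed = lowWires n vb′ △ (highWires n vb′ ⨾ table narrow)

    isOldVertex : Circuit (n + vb′) 1
    isOldVertex = highWires n vb′ ⨾ table (λ h → [ value h <ᵇ k ])

    newColour : Circuit (n + vb′) cb′
    newColour = highWires n vb′ ⨾ table (λ _ → toWord cb′ (suc k))

    colours : Circuit (n + vb) cb → Circuit (n + vb′) cb′
    colours C = mux isOldVertex (narrowed ⨾ C ⨾ table widenColour) newColour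

  module _ {n : ℕ} (C : Circuit (n + vb) cb) where

    colour-old : ∀ v → OldVertex v → eval (colours n C) v ≡ widenColour (eval C (restricted v))
    colour-old v old = begin
      eval (colours n C) v
        ≡⟨ eval-mux (isOldVertex n) _ (newColour n) v
             (trans (eval-high⨾table (λ h → [ value h <ᵇ k ]) v) (cong [_] (<ᵇ-true old))) ⟩
      eval (narrowed n ⨾ C ⨾ table widenColour) v
        ≡⟨ trans (eval-⨾ (narrowed n) _ v) (eval-⨾ C (table widenColour) _) ⟩
      eval (table widenColour) (eval C (eval (narrowed n) v))
        ≡⟨ eval-table widenColour _ ⟩
      widenColour (eval C (eval (narrowed n) v))
        ≡⟨ cong (widenColour ∘ eval C) (trans (eval-△ (lowWires n vb′) _ v)
             (cong₂ _++_ (eval-low≡take n v) (eval-high⨾table narrow v))) ⟩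
      widenColour (eval C (restricted v)) ∎
      where open ≡-Reasoning

    colour-new : ∀ v → NewVertex v → eval (colours n C) v ≡ toWord cb′ (suc k)
    colour-new v new = trans
      (eval-mux (isOldVertex n) _ (newColour n) v
        (trans (eval-high⨾table (λ h → [ value h <ᵇ k ]) v) (cong [_] (<ᵇ-false (≤-reflexive (sym new))))))
      (eval-high⨾table (λ _ → toWord cb′ (suc k)) v)

    1+k<2^cb′ : suc k < 2 ^ cb′
    1+k<2^cb′ = k≤2^⌈log₂k⌉ (suc (suc k))

    value-new : ∀ v → NewVertex v → value (eval (colours n C) v) ≡ suc k
    value-new v new = trans (cong value (colour-new v new)) (value-toWord cb′ (suc k) 1+k<2^cb′)

    module _ (C-inRange : ∀ v → IsVertex k n v → IsColour k (eval C v)) where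

      value-old : ∀ v → OldVertex v → value (eval (colours n C) v) ≡ value (eval C (restricted v))
      value-old v old = trans (cong value (colour-old v old)) (value-toWord cb′ _
        (<-trans (s≤s (proj₂ (C-inRange (restricted v) (restricted-vertex v old)))) 1+k<2^cb′))

      colours-inRange : ∀ v → IsVertex (suc k) n v → IsColour (suc k) (eval (colours n C) v)
      colours-inRange v v< with value (drop n v) <? k
      ... | yes old = let (1≤ , ≤k) = C-inRange (restricted v) (restricted-vertex v old) in
        subst (1 ≤_) (sym (value-old v old)) 1≤ , m≤n⇒m≤1+n (subst (_≤ k) (sym (value-old v old)) ≤k)
      ... | no ¬old = subst (1 ≤_) (sym (value-new v new)) (s≤s z≤n) , ≤-reflexive (value-new v new)
        where
        new : NewVertex v
        new = ≤-antisym (s≤s⁻¹ (vertex-high {n} {vb′} v v<)) (≮⇒≥ ¬old)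

      module _ (E : EdgeCircuit k n) (E-inRange : EdgesInRange k n E) where

        -- A new edge has colour `suc k` at its new end and at most `k` at its old end. On old
        -- vertices the colouring is that of `C` read through `restricted`, so a monochromatic old
        -- edge is one for `C`.
        monochromatic-old : ∀ i → IsIndex (suc k) n i →
          eval (colours n C) (proj₁ (edge (suc k) n (edges n E) i)) ≡ eval (colours n C) (proj₂ (edge (suc k) n (edges n E) i)) →
          Old {n} i × eval C (proj₁ (edge k n E (stripped {n} i))) ≡ eval C (proj₂ (edge k n E (stripped {n} i)))
        monochromatic-old i i≤ eq with value (block {n} i) <? k
        ... | yes new = ⊥-elim (1+n≰n (begin
          suc k                                               ≡⟨ sym (value-new v v-new) ⟩
          value (eval (colours n C) v)                        ≡⟨ cong value (sym eq) ⟩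
          value (eval (colours n C) u)                        ≡⟨ value-old u u-old ⟩
          value (eval C (restricted u))                       ≤⟨ proj₂ (C-inRange (restricted u) (restricted-vertex u u-old)) ⟩
          k                                                   ∎))
          where
          open ≤-Reasoning
          u = proj₁ (edge (suc k) n (edges n E) i)
          v = proj₂ (edge (suc k) n (edges n E) i)
          u-old = proj₁ (new-ends {n} E i new)
          v-new = proj₂ (new-ends {n} E i new)
        ... | no ¬new = old , value-injective _ _ (begin
          value (eval C u)                                   ≡⟨ sym (value-embedded u (proj₁ ends)) ⟩
          value (eval (colours n C) (embedded u))            ≡⟨ cong (value ∘ eval (colours n C) ∘ proj₁) (sym (edge-old {n} E i old)) ⟩
          value (eval (colours n C) (proj₁ (edge (suc k) n (edges n E) i)))  ≡⟨ cong value eq ⟩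
          value (eval (colours n C) (proj₂ (edge (suc k) n (edges n E) i)))  ≡⟨ cong (value ∘ eval (colours n C) ∘ proj₂) (edge-old {n} E i old) ⟩
          value (eval (colours n C) (embedded v))            ≡⟨ value-embedded v (proj₂ ends) ⟩
          value (eval C v)                                   ∎)
          where
          open ≡-Reasoning
          old = ≮⇒≥ ¬new
          u = proj₁ (edge k n E (stripped {n} i))
          v = proj₂ (edge k n E (stripped {n} i))
          ends = E-inRange (stripped {n} i) (stripped-index {n} i i≤ old)
          value-embedded : ∀ v → IsVertex k n v → value (eval (colours n C) (embedded v)) ≡ value (eval C v)
          value-embedded v v< = trans (value-old (embedded v) (embedded-old v v<))
            (cong (value ∘ eval C) (restricted-embedded v v<))

  open BadColoringInstance

  module _ where
    open Uniform (encodeInstance (BadColoring k p)) n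

    numberᵤ : UniformNumber n
    numberᵤ = record { unary = leftₚ idₚ ; degree = var ; below = λ _ → ≤-refl }

    E′ᵤ : UniformCircuit (λ I → edges (n I) (E I))
    E′ᵤ = edgesᵤ numberᵤ (record { code = leftₚ (rightₚ idₚ) ; degree = p ; small = E-small })

    C′ᵤ : UniformCircuit (λ I → colours (n I) (C I))
    C′ᵤ = muxᵤ (vertexBitsᵤ′ numberᵤ) (constNumber cb′) (blockᵤ _)
      (seqᵤ (vertexBitsᵤ numberᵤ) (pairᵤ (vertexBitsᵤ′ numberᵤ) (lowᵤ _ numberᵤ) (blockᵤ _))
        (seqᵤ (constNumber cb) (record { code = rightₚ (rightₚ idₚ) ; degree = p ; small = C-small })
          (constCircuit (table widenColour))))
      (blockᵤ _)
      where
      blockᵤ : ∀ {w} (F : Word vb′ → Word w) → UniformCircuit (λ I → highWires (n I) vb′ ⨾ table F)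
      blockᵤ F = seqᵤ (constNumber vb′) (highᵤ numberᵤ (constNumber vb′)) (constCircuit (table F))

    open UniformCircuit

    q : Poly
    q = degree E′ᵤ ⊕ degree C′ᵤ

    extended : BadColoringInstance k p → BadColoringInstance (suc k) q
    extended I = record
      { n = n I ; E = edges (n I) (E I) ; C = colours (n I) (C I)
      ; E-small = ≤-trans (small E′ᵤ I) (m≤m+n _ _)
      ; C-small = ≤-trans (small C′ᵤ I) (m≤n+m _ (⟦ degree E′ᵤ ⟧ (n I)))
      ; E-inRange = edges-inRange {n I} (E I) (E-inRange I)
      ; C-inRange = colours-inRange {n I} (C I) (C-inRange I)
      }

    extendedₚ : PolyTime (encodeInstance (BadColoring k p)) (λ I → encodeInstance (BadColoring (suc k) q) (extended I))
    extendedₚ = nodeₚ (leftₚ idₚ) (nodeₚ (code E′ᵤ) (code C′ᵤ))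

  pullBack : ∀ I → BadColoringSolution (suc k) q (extended I) → BadColoringSolution k p I
  pullBack I (repeated i j i≤ j≤ i≢j s) =
    let (iold , jold , i≢j′ , s′) = repeated-old {n I} (E I) (E-inRange I) i j i≤ j≤ i≢j s in
    repeated (stripped {n I} i) (stripped {n I} j) (stripped-index {n I} i i≤ iold) (stripped-index {n I} j j≤ jold) i≢j′ s′
  pullBack I (monochromatic i i≤ eq) =
    let (iold , eq′) = monochromatic-old {n I} (C I) (C-inRange I) (E I) (E-inRange I) i i≤ eq in
    monochromatic (stripped {n I} i) (stripped-index {n I} i i≤ iold) eq′

  module _ where
    open Uniform.UniformWord

    W : BadColoringInstance k p → Set
    W I = Word (indexBits (suc k) (n I))

    input₂ : Σ (BadColoringInstance k p) (λ I → W I × W I) → Tree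
    input₂ (I , i , j) = node (encodeInstance (BadColoring k p) I) (node leaf (node (encodeWord i) (encodeWord j)))

    input₁ : Σ (BadColoringInstance k p) W → Tree
    input₁ (I , i) = node (encodeInstance (BadColoring k p) I) (node (encodeℕ 1) (encodeWord i))

    reduction : Reduces (BadColoring k p) (BadColoring (suc k) q)
    reduction = record
      { f = extended
      ; g = pullBack
      ; f-polyTime = extendedₚ
      ; g-polyTime = branchₚ {i₁ = input₁} {i₂ = input₂} (leftₚ (rightₚ idₚ))
          (nodeₚ (constₚ (encodeℕ 1)) (digits (strippedᵤ (reindexNumber proj₁ (leftₚ idₚ) numberᵤ) (record { digits = rightₚ (rightₚ idₚ) }))))
          (nodeₚ leafₚ (nodeₚ
            (digits (strippedᵤ (reindexNumber proj₁ (leftₚ idₚ) numberᵤ) (record { digits = leftₚ (rightₚ (rightₚ idₚ)) })))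
            (digits (strippedᵤ (reindexNumber proj₁ (leftₚ idₚ) numberᵤ) (record { digits = rightₚ (rightₚ (rightₚ idₚ)) })))))
          λ where
            (I , repeated i j _ _ _ _) → inj₂ (refl , (I , i , j) , refl , refl)
            (I , monochromatic i _ _)  → inj₁ (_ , _ , refl , (I , i) , refl , refl)
      }

-- From k-Turán to (k + 1)-Turán

module _ {A : Set} (i : A → Tree) (N : A → ℕ) where
  open Uniform i N
  open UniformWord

  -- Unrolled over the fixed length `m`, like `firstOrᵤ`, although the length of the result varies
  -- with the input.
  keepₚ : ∀ {w v : A → ℕ} (P : ∀ a → Word (w a) → Bool) (f : ∀ a → Word (w a) → Word (v a)) →
    (∀ {x : ∀ a → Word (w a)} → UniformWord x → UniformBool (λ a → P a (x a))) →
    (∀ {x : ∀ a → Word (w a)} → UniformWord x → UniformWord (λ a → f a (x a))) →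
    ∀ {m} {xs : ∀ a → Vec (Word (w a)) m} → PolyTime i (λ a → encodeVec encodeWord (xs a)) →
    PolyTime i (λ a → encodeVec encodeWord (map (f a) (keep (P a) (xs a))))
  keepₚ P f Pᵤ fᵤ {zero} {xs} X = congₚ (λ a → keep-[] (P a) (f a) (xs a)) leafₚ
    where
    keep-[] : ∀ {w v} P (f : Word w → Word v) xs → leaf ≡ encodeVec encodeWord (map f (keep P xs))
    keep-[] P f [] = refl
  keepₚ P f Pᵤ fᵤ {suc m} {xs} X = congₚ (λ a → keep-∷ (P a) (f a) (xs a))
    (ifₚ (Pᵤ (headₚ i N X)) (nodeₚ (digits (fᵤ (headₚ i N X))) rest) rest)
    where
    rest = keepₚ P f Pᵤ fᵤ (tailₚ i N X)
    keep-∷ : ∀ {w v m} P (f : Word w → Word v) (xs : Vec (Word w) (suc m)) →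
      ifT (encodeBool (P (head xs)))
        (node (encodeWord (f (head xs))) (encodeVec encodeWord (map f (keep P (tail xs)))))
        (encodeVec encodeWord (map f (keep P (tail xs)))) ≡
      encodeVec encodeWord (map f (keep P xs))
    keep-∷ P f (x ∷ xs) with P x
    ... | true  = refl
    ... | false = refl

module TuránToTurán (k : ℕ) (p : Poly) where

  open Extension k
  open TuránInstance

  module _ where
    open Uniform (encodeInstance (Turán k p)) n

    numberᵤ : UniformNumber n
    numberᵤ = record { unary = leftₚ idₚ ; degree = var ; below = λ _ → ≤-refl }

    E′ᵤ : UniformCircuit (λ I → edges (n I) (E I))
    E′ᵤ = edgesᵤ numberᵤ (record { code = rightₚ idₚ ; degree = p ; small = E-small })

    open UniformCircuit

    q : Poly
    q = degree E′ᵤ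

    extended : TuránInstance k p → TuránInstance (suc k) q
    extended I = record
      { n = n I ; E = edges (n I) (E I) ; E-small = small E′ᵤ I ; E-inRange = edges-inRange {n I} (E I) (E-inRange I) }

    extendedₚ : PolyTime (encodeInstance (Turán k p)) (λ I → encodeInstance (Turán (suc k) q) (extended I))
    extendedₚ = nodeₚ (leftₚ idₚ) (code E′ᵤ)

  module _ (n : ℕ) where

    isNewIndex : Word (indexBits (suc k) n) → Bool
    isNewIndex i = value (block {n} i) <ᵇ k

    isNewIndex-true : ∀ i → isNewIndex i ≡ true → New {n} i
    isNewIndex-true i eq = <ᵇ⇒< _ _ (subst T (sym eq) _)

    isNewIndex-false : ∀ i → isNewIndex i ≡ false → Old {n} i
    isNewIndex-false i eq = ≮⇒≥ λ new → true≢false (trans (sym (<ᵇ-true new)) eq)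
      where
      true≢false : true ≢ false
      true≢false ()

    module _ (E : EdgeCircuit k n) where

      e′ : Word (indexBits (suc k) n) → Word (vertexBits (suc k) n) × Word (vertexBits (suc k) n)
      e′ = edge (suc k) n (edges n E)

      open Residual _≟ʷ_ e′ (edge k n E) isNewIndex (stripped {n}) (restricted {n}) public

      -- A default for `pick`, not returned on the index list of a clique, which is nonempty.
      noVertex : Word (vertexBits (suc k) n)
      noVertex = replicate (vertexBits (suc k) n) false

      IsClique : ∀ {m} → Vec (Word (indexBits k n)) m → Set
      IsClique is = All (IsIndex k n) is × Unique is × FormClique (suc k) (map (edge k n E) is)

      module _ (E-inRange : EdgesInRange k n E) where

        private
          new-ends′ : ∀ i → isNewIndex i ≡ true → OldVertex {n} (proj₁ (e′ i)) × ¬ OldVertex {n} (proj₂ (e′ i))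
          new-ends′ i new = let (u-old , v-new) = new-ends {n} E i (isNewIndex-true i new) in
            u-old , λ v-old → old≢new {n} v-old v-new refl

          old-ends′ : ∀ i → IsIndex (suc k) n i → isNewIndex i ≡ false → OldVertex {n} (proj₁ (e′ i)) × OldVertex {n} (proj₂ (e′ i))
          old-ends′ i i≤ old = old-ends {n} E E-inRange i i≤ (isNewIndex-false i old)

          stripped-injective′ : ∀ i j → IsIndex (suc k) n i → IsIndex (suc k) n j → isNewIndex i ≡ false → isNewIndex j ≡ false →
            stripped {n} i ≡ stripped {n} j → i ≡ j
          stripped-injective′ i j i≤ j≤ iold jold = stripped-injective {n} i j i≤ j≤ (isNewIndex-false i iold) (isNewIndex-false j jold)

          restricted-injective : ∀ u v → OldVertex {n} u → OldVertex {n} v → restricted {n} u ≡ restricted {n} v → u ≡ v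
          restricted-injective u v u-old v-old eq = trans (sym (embedded-restricted {n} u u-old))
            (trans (cong (embedded {n}) eq) (embedded-restricted {n} v v-old))

          stripped-edge : ∀ i → IsIndex (suc k) n i → isNewIndex i ≡ false →
            edge k n E (stripped {n} i) ≡ (restricted {n} (proj₁ (e′ i)) , restricted {n} (proj₂ (e′ i)))
          stripped-edge i i≤ old = sym (trans
            (cong (λ f → restricted {n} (proj₁ f) , restricted {n} (proj₂ f)) (edge-old {n} E i (isNewIndex-false i old)))
            (cong₂ _,_ (restricted-embedded {n} _ (proj₁ ends)) (restricted-embedded {n} _ (proj₂ ends))))
            where ends = E-inRange (stripped {n} i) (stripped-index {n} i i≤ (isNewIndex-false i old))

        module _ (is : Vec (Word (indexBits (suc k) n)) (suc (suc k) choose 2)) (is≤ : All (IsIndex (suc k) n) is)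
                 (u : Unique is) (c : FormClique (suc (suc k)) (map e′ is)) where

          oldClique-count : kept (avoids (pick noVertex is)) is ≡ suc k choose 2
          oldClique-count = remaining-count (IsIndex (suc k) n) (OldVertex {n}) new-ends′ old-ends′ stripped-injective′
            restricted-injective stripped-edge noVertex is is≤ u c refl

          oldClique-isClique : IsClique (remaining noVertex is)
          oldClique-isClique =
            all-∈ (λ j∈ → let (i , i≤ , i-old , eq) = remaining-old (IsIndex (suc k) n) (OldVertex {n}) new-ends′ old-ends′
                                stripped-injective′ restricted-injective stripped-edge noVertex is is≤ u c j∈
                          in subst (IsIndex k n) (sym eq) (stripped-index {n} i i≤ (isNewIndex-false i i-old))) ,
            remaining-unique (IsIndex (suc k) n) (OldVertex {n}) new-ends′ old-ends′ stripped-injective′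
              restricted-injective stripped-edge noVertex is is≤ u c ,
            remaining-clique (IsIndex (suc k) n) (OldVertex {n}) new-ends′ old-ends′ stripped-injective′
              restricted-injective stripped-edge noVertex is is≤ u c

  SizedClique : (I : TuránInstance k p) → ℕ → Set
  SizedClique I m = Σ (Vec (Word (indexBits k (n I))) m) (IsClique (n I) (E I))

  -- The cast along `oldClique-count` does not change the encoding, so no program has to carry it
  -- out.
  encode-subst : ∀ I {l m} (eq : l ≡ m) (c : SizedClique I l) →
    encodeVec encodeWord (proj₁ c) ≡ encodeVec encodeWord (proj₁ (subst (SizedClique I) eq c))
  encode-subst I refl c = refl

  oldClique : ∀ I is → All (IsIndex (suc k) (n I)) is → Unique is →
    FormClique (suc (suc k)) (map (edge (suc k) (n I) (edges (n I) (E I))) is) → SizedClique I (suc k choose 2)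
  oldClique I is is≤ u c = subst (SizedClique I) (oldClique-count (n I) (E I) (E-inRange I) is is≤ u c)
    (remaining (n I) (E I) (noVertex (n I) (E I)) is , oldClique-isClique (n I) (E I) (E-inRange I) is is≤ u c)

  pullBack : ∀ I → TuránSolution (suc k) q (extended I) → TuránSolution k p I
  pullBack I (loop i i≤ eq) = loop (stripped {n I} i) (stripped-index {n I} i i≤ old)
    (embedded-injective {n I} _ _ (proj₁ ends) (proj₂ ends)
      (trans (sym (cong proj₁ (edge-old {n I} (E I) i old))) (trans eq (cong proj₂ (edge-old {n I} (E I) i old)))))
    where
    old : Old {n I} i
    -- A new edge joins an old vertex to a new one, so it is never a loop.
    old = ≮⇒≥ λ new → let (u-old , v-new) = new-ends {n I} (E I) i new in old≢new {n I} u-old v-new eq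
    ends = E-inRange I (stripped {n I} i) (stripped-index {n I} i i≤ old)
  pullBack I (repeated i j i≤ j≤ i≢j s) =
    let (iold , jold , i≢j′ , s′) = repeated-old {n I} (E I) (E-inRange I) i j i≤ j≤ i≢j s in
    repeated (stripped {n I} i) (stripped {n I} j) (stripped-index {n I} i i≤ iold) (stripped-index {n I} j j≤ jold) i≢j′ s′
  pullBack I (clique is is≤ u c) =
    let (js , js≤ , js-unique , js-clique) = oldClique I is is≤ u c in clique js js≤ js-unique js-clique

  module _ {J : Set} {encodeJ : J → Tree} (h : J → TuránInstance k p)
           (H : PolyTime encodeJ (encodeInstance (Turán k p) ∘ h)) where
    open Uniform encodeJ (n ∘ h)
    open UniformWord

    private
      Nn : UniformNumber (n ∘ h)
      Nn = reindexNumber h H numberᵤ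

      Bᵤ : UniformNumber (λ a → vertexBits (suc k) (n (h a)))
      Bᵤ = vertexBitsᵤ′ Nn

    endᵤ₁ : ∀ {j : ∀ a → Word (indexBits (suc k) (n (h a)))} → UniformWord j →
      UniformWord (λ a → proj₁ (e′ (n (h a)) (E (h a)) (j a)))
    endᵤ₁ {j} X = record { digits = congₚ
      (λ a → cong encodeWord (eval-low≡take (vertexBits (suc k) (n (h a))) (eval (edges (n (h a)) (E (h a))) (j a))))
      (digits (evalᵤ (lowᵤ _ Bᵤ) (evalᵤ (reindexCircuit h H E′ᵤ) X))) }

    endᵤ₂ : ∀ {j : ∀ a → Word (indexBits (suc k) (n (h a)))} → UniformWord j →
      UniformWord (λ a → proj₂ (e′ (n (h a)) (E (h a)) (j a)))
    endᵤ₂ {j} X = record { digits = congₚ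
      (λ a → cong encodeWord (eval-high≡drop (vertexBits (suc k) (n (h a))) (eval (edges (n (h a)) (E (h a))) (j a))))
      (digits (evalᵤ (highᵤ Bᵤ Bᵤ) (evalᵤ (reindexCircuit h H E′ᵤ) X))) }

    newᵤ : ∀ {j : ∀ a → Word (indexBits (suc k) (n (h a)))} → UniformWord j →
      UniformBool (λ a → isNewIndex (n (h a)) (j a))
    newᵤ {j} X = congₚ (λ a → cong (leftOf ∘ encodeWord) (eval-isNew {n (h a)} (j a))) (leftₚ (digits (evalᵤ (isNewᵤ Nn) X)))

    -- The default `d` varies in the recursion, because each old edge passes on its first end as the
    -- next default.
    pickᵤ : ∀ {d : ∀ a → Word (vertexBits (suc k) (n (h a)))} → UniformWord d →
      ∀ {m} {is : ∀ a → Vec (Word (indexBits (suc k) (n (h a)))) m} →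
      PolyTime encodeJ (λ a → encodeVec encodeWord (is a)) →
      UniformWord (λ a → pick (n (h a)) (E (h a)) (d a) (is a))
    pickᵤ {d} D {zero} {is} X = record { digits = congₚ (λ a → pick-[] (n (h a)) (E (h a)) (d a) (is a)) (digits D) }
      where
      pick-[] : ∀ n E d is → encodeWord d ≡ encodeWord (pick n E d is)
      pick-[] n E d [] = refl
    pickᵤ {d} D {suc m} {is} X = record { digits = congₚ (λ a → pick-∷ (n (h a)) (E (h a)) (d a) (is a))
      (ifₚ (newᵤ first) (digits (endᵤ₂ first)) (digits (pickᵤ (endᵤ₁ first) (tailₚ encodeJ (n ∘ h) X)))) }
      where
      first = headₚ encodeJ (n ∘ h) X
      pick-∷ : ∀ n E d (is : Vec (Word (indexBits (suc k) n)) (suc m)) →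
        ifT (encodeBool (isNewIndex n (head is))) (encodeWord (proj₂ (e′ n E (head is))))
          (encodeWord (pick n E (proj₁ (e′ n E (head is))) (tail is))) ≡
        encodeWord (pick n E d is)
      pick-∷ n E d (i ∷ is) = if-app encodeWord (isNewIndex n i) _ _

    avoidsᵤ : ∀ {w : ∀ a → Word (vertexBits (suc k) (n (h a)))} → UniformWord w →
      ∀ {j : ∀ a → Word (indexBits (suc k) (n (h a)))} → UniformWord j →
      UniformBool (λ a → avoids (n (h a)) (E (h a)) (w a) (j a))
    avoidsᵤ {w} W {j} X = congₚ (λ a → combine (does (proj₁ (e′ (n (h a)) (E (h a)) (j a)) ≟ʷ w a)) _)
      (ifₚ (equalᵤ (endᵤ₁ X) W) leafₚ (notₚ (equalᵤ (endᵤ₂ X) W)))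
      where
      combine : ∀ b c → ifT (encodeBool b) leaf (notT (encodeBool c)) ≡ encodeBool (if b then false else ¬ᵇ c)
      combine true  c = refl
      combine false c = not-encode c

    remainingₚ : ∀ {m} {is : ∀ a → Vec (Word (indexBits (suc k) (n (h a)))) m} →
      PolyTime encodeJ (λ a → encodeVec encodeWord (is a)) →
      PolyTime encodeJ (λ a → encodeVec encodeWord (remaining (n (h a)) (E (h a)) (noVertex (n (h a)) (E (h a))) (is a)))
    remainingₚ X = keepₚ encodeJ (n ∘ h) _ (λ a → stripped {n (h a)}) (avoidsᵤ (pickᵤ (zerosᵤ Bᵤ) X)) (strippedᵤ Nn) X

  reduction : Reduces (Turán k p) (Turán (suc k) q)
  reduction = record
    { f = extended
    ; g = pullBack
    ; f-polyTime = extendedₚ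
    ; g-polyTime = turánSolutionsₚ (encodeInstance (Turán k p)) extended
        (λ (I , s) → encodeTuránSolution k p (pullBack I s))
        (nodeₚ leafₚ (digits (strippedᵤ (reindexNumber proj₁ (leftₚ idₚ) numberᵤ) (record { digits = rightₚ (rightₚ idₚ) }))))
        (nodeₚ (constₚ (encodeℕ 1)) (nodeₚ
          (digits (strippedᵤ (reindexNumber proj₁ (leftₚ idₚ) numberᵤ) (record { digits = leftₚ (rightₚ (rightₚ idₚ)) })))
          (digits (strippedᵤ (reindexNumber proj₁ (leftₚ idₚ) numberᵤ) (record { digits = rightₚ (rightₚ (rightₚ idₚ)) })))))
        (nodeₚ (constₚ (encodeℕ 2)) (remainingₚ proj₁ (leftₚ idₚ) (rightₚ (rightₚ idₚ))))
        (λ _ _ _ _ → refl)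
        (λ _ _ _ _ _ _ _ → refl)
        (λ I is is≤ u c → cong (node (encodeℕ 2)) (encode-subst I (oldClique-count (n I) (E I) (E-inRange I) is is≤ u c) _))
    }
    where open Uniform.UniformWord

theorem11 : (Collision ≤ₚ BadColoring 2 × PPP-Hard (BadColoring 2)) ×
    ((∀ k → 2 ≤ k → BadColoring k ≤ₚ Turán k) × BadColoring 2 ≤ₚ Mantel) ×
    (∀ k → 2 ≤ k → BadColoring k ≤ₚ BadColoring (suc k)) ×
    (∀ k → 2 ≤ k → Turán k ≤ₚ Turán (suc k))
theorem11 =
  ((λ p → CollisionToColoring.q p , CollisionToColoring.reduction p) ,
   (λ A (p , R) → CollisionToColoring.q p , Reduces-trans R (CollisionToColoring.reduction p))) ,
  -- Forgetting the colouring leaves `E` as it is, so the size bound `p` serves for both problems.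
  ((λ where (suc k) _ p → p , ColoringToTurán.reduction k p) ,
   (λ p → p , ColoringToTurán.reduction 1 p)) ,
  (λ k _ p → ColoringToColoring.q k p , ColoringToColoring.reduction k p) ,
  (λ k _ p → TuránToTurán.q k p , TuránToTurán.reduction k p)
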